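{- Let $\Psi_{\mathbf{HGP}}:\mathbf{HGP}\to QSym$ be the linear map sending a hypergraphic polytope $\mathfrak{q}\subseteq\mathbb{R}^n$ to $\Psi_{\mathbf{HGP}}(\mathfrak{q})=\sum_f\prod_{i=1}^n x_{f(i)}$, the sum running over all $\mathfrak{q}$-generic functions $f:[n]\to\mathbb{N}$. Then the linear space $\ker\Psi_{\mathbf{HGP}}$ is generated (spanned) by the simple relations, the modular relations and the isomorphism relations on hypergraphic polytopes. The image of $\Psi_{\mathbf{HGP}}$ is $QSym$.
   Context: $\mathbb{K}$ is a field of characteristic zero; $\mathbb{N}=\{1,2,\dots\}$, $[n]=\{1,\dots,n\}$. $QSym$ is the $\mathbb{K}$-algebra of quasisymmetric functions in the commuting variables $x_1,x_2,\dots$. Polytopes. For non-empty $J\subseteq[n]$ let $\mathfrak{s}_J=\mathrm{conv}\{e_j : j\in J\}\subseteq\mathbb{R}^n$. A hypergraphic polytope in $\mathbb{R}^n$ is a Minkowski sum $\mathfrak{q}=\sum_{\emptyset\ne J\subseteq[n]}a_J\mathfrak{s}_J$ with real $a_J\ge0$ (the empty sum is $\{0\}$). The $a_J$ are determined by $\mathfrak{q}$, and $\mathcal{F}(\mathfrak{q})=\{J : a_J>0\}$. For a family $\mathcal{A}$ of non-empty subsets of $[n]$, $\mathcal{F}^{ -1}(\mathcal{A})=\sum_{J\in\mathcal{A}}\mathfrak{s}_J$. $\mathbf{HGP}=\bigoplus_{n\ge0}\mathbf{HGP}_n$, with $\mathbf{HGP}_n$ the $\mathbb{K}$-vector space freely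 generated by the hypergraphic polytopes in $\mathbb{R}^n$. A function $f:[n]\to\mathbb{N}$ is $\mathfrak{q}$-generic if the face of $\mathfrak{q}$ on which $x\mapsto\sum_i f(i)x_i$ is minimized is a point. Set compositions. $\mathbf{C}_n$ is the set of set compositions $\vec{\boldsymbol{\pi}}=S_1|\cdots|S_k$ of $[n]$ (ordered lists of non-empty disjoint sets with union $[n]$). For non-empty $A\subseteq[n]$, $A_{\vec{\boldsymbol{\pi}}}=A\cap S_i$ with $i$ the smallest index such that $A\cap S_i\neq\emptyset$. Relations. A simple relation is $\mathfrak{q}_1-\mathfrak{q}_2\in\mathbf{HGP}$ (formal difference) with $\mathfrak{q}_1,\mathfrak{q}_2$ hypergraphic polytopes in the same $\mathbb{R}^n$ and $\mathcal{F}(\mathfrak{q}_1)=\mathcal{F}(\mathfrak{q}_2)$. For non-empty $A\subseteq[n]$ let $\mathrm{Orth}\,A=\{\vec{\boldsymbol{\pi}}\in\mathbf{C}_n : \#A_{\vec{\boldsymbol{\pi}}}=1\}$. Given disjoint families $\mathcal{A},\mathcal{B}$ of non-empty subsets of $[n]$ with $\bigcup_{A\in\mathcal{A}}(\mathrm{Orth}\,A)^c\cup\bigcup_{B\in\mathcal{B}}\mathrm{Orth}\,B=\mathbf{C}_n$, the corresponding modular relation is the formal linear combination $\sum_{\mathcal{T}\subseteq\mathcal{B}}(-1)^{\#\mathcal{T}}\big[\mathcal{F}^{ -1}(\mathcal{A})+\mathcal{F}^{ -1}(\mathcal{T})\big]\in\mathbf{HGP}_n$, where the sum inside the brackets is a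 Minkowski sum. An isomorphism relation is $\mathfrak{q}_1-\mathfrak{q}_2\in\mathbf{HGP}$ where $\mathfrak{q}_1,\mathfrak{q}_2$ are hypergraphic polytopes in the same $\mathbb{R}^n$ and $\mathfrak{q}_1$ is obtained from $\mathfrak{q}_2$ by a permutation of the coordinates. -}

module Defs where

open import Level using (Level; 0ℓ; _⊔_) renaming (suc to lsuc)
open import Algebra.Bundles using (CommutativeRing)
import Algebra.Properties.CommutativeMonoid.Sum as Sums
import Algebra.Properties.Ring as RingProperties
import Algebra.Properties.Semiring.Exp as Exponentiation
import Algebra.Properties.Semiring.Sum as SemiringSum
open import Axiom.ExcludedMiddle using (ExcludedMiddle)
open import Data.Bool.Base using (if_then_else_)
import Data.Bool.Properties as Bool
open import Data.Empty using (⊥-elim)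
open import Data.Fin.Base using (Fin; zero; suc; splitAt) renaming (_<_ to _<ᶠ_)
open import Data.Fin.Permutation using (Permutation′; _⟨$⟩ʳ_)
import Data.Fin.Properties as Fin
open import Data.Fin.Subset
  using (Subset; inside; outside; Nonempty; Empty; ∣_∣; _∩_; ⋃; ⊤; ⊥)
  renaming (_∈_ to _∈ˢ_)
open import Data.Fin.Subset.Properties using (nonempty?)
open import Data.List.Base as List
  using (List; []; _∷_; _++_; length; map; foldr; filter; upTo; cartesianProductWith)
open import Data.List.Membership.Propositional using () renaming (_∈_ to _∈ᴸ_)
import Data.List.Membership.DecPropositional as DecMembership
open import Data.List.Properties using (filter-≐)
open import Data.List.Relation.Binary.Disjoint.Propositional using (Disjoint)
open import Data.List.Relation.Binary.Permutation.Propositional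
  using (_↭_; ↭-setoid; ↭-sym; ↭-trans; ↭⇒↭ₛ)
import Data.List.Relation.Binary.Permutation.Setoid.Properties as Permutation
open import Data.List.Relation.Unary.All using (All)
open import Data.List.Relation.Unary.AllPairs using (AllPairs)
open import Data.List.Relation.Unary.Unique.Propositional using (Unique)
open import Data.Nat.Base as ℕ using (ℕ; zero; suc)
import Data.Nat.Properties as ℕ
open import Data.Product.Base using (Σ; ∃; ∃-syntax; _×_; _,_; proj₁; proj₂)
open import Data.Sum.Base using (_⊎_; inj₁; inj₂)
open import Data.Vec.Base as Vec using (Vec; []; _∷_; lookup; toList)
import Data.Vec.Functional as Vector
open Vector using (Vector)
import Data.Vec.Properties as Vec
open import Function.Base using (_∘_)
open import Function.Bundles using (Func; _⟨$⟩_; _⇔_)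
open import Relation.Binary.Core using (Rel)
open import Relation.Binary.PropositionalEquality as ≡ using (_≡_)
import Relation.Binary.Reasoning.Setoid as SetoidReasoning
open import Relation.Binary.Structures using (IsTotalOrder)
open import Relation.Nullary using (¬_; Dec; yes; no; does)
open import Relation.Unary using (Pred; Satisfiable; _≐_)

module _ {c ℓ : Level} (R : CommutativeRing c ℓ) where
  open CommutativeRing R
  open import Algebra.Definitions.RawMonoid +-rawMonoid using () renaming (_×_ to _×ℕ_)

  record IsField : Set (c ⊔ ℓ) where
    field
      0≉1     : ¬ (0# ≈ 1#)
      inverse : ∀ x → ¬ (x ≈ 0#) → ∃[ y ] x * y ≈ 1#

  CharacteristicZero : Set ℓ
  CharacteristicZero = ∀ n → ¬ (suc n ×ℕ 1# ≈ 0#)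

-- The library has no real numbers. They are axiomatised as a complete
-- ordered field, which determines them up to unique isomorphism.

record RealNumbers : Set (lsuc 0ℓ) where
  infix 4 _≤_ _<_
  field
    commutativeRing : CommutativeRing 0ℓ 0ℓ
    isField         : IsField commutativeRing
  open CommutativeRing commutativeRing public hiding (zero)
  open IsField isField public
  field
    _≤_          : Rel Carrier 0ℓ
    isTotalOrder : IsTotalOrder _≈_ _≤_
    +-monoˡ-≤    : ∀ z {x y} → x ≤ y → x + z ≤ y + z
    *-nonneg     : ∀ {x y} → 0# ≤ x → 0# ≤ y → 0# ≤ x * y

  UpperBound : Pred Carrier 0ℓ → Pred Carrier 0ℓ
  UpperBound S b = ∀ x → S x → x ≤ b

  field
    complete : ∀ S → Satisfiable S → Satisfiable (UpperBound S) →
               ∃[ s ] UpperBound S s × (∀ b → UpperBound S b → s ≤ b)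

  _<_ : Rel Carrier 0ℓ
  x < y = x ≤ y × ¬ (x ≈ y)

  open IsTotalOrder isTotalOrder public
    using (total; antisym; ≤-respˡ-≈; ≤-respʳ-≈)
    renaming (refl to ≤-refl; reflexive to ≤-reflexive; trans to ≤-trans)

  open RingProperties ring using (-‿distribʳ-*; -‿involutive)

  +-nonneg : ∀ {x y} → 0# ≤ x → 0# ≤ y → 0# ≤ x + y
  +-nonneg {x} {y} 0≤x 0≤y = ≤-trans 0≤y (≤-respˡ-≈ (+-identityˡ y) (+-monoˡ-≤ y 0≤x))

  neg-nonneg : ∀ {x} → x ≤ 0# → 0# ≤ - x
  neg-nonneg {x} x≤0 =
    ≤-respˡ-≈ (-‿inverseʳ x) (≤-respʳ-≈ (+-identityˡ (- x)) (+-monoˡ-≤ (- x) x≤0))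

  0≤1 : 0# ≤ 1#
  0≤1 with total 0# 1#
  ... | inj₁ p = p
  ... | inj₂ p = ≤-respʳ-≈ (trans (trans (sym (-‿distribʳ-* (- 1#) 1#))
                    (-‿cong (*-identityʳ (- 1#)))) (-‿involutive 1#))
                  (*-nonneg (neg-nonneg p) (neg-nonneg p))

  inverse-nonneg : ∀ {x y} → 0# ≤ x → x * y ≈ 1# → 0# ≤ y
  inverse-nonneg {x} {y} 0≤x xy≈1 with total 0# y
  ... | inj₁ p = p
  ... | inj₂ p = ⊥-elim (0≉1 (antisym 0≤1 1≤0))
    where
    0≤-1 : 0# ≤ - 1#
    0≤-1 = ≤-respʳ-≈ (trans (sym (-‿distribʳ-* x y)) (-‿cong xy≈1))
             (*-nonneg 0≤x (neg-nonneg p))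
    1≤0 : 1# ≤ 0#
    1≤0 = ≤-respˡ-≈ (+-identityˡ 1#) (≤-respʳ-≈ (-‿inverseˡ 1#) (+-monoˡ-≤ 1# 0≤-1))

subsets : ∀ n → List (Subset n)
subsets zero    = [] ∷ []
subsets (suc n) = map (inside ∷_) (subsets n) ++ map (outside ∷_) (subsets n)

nonemptySubsets : ∀ n → List (Subset n)
nonemptySubsets n = filter nonempty? (subsets n)

record Family (n : ℕ) : Set where
  field
    members  : List (Subset n)
    unique   : Unique members
    nonempty : All Nonempty members

open Family public

-- For a list without repetitions, these are the subsets of its set of
-- entries, each listed exactly once.
sublists : ∀ {a} {A : Set a} → List A → List (List A)
sublists []       = [] ∷ []
sublists (x ∷ xs) = map (x ∷_) (sublists xs) ++ sublists xs

record SetComposition (n : ℕ) : Set where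
  field
    blocks   : List (Subset n)
    nonempty : All Nonempty blocks
    disjoint : AllPairs (λ S T → Empty (S ∩ T)) blocks
    covers   : ⋃ blocks ≡ ⊤

firstIntersection : ∀ {n} → Subset n → List (Subset n) → Subset n
firstIntersection A []       = ⊥
firstIntersection A (S ∷ Ss) =
  if does (nonempty? (A ∩ S)) then A ∩ S else firstIntersection A Ss

Orth : ∀ {n} → Subset n → Pred (SetComposition n) 0ℓ
Orth A π = ∣ firstIntersection A (SetComposition.blocks π) ∣ ≡ 1

module Polytopes (ℝ : RealNumbers) where
  open RealNumbers ℝ
  open Sums +-commutativeMonoid using (sum; sum-cong-≋)
  open SemiringSum semiring using (*-distribˡ-sum)
  open import Algebra.Definitions.RawMonoid +-rawMonoid using () renaming (_×_ to _×ℕ_)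
  private module ≈-Reasoning = SetoidReasoning setoid

  Point : ℕ → Set
  Point n = Vector Carrier n

  infix 4 _≈ₚ_
  _≈ₚ_ : ∀ {n} → Rel (Point n) 0ℓ
  x ≈ₚ y = ∀ i → x i ≈ y i

  basis : ∀ {n} → Fin n → Point n
  basis j i = if does (i Fin.≟ j) then 1# else 0#

  ConvexHull : ∀ {n} → Pred (Point n) 0ℓ → Pred (Point n) 0ℓ
  ConvexHull S x =
    ∃[ k ] Σ (Vector Carrier k) λ t → Σ (Vector (Point _) k) λ v →
      (∀ i → 0# ≤ t i) × (∀ i → S (v i)) × sum t ≈ 1# ×
      (∀ j → x j ≈ sum (λ i → t i * v i j))

  vertices : ∀ {n} → Subset n → Pred (Point n) 0ℓ
  vertices J v = ∃[ j ] j ∈ˢ J × v ≈ₚ basis j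

  simplex : ∀ {n} → Subset n → Pred (Point n) 0ℓ
  simplex J = ConvexHull (vertices J)

  infixl 6 _⊞_
  infixl 7 _⊙_

  origin : ∀ {n} → Pred (Point n) 0ℓ
  origin x = ∀ i → x i ≈ 0#

  _⊞_ : ∀ {n} → Pred (Point n) 0ℓ → Pred (Point n) 0ℓ → Pred (Point n) 0ℓ
  (P ⊞ Q) x = ∃[ y ] ∃[ z ] P y × Q z × (∀ i → x i ≈ y i + z i)

  _⊙_ : ∀ {n} → Carrier → Pred (Point n) 0ℓ → Pred (Point n) 0ℓ
  (a ⊙ P) x = ∃[ y ] P y × (∀ i → x i ≈ a * y i)

  minkowskiSum : ∀ {n} → List (Pred (Point n) 0ℓ) → Pred (Point n) 0ℓ
  minkowskiSum = foldr _⊞_ origin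

  -- A hypergraphic polytope is given by its coefficients; equality of
  -- polytopes is equality of their sets of points ⟦_⟧. The coefficient of the
  -- empty set plays no role: ⟦_⟧ and 𝓕 ignore it.
  record HypergraphicPolytope (n : ℕ) : Set where
    field
      coefficient : Subset n → Carrier
      nonneg      : ∀ J → 0# ≤ coefficient J

  open HypergraphicPolytope public

  ⟦_⟧ : ∀ {n} → HypergraphicPolytope n → Pred (Point n) 0ℓ
  ⟦_⟧ {n} 𝔮 = minkowskiSum (map (λ J → coefficient 𝔮 J ⊙ simplex J) (nonemptySubsets n))

  𝓕 : ∀ {n} → HypergraphicPolytope n → Pred (Subset n) 0ℓ
  𝓕 𝔮 J = Nonempty J × 0# < coefficient 𝔮 J

  𝓕⁻¹ : ∀ {n} → List (Subset n) → HypergraphicPolytope n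
  𝓕⁻¹ 𝒜 = record
    { coefficient = λ J → if does (J ∈? 𝒜) then 1# else 0#
    ; nonneg      = λ J → indicator-nonneg (J ∈? 𝒜)
    }
    where
    open DecMembership (Vec.≡-dec Bool._≟_) using (_∈?_)
    indicator-nonneg : ∀ {P : Set} (d : Dec P) → 0# ≤ (if does d then 1# else 0#)
    indicator-nonneg (yes _) = 0≤1
    indicator-nonneg (no  _) = ≤-refl

  -- Adding coefficients is the Minkowski sum: see ⊕-isMinkowskiSum.
  infixl 6 _⊕_
  _⊕_ : ∀ {n} → HypergraphicPolytope n → HypergraphicPolytope n → HypergraphicPolytope n
  𝔭 ⊕ 𝔮 = record
    { coefficient = λ J → coefficient 𝔭 J + coefficient 𝔮 J
    ; nonneg      = λ J → +-nonneg (nonneg 𝔭 J) (nonneg 𝔮 J)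
    }

  private
    sum-++ : ∀ {k l} (s : Vector Carrier k) (t : Vector Carrier l) →
             sum (s Vector.++ t) ≈ sum s + sum t
    sum-++ {zero}  s t = sym (+-identityˡ _)
    sum-++ {suc k} s t = begin
      s zero + sum (λ i → (s Vector.++ t) (suc i))
        ≈⟨ +-congˡ (sum-cong-≋ λ i → reflexive (shift i)) ⟩
      s zero + sum ((s ∘ suc) Vector.++ t)
        ≈⟨ +-congˡ (sum-++ (s ∘ suc) t) ⟩
      s zero + (sum (s ∘ suc) + sum t)
        ≈⟨ +-assoc _ _ _ ⟨
      s zero + sum (s ∘ suc) + sum t ∎
      where
      open ≈-Reasoning
      shift : ∀ i → (s Vector.++ t) (suc i) ≡ ((s ∘ suc) Vector.++ t) i
      shift i with splitAt k i
      ... | inj₁ _ = ≡.refl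
      ... | inj₂ _ = ≡.refl

    +-interchange : ∀ a b c d → (a + b) + (c + d) ≈ (a + c) + (b + d)
    +-interchange a b c d = begin
      (a + b) + (c + d) ≈⟨ +-assoc a b (c + d) ⟩
      a + (b + (c + d)) ≈⟨ +-congˡ (+-assoc b c d) ⟨
      a + ((b + c) + d) ≈⟨ +-congˡ (+-congʳ (+-comm b c)) ⟩
      a + ((c + b) + d) ≈⟨ +-congˡ (+-assoc c b d) ⟩
      a + (c + (b + d)) ≈⟨ +-assoc a c (b + d) ⟨
      (a + c) + (b + d) ∎
      where open ≈-Reasoning

    module _ {n} {S : Pred (Point n) 0ℓ} where
      convex : ∀ {α β y z} → 0# ≤ α → 0# ≤ β → α + β ≈ 1# →
               ConvexHull S y → ConvexHull S z →
               ConvexHull S (λ j → α * y j + β * z j)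
      convex {α} {β} {y} {z} 0≤α 0≤β α+β≈1
        (k , s , v , s≥0 , v∈S , ∑s≈1 , y≈) (l , t , w , t≥0 , w∈S , ∑t≈1 , z≈) =
          k ℕ.+ l , αs Vector.++ βt , v Vector.++ w ,
          nonneg′ , inS , ∑≈1 , point
        where
        open ≈-Reasoning
        αs : Vector Carrier k
        αs i = α * s i
        βt : Vector Carrier l
        βt i = β * t i
        nonneg′ : ∀ i → 0# ≤ (αs Vector.++ βt) i
        nonneg′ i with splitAt k i
        ... | inj₁ i′ = *-nonneg 0≤α (s≥0 i′)
        ... | inj₂ i′ = *-nonneg 0≤β (t≥0 i′)
        inS : ∀ i → S ((v Vector.++ w) i)
        inS i with splitAt k i
        ... | inj₁ i′ = v∈S i′
        ... | inj₂ i′ = w∈S i′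
        ∑≈1 : sum (αs Vector.++ βt) ≈ 1#
        ∑≈1 = begin
          sum (αs Vector.++ βt)   ≈⟨ sum-++ αs βt ⟩
          sum αs + sum βt         ≈⟨ +-cong (*-distribˡ-sum α s) (*-distribˡ-sum β t) ⟨
          α * sum s + β * sum t   ≈⟨ +-cong (*-congˡ ∑s≈1) (*-congˡ ∑t≈1) ⟩
          α * 1# + β * 1#         ≈⟨ +-cong (*-identityʳ α) (*-identityʳ β) ⟩
          α + β                   ≈⟨ α+β≈1 ⟩
          1#                      ∎
        scaled : ∀ {m} γ (u : Vector Carrier m) (p : Vector (Point n) m) {x} j →
                 x ≈ sum (λ i → u i * p i j) → γ * x ≈ sum (λ i → (γ * u i) * p i j)
        scaled γ u p {x} j x≈ = begin
          γ * x                           ≈⟨ *-congˡ x≈ ⟩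
          γ * sum (λ i → u i * p i j)     ≈⟨ *-distribˡ-sum γ (λ i → u i * p i j) ⟩
          sum (λ i → γ * (u i * p i j))   ≈⟨ sum-cong-≋ (λ i → *-assoc γ (u i) (p i j)) ⟨
          sum (λ i → (γ * u i) * p i j)   ∎
        point : ∀ j → α * y j + β * z j ≈
                sum (λ i → (αs Vector.++ βt) i * (v Vector.++ w) i j)
        point j = begin
          α * y j + β * z j
            ≈⟨ +-cong (scaled α s v j (y≈ j)) (scaled β t w j (z≈ j)) ⟩
          sum (λ i → αs i * v i j) + sum (λ i → βt i * w i j)
            ≈⟨ sum-++ (λ i → αs i * v i j) (λ i → βt i * w i j) ⟨
          sum ((λ i → αs i * v i j) Vector.++ (λ i → βt i * w i j))
            ≈⟨ sum-cong-≋ split ⟩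
          sum (λ i → (αs Vector.++ βt) i * (v Vector.++ w) i j) ∎
          where
          split : ∀ i → ((λ i → αs i * v i j) Vector.++ (λ i → βt i * w i j)) i ≈
                        (αs Vector.++ βt) i * (v Vector.++ w) i j
          split i with splitAt k i
          ... | inj₁ _ = refl
          ... | inj₂ _ = refl

      ⊙-distrib-⊞ : ExcludedMiddle 0ℓ → ∀ {a b} → 0# ≤ a → 0# ≤ b →
                    (a ⊙ ConvexHull S) ⊞ (b ⊙ ConvexHull S) ≐ (a + b) ⊙ ConvexHull S
      ⊙-distrib-⊞ em {a} {b} 0≤a 0≤b = to , from
        where
        open ≈-Reasoning
        from : ∀ {x} → ((a + b) ⊙ ConvexHull S) x →
               ((a ⊙ ConvexHull S) ⊞ (b ⊙ ConvexHull S)) x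
        from (y , y∈ , x≈) =
          (λ j → a * y j) , (λ j → b * y j) ,
          (y , y∈ , λ _ → refl) , (y , y∈ , λ _ → refl) ,
          λ j → trans (x≈ j) (distribʳ (y j) a b)
        to : ∀ {x} → ((a ⊙ ConvexHull S) ⊞ (b ⊙ ConvexHull S)) x →
             ((a + b) ⊙ ConvexHull S) x
        to {x} (_ , _ , (y , y∈ , p≈) , (z , z∈ , q≈) , x≈) with em {P = a + b ≈ 0#}
        ... | yes a+b≈0 = y , y∈ , λ j → begin
          x j                 ≈⟨ trans (x≈ j) (+-cong (p≈ j) (q≈ j)) ⟩
          a * y j + b * z j   ≈⟨ +-congˡ (trans (*-congʳ b≈0) (zeroˡ _)) ⟩
          a * y j + 0#        ≈⟨ +-congˡ (trans (*-congʳ b≈0) (zeroˡ _)) ⟨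
          a * y j + b * y j   ≈⟨ distribʳ (y j) a b ⟨
          (a + b) * y j       ∎
          where
          b≈0 : b ≈ 0#
          b≈0 = antisym (≤-respˡ-≈ (+-identityˡ b) (≤-respʳ-≈ a+b≈0 (+-monoˡ-≤ b 0≤a))) 0≤b
        ... | no a+b≉0 with inverse (a + b) a+b≉0
        ...   | u , [a+b]u≈1 =
          (λ j → (u * a) * y j + (u * b) * z j) ,
          convex (*-nonneg 0≤u 0≤a) (*-nonneg 0≤u 0≤b)
            (trans (sym (distribˡ u a b)) (trans (*-comm u (a + b)) [a+b]u≈1)) y∈ z∈ ,
          λ j → begin
            x j                                           ≈⟨ trans (x≈ j) (+-cong (p≈ j) (q≈ j)) ⟩
            a * y j + b * z j                             ≈⟨ +-cong (cancel a (y j)) (cancel b (z j)) ⟩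
            (a + b) * ((u * a) * y j) + (a + b) * ((u * b) * z j)
                                                          ≈⟨ distribˡ (a + b) _ _ ⟨
            (a + b) * ((u * a) * y j + (u * b) * z j)     ∎
          where
          0≤u : 0# ≤ u
          0≤u = inverse-nonneg (+-nonneg 0≤a 0≤b) [a+b]u≈1
          cancel : ∀ d e → d * e ≈ (a + b) * ((u * d) * e)
          cancel d e = begin
            d * e                     ≈⟨ *-identityˡ (d * e) ⟨
            1# * (d * e)              ≈⟨ *-congʳ [a+b]u≈1 ⟨
            ((a + b) * u) * (d * e)   ≈⟨ *-assoc (a + b) u (d * e) ⟩
            (a + b) * (u * (d * e))   ≈⟨ *-congˡ (*-assoc u d e) ⟨
            (a + b) * ((u * d) * e)   ∎

  ⊕-isMinkowskiSum : ExcludedMiddle 0ℓ → ∀ {n} (𝔭 𝔮 : HypergraphicPolytope n) →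
                     ⟦ 𝔭 ⊕ 𝔮 ⟧ ≐ ⟦ 𝔭 ⟧ ⊞ ⟦ 𝔮 ⟧
  ⊕-isMinkowskiSum em {n} 𝔭 𝔮 = to (nonemptySubsets n) , from (nonemptySubsets n)
    where
    scalars-+ : ∀ J → (coefficient 𝔭 J ⊙ simplex J) ⊞ (coefficient 𝔮 J ⊙ simplex J) ≐
                      (coefficient 𝔭 J + coefficient 𝔮 J) ⊙ simplex J
    scalars-+ J = ⊙-distrib-⊞ {S = vertices J} em (nonneg 𝔭 J) (nonneg 𝔮 J)
    ∑ : List (Subset n) → HypergraphicPolytope n → Pred (Point n) 0ℓ
    ∑ Js 𝔯 = minkowskiSum (map (λ J → coefficient 𝔯 J ⊙ simplex J) Js)
    regroup : ∀ {x y z y₁ y₂ z₁ z₂} → x ≈ y + z → y ≈ y₁ + y₂ → z ≈ z₁ + z₂ →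
              x ≈ (y₁ + z₁) + (y₂ + z₂)
    regroup x≈ y≈ z≈ = trans x≈ (trans (+-cong y≈ z≈) (+-interchange _ _ _ _))
    to : ∀ Js {x} → ∑ Js (𝔭 ⊕ 𝔮) x → (∑ Js 𝔭 ⊞ ∑ Js 𝔮) x
    to []       x≈0 = _ , _ , (λ _ → refl) , (λ _ → refl) ,
                      λ i → trans (x≈0 i) (sym (+-identityˡ 0#))
    to (J ∷ Js) (y , z , y∈ , z∈ , x≈) with proj₂ (scalars-+ J) y∈ | to Js z∈
    ... | y₁ , y₂ , y₁∈ , y₂∈ , y≈ | z₁ , z₂ , z₁∈ , z₂∈ , z≈ =
      _ , _ , (y₁ , z₁ , y₁∈ , z₁∈ , λ _ → refl) , (y₂ , z₂ , y₂∈ , z₂∈ , λ _ → refl) ,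
      λ i → regroup (x≈ i) (y≈ i) (z≈ i)
    from : ∀ Js {x} → (∑ Js 𝔭 ⊞ ∑ Js 𝔮) x → ∑ Js (𝔭 ⊕ 𝔮) x
    from []       (_ , _ , y≈0 , z≈0 , x≈) i =
      trans (x≈ i) (trans (+-cong (y≈0 i) (z≈0 i)) (+-identityˡ 0#))
    from (J ∷ Js) (_ , _ , (y₁ , z₁ , y₁∈ , z₁∈ , y≈) , (y₂ , z₂ , y₂∈ , z₂∈ , z≈) , x≈) =
      _ , _ ,
      proj₁ (scalars-+ J) (y₁ , y₂ , y₁∈ , y₂∈ , λ _ → refl) ,
      from Js (z₁ , z₂ , z₁∈ , z₂∈ , λ _ → refl) ,
      λ i → regroup (x≈ i) (y≈ i) (z≈ i)

  -- A function [n] → {1, 2, …} is a vector f of natural numbers, an entry k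
  -- standing for the positive integer suc k, both as a weight here and as the
  -- index of a variable below.
  linearFunctional : ∀ {n} → Vec ℕ n → Point n → Carrier
  linearFunctional f x = sum (λ i → suc (lookup f i) ×ℕ x i)

  face : ∀ {n} → HypergraphicPolytope n → Vec ℕ n → Pred (Point n) 0ℓ
  face 𝔮 f x = ⟦ 𝔮 ⟧ x × (∀ y → ⟦ 𝔮 ⟧ y → linearFunctional f x ≤ linearFunctional f y)

  IsGeneric : ∀ {n} → HypergraphicPolytope n → Pred (Vec ℕ n) 0ℓ
  IsGeneric 𝔮 f = ∃[ x ] face 𝔮 f x × (∀ y → face 𝔮 f y → y ≈ₚ x)

-- The monomial x_{suc i₁} ⋯ x_{suc i_d} is the list i₁ ∷ … ∷ i_d ∷ [],
-- taken up to permutation _↭_.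
Monomial : Set
Monomial = List ℕ

module Series {c ℓ : Level} (K : CommutativeRing c ℓ) where
  private module K = CommutativeRing K

  PowerSeries : Set (c ⊔ ℓ)
  PowerSeries = Func (↭-setoid {A = ℕ}) K.setoid

  infix 4 _≈ˢ_
  _≈ˢ_ : Rel PowerSeries ℓ
  F ≈ˢ G = ∀ m → (F ⟨$⟩ m) K.≈ (G ⟨$⟩ m)

  0ˢ : PowerSeries
  0ˢ = record { to = λ _ → K.0# ; cong = λ _ → K.refl }

  infixl 6 _+ˢ_
  _+ˢ_ : PowerSeries → PowerSeries → PowerSeries
  F +ˢ G = record
    { to   = λ m → (F ⟨$⟩ m) K.+ (G ⟨$⟩ m)
    ; cong = λ m↭m′ → K.+-cong (Func.cong F m↭m′) (Func.cong G m↭m′)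
    }

  infixr 7 _·ˢ_
  _·ˢ_ : K.Carrier → PowerSeries → PowerSeries
  a ·ˢ F = record
    { to   = λ m → a K.* (F ⟨$⟩ m)
    ; cong = λ m↭m′ → K.*-congˡ (Func.cong F m↭m′)
    }

  StrictlyIncreasing : ∀ {k} → Vector ℕ k → Set
  StrictlyIncreasing i = ∀ {s t} → s <ᶠ t → i s ℕ.< i t

  -- x_{i₁}^{α₁} ⋯ x_{i_k}^{α_k}
  powerProduct : ∀ {k} → Vector ℕ k → Vector ℕ k → Monomial
  powerProduct i α = List.concat (List.tabulate λ t → List.replicate (α t) (i t))

  record IsQuasisymmetric (F : PowerSeries) : Set ℓ where
    field
      boundedDegree  : ∃[ d ] (∀ m → d ℕ.< length m → (F ⟨$⟩ m) K.≈ K.0#)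
      quasisymmetric : ∀ {k} (α i j : Vector ℕ k) → (∀ t → 0 ℕ.< α t) →
                       StrictlyIncreasing i → StrictlyIncreasing j →
                       (F ⟨$⟩ powerProduct i α) K.≈ (F ⟨$⟩ powerProduct j α)

boundedFunctions : ∀ n → ℕ → List (Vec ℕ n)
boundedFunctions zero    N = [] ∷ []
boundedFunctions (suc n) N = cartesianProductWith _∷_ (upTo N) (boundedFunctions n N)

-- Strictly larger than every index of a variable occurring in m.
variableBound : Monomial → ℕ
variableBound m = suc (foldr ℕ._⊔_ 0 m)

variableBound-↭ : ∀ {m m′} → m ↭ m′ → variableBound m ≡ variableBound m′
variableBound-↭ m↭m′ =
  ≡.cong suc (Permutation.foldr-commMonoid (≡.setoid ℕ) ℕ.⊔-0-isCommutativeMonoid (↭⇒↭ₛ m↭m′))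

-- Excluded middle is needed to count generic functions.
module HGPSpace
  (em : ExcludedMiddle 0ℓ) {c ℓ : Level} (K : CommutativeRing c ℓ) (ℝ : RealNumbers)
  where

  private module K = CommutativeRing K
  open Polytopes ℝ
  open Series K public
  open import Algebra.Definitions.RawMonoid K.+-rawMonoid using () renaming (_×_ to _×ℕ_)
  open Exponentiation K.semiring using (_^_)

  -- Formal K-linear combinations of hypergraphic polytopes. Modulo _≈ᴴ_
  -- they form the vector space freely generated by the polytopes (as sets
  -- of points) in all dimensions, that is, the direct sum of the HGPₙ.
  infix  8 [_]
  infixr 7 _·_
  infixl 6 _+ᴴ_ _-ᴴ_
  infix  4 _≈ᴴ_

  data HGP : Set c where
    [_]  : ∀ {n} → HypergraphicPolytope n → HGP
    0ᴴ   : HGP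
    _+ᴴ_ : HGP → HGP → HGP
    _·_  : K.Carrier → HGP → HGP

  _-ᴴ_ : HGP → HGP → HGP
  x -ᴴ y = x +ᴴ (K.- K.1#) · y

  sumᴴ : List HGP → HGP
  sumᴴ = foldr _+ᴴ_ 0ᴴ

  data _≈ᴴ_ : HGP → HGP → Set (c ⊔ ℓ) where
    ≈-refl       : ∀ {x} → x ≈ᴴ x
    ≈-sym        : ∀ {x y} → x ≈ᴴ y → y ≈ᴴ x
    ≈-trans      : ∀ {x y z} → x ≈ᴴ y → y ≈ᴴ z → x ≈ᴴ z
    []-cong      : ∀ {n} {𝔭 𝔮 : HypergraphicPolytope n} → ⟦ 𝔭 ⟧ ≐ ⟦ 𝔮 ⟧ → [ 𝔭 ] ≈ᴴ [ 𝔮 ]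
    +-cong       : ∀ {x x′ y y′} → x ≈ᴴ x′ → y ≈ᴴ y′ → x +ᴴ y ≈ᴴ x′ +ᴴ y′
    ·-cong       : ∀ {a a′ x x′} → a K.≈ a′ → x ≈ᴴ x′ → a · x ≈ᴴ a′ · x′
    +-assoc      : ∀ x y z → (x +ᴴ y) +ᴴ z ≈ᴴ x +ᴴ (y +ᴴ z)
    +-comm       : ∀ x y → x +ᴴ y ≈ᴴ y +ᴴ x
    +-identityˡ  : ∀ x → 0ᴴ +ᴴ x ≈ᴴ x
    ·-zeroˡ      : ∀ x → K.0# · x ≈ᴴ 0ᴴ
    ·-identityˡ  : ∀ x → K.1# · x ≈ᴴ x
    ·-assoc      : ∀ a b x → (a K.* b) · x ≈ᴴ a · (b · x)
    ·-distribˡ   : ∀ a x y → a · (x +ᴴ y) ≈ᴴ a · x +ᴴ a · y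
    ·-distribʳ   : ∀ a b x → (a K.+ b) · x ≈ᴴ a · x +ᴴ b · x

  data Span {p} (P : Pred HGP p) : Pred HGP (c ⊔ ℓ ⊔ p) where
    generator : ∀ {x} → P x → Span P x
    zeroᴴ     : Span P 0ᴴ
    add       : ∀ {x y} → Span P x → Span P y → Span P (x +ᴴ y)
    scale     : ∀ a {x} → Span P x → Span P (a · x)
    resp      : ∀ {x y} → x ≈ᴴ y → Span P x → Span P y

  genericFunctions : ∀ {n} → HypergraphicPolytope n → Monomial → List (Vec ℕ n)
  genericFunctions {n} 𝔮 m =
    filter (λ f → em {P = IsGeneric 𝔮 f × toList f ↭ m}) (boundedFunctions n (variableBound m))

  -- The coefficient of m in ∑ ∏ᵢ x_{f(i)} is the number of generic f whose
  -- product ∏ᵢ x_{f(i)} is m; such f take values below variableBound m.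
  Ψ[_] : ∀ {n} → HypergraphicPolytope n → PowerSeries
  Ψ[_] {n} 𝔮 = record
    { to   = λ m → length (genericFunctions 𝔮 m) ×ℕ K.1#
    ; cong = λ m↭m′ → K.reflexive (≡.cong (λ fs → length fs ×ℕ K.1#) (invariant m↭m′))
    }
    where
    invariant : ∀ {m m′} → m ↭ m′ → genericFunctions 𝔮 m ≡ genericFunctions 𝔮 m′
    invariant {m} {m′} m↭m′ rewrite variableBound-↭ m↭m′ =
      filter-≐ {P = λ f → IsGeneric 𝔮 f × toList f ↭ m}
               {Q = λ f → IsGeneric 𝔮 f × toList f ↭ m′}
        (λ _ → em) (λ _ → em)
        ( (λ (g , f↭m)  → g , ↭-trans f↭m m↭m′)
        , (λ (g , f↭m′) → g , ↭-trans f↭m′ (↭-sym m↭m′)))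
        (boundedFunctions n (variableBound m′))

  Ψ : HGP → PowerSeries
  Ψ [ 𝔮 ]    = Ψ[ 𝔮 ]
  Ψ 0ᴴ       = 0ˢ
  Ψ (x +ᴴ y) = Ψ x +ˢ Ψ y
  Ψ (a · x)  = a ·ˢ Ψ x

  modularSum : ∀ {n} → Family n → Family n → HGP
  modularSum 𝒜 ℬ =
    sumᴴ (map (λ 𝒯 → ((K.- K.1#) ^ length 𝒯) · [ 𝓕⁻¹ (members 𝒜) ⊕ 𝓕⁻¹ 𝒯 ])
              (sublists (members ℬ)))

  data Relation : Pred HGP c where
    simple :
      ∀ {n} (𝔮₁ 𝔮₂ : HypergraphicPolytope n) → 𝓕 𝔮₁ ≐ 𝓕 𝔮₂ →
      Relation ([ 𝔮₁ ] -ᴴ [ 𝔮₂ ])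
    modular :
      ∀ {n} (𝒜 ℬ : Family n) → Disjoint (members 𝒜) (members ℬ) →
      (∀ π → (∃[ A ] A ∈ᴸ members 𝒜 × ¬ Orth A π) ⊎ (∃[ B ] B ∈ᴸ members ℬ × Orth B π)) →
      Relation (modularSum 𝒜 ℬ)
    isomorphism :
      ∀ {n} (𝔮₁ 𝔮₂ : HypergraphicPolytope n) (σ : Permutation′ n) →
      ⟦ 𝔮₁ ⟧ ≐ (λ x → ⟦ 𝔮₂ ⟧ (λ i → x (σ ⟨$⟩ʳ i))) →
      Relation ([ 𝔮₁ ] -ᴴ [ 𝔮₂ ])

{-# OPTIONS --safe #-}
-- A word f is generic for 𝔮 exactly when it has a unique minimiser on every J ∈ 𝓕 𝔮. Let
-- A_f be the family of all J on which f has a unique minimiser, and P_f = 𝓕⁻¹ A_f. If 𝓕 𝔮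
-- is not of the form A_f, then 𝓕 𝔮 and its complement are the families of a modular
-- relation, which expresses 𝔮 by polytopes with larger families; hence the P_f span HGP
-- modulo the relations. The monomial of h occurs in Ψ P_f only if A_f ⊆ A_g for some
-- rearrangement g of h, and then #A_f ≤ #A_g = #A_h. Equality means A_f = A_g, so that P_f
-- and P_h are isomorphic. Thus the matrix of the coefficients is triangular with respect to
-- #A_f, and Ψ is injective on the span of representatives of the P_f. For the image, if
-- A_f = A_g then f and g have the same composition type, so every quasisymmetric function
-- has the same coefficient at both, and triangular elimination applies to it.

module Submission where

open import Defs
open import Algebra.Bundles using (CommutativeRing; CommutativeMonoid)
import Algebra.Properties.CommutativeMonoid.Sum as Sums
import Algebra.Properties.CommutativeSemigroup as CommutativeSemigroupProperties
import Algebra.Properties.Monoid.Mult as Mult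
import Algebra.Properties.Ring as RingProperties
import Algebra.Properties.Semiring.Exp as Exponentiation
import Algebra.Properties.Semiring.Mult as SemiringMult
import Algebra.Properties.Semiring.Sum as SemiringSum
open import Axiom.ExcludedMiddle using (ExcludedMiddle)
open import Data.Bool.Base using (true; if_then_else_)
import Data.Bool.Properties as Bool
open import Data.Fin.Base using (Fin; zero; suc; punchIn; fromℕ<) renaming (_<_ to _<ᶠ_)
open import Data.Fin.Permutation as Perm using (Permutation′; _⟨$⟩ʳ_; _⟨$⟩ˡ_)
import Data.Fin.Properties as Fin
open import Data.Fin.Subset
  using (Subset; inside; outside; Nonempty; Empty; ∣_∣; _∩_; _∪_; ⋃; ⁅_⁆)
  renaming (_∈_ to _∈ˢ_; _∉_ to _∉ˢ_)
import Data.Fin.Subset.Properties as Subset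
open import Data.Fin.Subset.Properties using (nonempty?)
open import Data.List.Base as List
  using (List; []; _∷_; _++_; length; map; foldr; filter; replicate; upTo; allFin; concatMap)
import Data.List.Membership.DecPropositional as DecMembership
open import Data.List.Membership.Propositional using (_∈_; lose; find)
open import Data.List.Membership.Propositional.Properties
import Data.List.Properties as List
open import Data.List.Relation.Binary.Permutation.Propositional as ↭
  using (_↭_; ↭-refl; ↭-sym; ↭-trans; ↭-reflexive; module PermutationReasoning)
import Data.List.Relation.Binary.Permutation.Propositional.Properties as ↭
open import Data.List.Relation.Unary.All as All using (All; []; _∷_)
import Data.List.Relation.Unary.All.Properties as All
open import Data.List.Relation.Unary.AllPairs using (AllPairs; []; _∷_)
import Data.List.Relation.Unary.AllPairs.Properties as AllPairs
open import Data.List.Relation.Unary.Any using (here; there)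
import Data.List.Relation.Unary.Any.Properties as Any
open import Data.List.Relation.Unary.Unique.Propositional using (Unique)
import Data.List.Relation.Unary.Unique.Propositional.Properties as Unique
open import Data.Nat.Base as ℕ using (ℕ; zero; suc; z≤n; s≤s)
import Data.Nat.Properties as ℕ
open import Data.Product.Base using (Σ; ∃; ∃-syntax; _×_; _,_; proj₁; proj₂)
open import Data.Sum.Base using (_⊎_; inj₁; inj₂; [_,_]′)
open import Data.Vec.Base as Vec using (Vec; []; _∷_; lookup; tabulate; toList)
import Data.Vec.Functional as Vector
open Vector using (Vector)
import Data.Vec.Properties as Vec
open import Function.Base using (_∘_)
open import Function.Bundles using (Func; _⟨$⟩_; _⇔_; mk⇔)
open import Level using (0ℓ; _⊔_)
open import Relation.Binary.Bundles using (Setoid)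
open import Relation.Binary.Definitions using (tri<; tri≈; tri>)
open import Relation.Binary.PropositionalEquality as ≡ using (_≡_; _≢_)
import Relation.Binary.Reasoning.Setoid as SetoidReasoning
open import Relation.Nullary using (¬_; Dec; yes; no; does; contradiction)
open import Relation.Nullary.Decidable using (¬?; _⊎-dec_; _×-dec_; dec-true; dec-false)
open import Relation.Unary using (Pred; Decidable; _≐_)

-- The family A_f does not determine f up to relabelling: exchanging two adjacent blocks of size one
-- leaves it unchanged. For the kernel this is harmless, since equal families are related by a
-- simple relation. For the image it is the main obstacle: a quasisymmetric function has to take the
-- same value at two such words. To this end each letter is replaced by the number of strictly
-- smaller letters, and the resulting words are shown to be rearrangements of each other. The
-- diagonal coefficient at f counts the rearrangements of f that are generic for P_f. It is positive
-- but may exceed 1: for the word 0 1 both rearrangements count. Characteristic zero makes it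
-- invertible. Both eliminations treat words in order of increasing rank. Representatives are never
-- chosen: for the kernel, congruent terms are merged when they meet; for the image, a word with the
-- same family as a rearrangement of a treated one already has coefficient zero, and nothing is
-- subtracted for it.

-- Lists without repetitions and counting by injections

module _ {a} {A : Set a} where

  ∈⇒↭ : ∀ {x : A} {xs} → x ∈ xs → ∃[ ys ] xs ↭ x ∷ ys
  ∈⇒↭ x∈xs with ∈-∃++ x∈xs
  ... | as , bs , ≡.refl = as ++ bs , ↭.shift _ as bs

  unique-⊆⇒↭++ : ∀ {xs ys : List A} → Unique xs → (∀ {x} → x ∈ xs → x ∈ ys) →
                 ∃[ zs ] ys ↭ xs ++ zs
  unique-⊆⇒↭++ [] _ = _ , ↭-refl
  unique-⊆⇒↭++ {x ∷ xs} (x∉ ∷ u) xs⊆ys with ∈⇒↭ (xs⊆ys (here ≡.refl))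
  ... | ys′ , ys↭ with unique-⊆⇒↭++ u xs⊆ys′
    where
    xs⊆ys′ : ∀ {y} → y ∈ xs → y ∈ ys′
    xs⊆ys′ y∈xs with ↭.∈-resp-↭ ys↭ (xs⊆ys (there y∈xs))
    ... | here y≡x = contradiction (≡.sym y≡x) (All.lookup x∉ y∈xs)
    ... | there p  = p
  ... | zs , ys′↭ = zs , ↭-trans ys↭ (↭.prep x ys′↭)

  unique-⊆⇒length-≤ : ∀ {xs ys : List A} → Unique xs → (∀ {x} → x ∈ xs → x ∈ ys) →
                      length xs ℕ.≤ length ys
  unique-⊆⇒length-≤ {xs} u xs⊆ys with unique-⊆⇒↭++ u xs⊆ys
  ... | zs , ys↭ = ≡.subst (length xs ℕ.≤_)
    (≡.sym (≡.trans (↭.↭-length ys↭) (List.length-++ xs))) (ℕ.m≤m+n (length xs) (length zs))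

  unique-set⇒↭ : ∀ {xs ys : List A} → Unique xs → Unique ys →
                 (∀ {x} → x ∈ xs → x ∈ ys) → (∀ {x} → x ∈ ys → x ∈ xs) → xs ↭ ys
  unique-set⇒↭ {xs} {ys} u v xs⊆ys ys⊆xs with unique-⊆⇒↭++ u xs⊆ys
  ... | []     , ys↭ = ↭-trans (↭-sym (↭.++-identityʳ xs)) (↭-sym ys↭)
  ... | z ∷ zs , ys↭ = contradiction (unique-⊆⇒length-≤ v ys⊆xs)
    (ℕ.<⇒≱ (≡.subst (length xs ℕ.<_) (≡.sym (≡.trans (↭.↭-length ys↭) (List.length-++ xs)))
             (ℕ.m<m+n (length xs) (s≤s z≤n))))

  module _ {p q} {P : Pred A p} {Q : Pred A q} (P? : Decidable P) (Q? : Decidable Q) where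

    count-mono : ∀ xs → (∀ {x} → x ∈ xs → P x → Q x) →
                 length (filter P? xs) ℕ.≤ length (filter Q? xs)
    count-mono []       _   = z≤n
    count-mono (x ∷ xs) P⇒Q with P? x | Q? x | count-mono xs (P⇒Q ∘ there)
    ... | no _  | no _   | ih = ih
    ... | no _  | yes _  | ih = ℕ.m≤n⇒m≤1+n ih
    ... | yes p | no ¬q  | ih = contradiction (P⇒Q (here ≡.refl) p) ¬q
    ... | yes _ | yes _  | ih = s≤s ih

    count-strict : ∀ xs → (∀ {x} → x ∈ xs → P x → Q x) →
                   ∀ {x} → x ∈ xs → Q x → ¬ P x →
                   length (filter P? xs) ℕ.< length (filter Q? xs)
    count-strict (y ∷ xs) P⇒Q (here ≡.refl) qx ¬px with P? y | Q? y
    ... | yes px | _      = contradiction px ¬px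
    ... | no _   | no ¬qx = contradiction qx ¬qx
    ... | no _   | yes _  = s≤s (count-mono xs (P⇒Q ∘ there))
    count-strict (y ∷ xs) P⇒Q (there x∈) qx ¬px
      with P? y | Q? y | count-strict xs (P⇒Q ∘ there) x∈ qx ¬px
    ... | no _  | no _   | ih = ih
    ... | no _  | yes _  | ih = ℕ.m≤n⇒m≤1+n ih
    ... | yes p | no ¬q  | ih = contradiction (P⇒Q (here ≡.refl) p) ¬q
    ... | yes _ | yes _  | ih = s≤s ih

module _ {a b} {A : Set a} {B : Set b} where

  unique-map : ∀ (φ : A → B) {xs} → Unique xs →
               (∀ {x y} → x ∈ xs → y ∈ xs → φ x ≡ φ y → x ≡ y) → Unique (map φ xs)
  unique-map φ []       _   = []
  unique-map φ (x∉ ∷ u) inj =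
    All.map⁺ (All.tabulate λ y∈ φx≡φy → All.lookup x∉ y∈ (inj (here ≡.refl) (there y∈) φx≡φy)) ∷
    unique-map φ u (λ x∈ y∈ → inj (there x∈) (there y∈))

  -- Counts are compared by injections, and two opposite ones replace a bijection where an equality
  -- is needed. Injectivity is asked only where `P` holds, because a relabelling of words is
  -- injective only on the words of a given monomial.
  count-injection : ∀ {p q} {P : Pred A p} {Q : Pred B q} (P? : Decidable P) (Q? : Decidable Q)
                    (φ : A → B) {xs ys} → Unique xs →
                    (∀ {x} → x ∈ xs → P x → φ x ∈ ys × Q (φ x)) →
                    (∀ {x y} → P x → P y → φ x ≡ φ y → x ≡ y) →
                    length (filter P? xs) ℕ.≤ length (filter Q? ys)
  count-injection P? Q? φ {xs} {ys} u into inj =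
    ≡.subst (ℕ._≤ length (filter Q? ys)) (List.length-map φ (filter P? xs))
      (unique-⊆⇒length-≤
        (unique-map φ (Unique.filter⁺ P? u)
          (λ x∈ y∈ → inj (proj₂ (∈-filter⁻ P? {xs = xs} x∈)) (proj₂ (∈-filter⁻ P? {xs = xs} y∈))))
        image⊆)
    where
    image⊆ : ∀ {y} → y ∈ map φ (filter P? xs) → y ∈ filter Q? ys
    image⊆ y∈ with ∈-map⁻ φ y∈
    ... | x , x∈ , ≡.refl with ∈-filter⁻ P? {xs = xs} x∈
    ...   | x∈xs , px = let φx∈ , qx = into x∈xs px in ∈-filter⁺ Q? φx∈ qx

-- Enumerations of words, subsets and sublists

∈-boundedFunctions⁺ : ∀ {n N} (f : Vec ℕ n) → (∀ i → lookup f i ℕ.< N) → f ∈ boundedFunctions n N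
∈-boundedFunctions⁺ []      _   = here ≡.refl
∈-boundedFunctions⁺ (x ∷ f) f<N =
  ∈-cartesianProductWith⁺ _∷_ (∈-upTo⁺ (f<N zero)) (∈-boundedFunctions⁺ f (f<N ∘ suc))

boundedFunctions-unique : ∀ n N → Unique (boundedFunctions n N)
boundedFunctions-unique zero    N = [] ∷ []
boundedFunctions-unique (suc n) N =
  Unique.cartesianProductWith⁺ _∷_ Vec.∷-injective (Unique.upTo⁺ N) (boundedFunctions-unique n N)

∈-subsets : ∀ {n} (J : Subset n) → J ∈ subsets n
∈-subsets []            = here ≡.refl
∈-subsets (inside  ∷ J) = ∈-++⁺ˡ (∈-map⁺ (inside ∷_) (∈-subsets J))
∈-subsets (outside ∷ J) = ∈-++⁺ʳ (map (inside ∷_) (subsets _)) (∈-map⁺ (outside ∷_) (∈-subsets J))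

subsets-unique : ∀ n → Unique (subsets n)
subsets-unique zero    = [] ∷ []
subsets-unique (suc n) = Unique.++⁺
  (Unique.map⁺ Vec.∷-injectiveʳ (subsets-unique n))
  (Unique.map⁺ Vec.∷-injectiveʳ (subsets-unique n))
  disjoint
  where
  disjoint : ∀ {J} → ¬ (J ∈ map (inside ∷_) (subsets n) × J ∈ map (outside ∷_) (subsets n))
  disjoint (p , q) with ∈-map⁻ (inside ∷_) p | ∈-map⁻ (outside ∷_) q
  ... | _ , _ , ≡.refl | _ , _ , ()

∈-nonemptySubsets⁺ : ∀ {n} {J : Subset n} → Nonempty J → J ∈ nonemptySubsets n
∈-nonemptySubsets⁺ J≠∅ = ∈-filter⁺ nonempty? (∈-subsets _) J≠∅

∈-nonemptySubsets⁻ : ∀ {n} {J : Subset n} → J ∈ nonemptySubsets n → Nonempty J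
∈-nonemptySubsets⁻ {n} J∈ = proj₂ (∈-filter⁻ nonempty? {xs = subsets n} J∈)

nonemptySubsets-unique : ∀ n → Unique (nonemptySubsets n)
nonemptySubsets-unique n = Unique.filter⁺ nonempty? (subsets-unique n)

module _ {a} {A : Set a} where

  sublists-⊆ : ∀ (xs : List A) {ys} → ys ∈ sublists xs → ∀ {y} → y ∈ ys → y ∈ xs
  sublists-⊆ []       (here ≡.refl) y∈ = y∈
  sublists-⊆ (x ∷ xs) ys∈ y∈ with ∈-++⁻ (map (x ∷_) (sublists xs)) ys∈
  ... | inj₂ ys∈′ = there (sublists-⊆ xs ys∈′ y∈)
  ... | inj₁ ys∈′ with ∈-map⁻ (x ∷_) ys∈′ | y∈
  ...   | zs , zs∈ , ≡.refl | here ≡.refl = here ≡.refl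
  ...   | zs , zs∈ , ≡.refl | there y∈zs = there (sublists-⊆ xs zs∈ y∈zs)

  -- The empty sublist occurs once and last. It indexes the term of a modular relation that is
  -- solved for in `spanned-polytope`.
  sublists-[] : ∀ (xs : List A) → ∃[ yss ] sublists xs ≡ yss ++ [] ∷ [] × All (_≢ []) yss
  sublists-[] []       = [] , ≡.refl , []
  sublists-[] (x ∷ xs) with sublists-[] xs
  ... | yss , eq , all = map (x ∷_) (sublists xs) ++ yss ,
    ≡.trans (≡.cong (map (x ∷_) (sublists xs) ++_) eq)
          (≡.sym (List.++-assoc (map (x ∷_) (sublists xs)) yss _)) ,
    All.++⁺ (All.map⁺ (All.universal (λ _ ()) (sublists xs))) all

-- Permutations of words

toList-tabulate : ∀ {n} {A : Set} (f : Fin n → A) → toList (tabulate f) ≡ List.tabulate f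
toList-tabulate {zero}  f = ≡.refl
toList-tabulate {suc n} f = ≡.cong (f zero ∷_) (toList-tabulate (f ∘ suc))

-- An injective `σ` lists distinct indices, and by the pigeonhole principle it lists all of them: a
-- missed index would contradict the equal lengths of `tabulate σ` and `allFin n`.
toList-permute : ∀ {n} {A : Set} (f : Vec A n) (σ : Fin n → Fin n) →
                 (∀ {i j} → σ i ≡ σ j → i ≡ j) →
                 toList (tabulate (lookup f ∘ σ)) ↭ toList f
toList-permute {n} f σ σ-injective = begin
  toList (tabulate (lookup f ∘ σ))    ≡⟨ toList-tabulate (lookup f ∘ σ) ⟩
  List.tabulate (lookup f ∘ σ)        ≡⟨ List.map-tabulate σ (lookup f) ⟨
  map (lookup f) (List.tabulate σ)    ↭⟨ ↭.map⁺ (lookup f) tabulate↭ ⟩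
  map (lookup f) (allFin n)           ≡⟨ List.map-tabulate (λ i → i) (lookup f) ⟩
  List.tabulate (lookup f)            ≡⟨ toList-tabulate (lookup f) ⟨
  toList (tabulate (lookup f))        ≡⟨ ≡.cong toList (Vec.tabulate∘lookup f) ⟩
  toList f                            ∎
  where
  open PermutationReasoning
  ∈-all : ∀ {i} → i ∈ List.tabulate σ → i ∈ allFin n
  ∈-all _ = ∈-allFin _
  tabulate↭ : List.tabulate σ ↭ allFin n
  tabulate↭ with unique-⊆⇒↭++ (Unique.tabulate⁺ σ-injective) ∈-all
  ... | [] , ↭ = ↭-trans (↭-sym (↭.++-identityʳ _)) (↭-sym ↭)
  ... | z ∷ zs , ↭ = contradiction
    (≡.trans (≡.trans (≡.sym (List.length-tabulate (λ (i : Fin n) → i))) (↭.↭-length ↭))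
      (≡.trans (List.length-++ (List.tabulate σ)) (≡.cong (ℕ._+ suc (length zs)) (List.length-tabulate σ))))
    (ℕ.m≢1+m+n n ∘ λ eq → ≡.trans eq (ℕ.+-suc n (length zs)))

toList-removeAt : ∀ {n} {A : Set} (g : Vec A (suc n)) i →
                  toList g ↭ lookup g i ∷ toList (Vec.removeAt g i)
toList-removeAt (x ∷ g)     zero    = ↭-refl
toList-removeAt (x ∷ y ∷ g) (suc i) =
  ↭-trans (↭.prep x (toList-removeAt (y ∷ g) i)) (↭.swap x _ ↭-refl)

lookup-removeAt : ∀ {n} {A : Set} (g : Vec A (suc n)) i k →
                  lookup (Vec.removeAt g i) k ≡ lookup g (punchIn i k)
lookup-removeAt (x ∷ g)     zero    k       = ≡.refl
lookup-removeAt (x ∷ y ∷ g) (suc i) zero    = ≡.refl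
lookup-removeAt (x ∷ y ∷ g) (suc i) (suc k) = lookup-removeAt (y ∷ g) i k

∈-toList⁻ : ∀ {n} {A : Set} {x : A} (g : Vec A n) → x ∈ toList g → ∃[ i ] lookup g i ≡ x
∈-toList⁻ (y ∷ g) (here ≡.refl) = zero , ≡.refl
∈-toList⁻ (y ∷ g) (there x∈)  = let i , eq = ∈-toList⁻ g x∈ in suc i , eq

∈-toList⁺ : ∀ {n} {A : Set} (g : Vec A n) i → lookup g i ∈ toList g
∈-toList⁺ (y ∷ g) zero    = here ≡.refl
∈-toList⁺ (y ∷ g) (suc i) = there (∈-toList⁺ g i)

↭⇒permutation : ∀ {n} {A : Set} (f g : Vec A n) → toList f ↭ toList g →
                ∃[ σ ] (∀ i → lookup f i ≡ lookup g (_⟨$⟩ʳ_ {n} {n} σ i))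
↭⇒permutation []      []        _   = Perm.id , λ ()
↭⇒permutation {suc n} (x ∷ f) g f↭g with ∈-toList⁻ g (↭.∈-resp-↭ f↭g (here ≡.refl))
... | j , ≡.refl with ↭⇒permutation f (Vec.removeAt g j)
                      (↭.drop-∷ (↭-trans f↭g (toList-removeAt g j)))
... | σ , eq = Perm.insert zero j σ , λ where
  zero    → ≡.refl
  (suc i) → ≡.trans (eq i) (≡.trans (lookup-removeAt g j (σ ⟨$⟩ʳ i))
              (≡.cong (lookup g) (≡.sym (Perm.insert-punchIn zero j σ i))))

-- Rearranging the word of all indices by `σ` still leaves every index somewhere.
injective⇒surjective : ∀ {n} (σ : Fin n → Fin n) → (∀ {i j} → σ i ≡ σ j → i ≡ j) →
                       ∀ j → ∃[ i ] σ i ≡ j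
injective⇒surjective σ σ-injective j =
  let i , eq = ∈-toList⁻ (tabulate (lookup (Vec.allFin _) ∘ σ))
                 (↭.∈-resp-↭ (↭-sym (toList-permute (Vec.allFin _) σ σ-injective))
                   (≡.subst (_∈ toList (Vec.allFin _)) (Vec.lookup-allFin j) (∈-toList⁺ (Vec.allFin _) j)))
  in i , ≡.trans (≡.sym (≡.trans (Vec.lookup∘tabulate _ i) (Vec.lookup-allFin (σ i)))) eq

-- Unique minimisers and their transport by permutations

-- Orthogonality expressed by words: if `f` numbers the blocks of a set composition, this says that
-- the first block meeting `J` does so in one element.
UniqueMin : ∀ {n} → (Fin n → ℕ) → Subset n → Set
UniqueMin f J = ∃[ j ] j ∈ˢ J × (∀ k → k ∈ˢ J → k ≢ j → f j ℕ.< f k)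

module _ {n : ℕ} where

  UniqueMin-mono : ∀ {f g : Fin n → ℕ} {J} →
                   (∀ {i j} → i ∈ˢ J → j ∈ˢ J → f i ℕ.< f j → g i ℕ.< g j) → UniqueMin f J → UniqueMin g J
  UniqueMin-mono f⇒g (j , j∈J , min) = j , j∈J , λ k k∈J k≢j → f⇒g j∈J k∈J (min k k∈J k≢j)

  UniqueMin-cong : ∀ {f g : Fin n → ℕ} {J} → (∀ i → f i ≡ g i) → UniqueMin f J → UniqueMin g J
  UniqueMin-cong f≗g = UniqueMin-mono λ {i} {j} _ _ → ≡.subst (λ (x , y) → x ℕ.< y) (≡.cong₂ _,_ (f≗g i) (f≗g j))

  image : Permutation′ n → Subset n → Subset n
  image σ J = tabulate (λ i → lookup J (σ ⟨$⟩ˡ i))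

  ∈-image⁺ : ∀ σ {J i} → (σ ⟨$⟩ˡ i) ∈ˢ J → i ∈ˢ image σ J
  ∈-image⁺ σ {J} {i} i∈ = Vec.lookup⇒[]= i (image σ J)
    (≡.trans (Vec.lookup∘tabulate (λ i → lookup J (σ ⟨$⟩ˡ i)) i) (Vec.[]=⇒lookup i∈))

  ∈-image⁺′ : ∀ σ {J i} → i ∈ˢ J → (σ ⟨$⟩ʳ i) ∈ˢ image σ J
  ∈-image⁺′ σ {J} i∈ = ∈-image⁺ σ (≡.subst (_∈ˢ J) (≡.sym (Perm.inverseˡ σ)) i∈)

  ∈-image⁻ : ∀ σ {J i} → i ∈ˢ image σ J → (σ ⟨$⟩ˡ i) ∈ˢ J
  ∈-image⁻ σ {J} {i} i∈ = Vec.lookup⇒[]= _ J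
    (≡.trans (≡.sym (Vec.lookup∘tabulate (λ i → lookup J (σ ⟨$⟩ˡ i)) i)) (Vec.[]=⇒lookup i∈))

  image-flip : ∀ σ J → image (Perm.flip σ) (image σ J) ≡ J
  image-flip σ J = ≡.trans
    (Vec.tabulate-cong (λ i → ≡.trans (Vec.lookup∘tabulate _ (σ ⟨$⟩ʳ i)) (≡.cong (lookup J) (Perm.inverseˡ σ))))
    (Vec.tabulate∘lookup J)

  image-injective : ∀ σ {I J} → image σ I ≡ image σ J → I ≡ J
  image-injective σ {I} {J} eq =
    ≡.trans (≡.sym (image-flip σ I)) (≡.trans (≡.cong (image (Perm.flip σ)) eq) (image-flip σ J))

  UniqueMin-image : ∀ {f h : Fin n → ℕ} σ → (∀ i → h i ≡ f (σ ⟨$⟩ʳ i)) →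
                    ∀ {J} → UniqueMin h J → UniqueMin f (image σ J)
  UniqueMin-image {f} σ h≡ {J} (j , j∈J , min) =
    (σ ⟨$⟩ʳ j) , ∈-image⁺′ σ j∈J , λ k k∈ k≢ →
      ≡.subst (λ (x , y) → x ℕ.< y)
        (≡.cong₂ _,_ (h≡ j) (≡.trans (h≡ (σ ⟨$⟩ˡ k)) (≡.cong f (Perm.inverseʳ σ))))
        (min (σ ⟨$⟩ˡ k) (∈-image⁻ σ k∈) (λ eq → k≢ (≡.trans (≡.sym (Perm.inverseʳ σ)) (≡.cong (σ ⟨$⟩ʳ_) eq))))

  UniqueMin-image⁻ : ∀ {f h : Fin n → ℕ} σ → (∀ i → h i ≡ f (σ ⟨$⟩ʳ i)) →
                     ∀ {J} → UniqueMin f (image σ J) → UniqueMin h J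
  UniqueMin-image⁻ {f} {h} σ h≡ {J} u =
    ≡.subst (UniqueMin h) (image-flip σ J)
      (UniqueMin-image (Perm.flip σ) (λ i → ≡.trans (≡.cong f (≡.sym (Perm.inverseʳ σ))) (≡.sym (h≡ (σ ⟨$⟩ˡ i)))) u)

UniqueMin⇒Nonempty : ∀ {n} {f : Fin n → ℕ} {J} → UniqueMin f J → Nonempty J
UniqueMin⇒Nonempty (j , j∈J , _) = j , j∈J

-- Standardisation

module _ {n} (f : Fin n → ℕ) where

  -- Equal letters keep equal values and all values stay below `n`, so `below` is a normal form of
  -- the word up to strictly monotone relabelling.
  below : Fin n → ℕ
  below i = length (filter (λ c → f c ℕ.<? f i) (allFin n))

  below-< : ∀ {i j} → f i ℕ.< f j → below i ℕ.< below j
  below-< {i} {j} i<j = count-strict (λ c → f c ℕ.<? f i) (λ c → f c ℕ.<? f j) (allFin n)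
    (λ _ c<i → ℕ.<-trans c<i i<j) (∈-allFin i) i<j (ℕ.<-irrefl ≡.refl)

  below<n : ∀ i → below i ℕ.< n
  below<n i = ≡.subst (below i ℕ.<_) (List.length-tabulate (λ (i : Fin n) → i))
    (List.filter-notAll (λ c → f c ℕ.<? f i) (allFin n)
      (lose (∈-allFin i) (ℕ.<-irrefl ≡.refl)))

  -- The total order refining `f` in which equal letters are ordered by their indices. The place in
  -- this order is the classical standardisation of a word, counted from 0.
  Precedes : Fin n → Fin n → Set
  Precedes c i = f c ℕ.< f i ⊎ (f c ≡ f i × c <ᶠ i)

  precedes? : ∀ i c → Dec (Precedes c i)
  precedes? i c = (f c ℕ.<? f i) ⊎-dec ((f c ℕ.≟ f i) ×-dec (c Fin.<? i))

  precedes-trans : ∀ {i j k} → Precedes i j → Precedes j k → Precedes i k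
  precedes-trans (inj₁ p)       (inj₁ q)       = inj₁ (ℕ.<-trans p q)
  precedes-trans (inj₁ p)       (inj₂ (e , _)) = inj₁ (ℕ.<-≤-trans p (ℕ.≤-reflexive e))
  precedes-trans (inj₂ (e , _)) (inj₁ q)       = inj₁ (ℕ.≤-<-trans (ℕ.≤-reflexive e) q)
  precedes-trans (inj₂ (e , p)) (inj₂ (e′ , q)) = inj₂ (≡.trans e e′ , Fin.<-trans p q)

  precedes-irrefl : ∀ {i} → ¬ Precedes i i
  precedes-irrefl (inj₁ p)       = ℕ.<-irrefl ≡.refl p
  precedes-irrefl (inj₂ (_ , p)) = Fin.<-irrefl ≡.refl p

  precedes-total : ∀ i j → Precedes i j ⊎ i ≡ j ⊎ Precedes j i
  precedes-total i j with ℕ.<-cmp (f i) (f j) | Fin.<-cmp i j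
  ... | tri< p _ _ | _          = inj₁ (inj₁ p)
  ... | tri> _ _ p | _          = inj₂ (inj₂ (inj₁ p))
  ... | tri≈ _ e _ | tri< p _ _ = inj₁ (inj₂ (e , p))
  ... | tri≈ _ e _ | tri≈ _ p _ = inj₂ (inj₁ p)
  ... | tri≈ _ e _ | tri> _ _ p = inj₂ (inj₂ (inj₂ (≡.sym e , p)))

  place : Fin n → ℕ
  place i = length (filter (precedes? i) (allFin n))

  place-mono : ∀ {i j} → Precedes i j → place i ℕ.< place j
  place-mono {i} {j} i<j = count-strict (precedes? i) (precedes? j) (allFin n)
    (λ _ c<i → precedes-trans c<i i<j) (∈-allFin i) i<j precedes-irrefl

  place-injective : ∀ {i j} → place i ≡ place j → i ≡ j
  place-injective {i} {j} eq with precedes-total i j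
  ... | inj₁ p        = contradiction eq (ℕ.<⇒≢ (place-mono p))
  ... | inj₂ (inj₁ p) = p
  ... | inj₂ (inj₂ p) = contradiction (≡.sym eq) (ℕ.<⇒≢ (place-mono p))

  place<n : ∀ i → place i ℕ.< n
  place<n i = ≡.subst (place i ℕ.<_) (List.length-tabulate (λ (i : Fin n) → i))
    (List.filter-notAll (precedes? i) (allFin n)
      (lose (∈-allFin i) precedes-irrefl))

  placeᶠ : Fin n → Fin n
  placeᶠ i = fromℕ< (place<n i)

  placeᶠ-injective : ∀ {i j} → placeᶠ i ≡ placeᶠ j → i ≡ j
  placeᶠ-injective {i} {j} eq = place-injective (Fin.fromℕ<-injective _ _ (place<n i) (place<n j) eq)

  Tied : Fin n → Set
  Tied a = ∃[ b ] a ≢ b × f a ≡ f b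

  -- For an untied letter the tie-breaking rule never applies, so both counts run over the strictly
  -- smaller letters.
  untied-place : ∀ {a} → ¬ Tied a → place a ≡ below a
  untied-place {a} untied = ℕ.≤-antisym
    (count-mono (precedes? a) (λ c → f c ℕ.<? f a) (allFin n)
      λ { _ (inj₁ p)       → p
        ; _ (inj₂ (e , p)) → contradiction (_ , (λ a≡c → Fin.<-irrefl (≡.sym a≡c) p) , ≡.sym e) untied })
    (count-mono (λ c → f c ℕ.<? f a) (precedes? a) (allFin n) λ _ → inj₁)

module _ {n} {f h : Fin n → ℕ} (f⇒h : ∀ J → UniqueMin f J → UniqueMin h J) where

  private
    pair : Fin n → Fin n → Subset n
    pair a b = ⁅ a ⁆ ∪ ⁅ b ⁆

    ∈-pair⁻ : ∀ a b {c} → c ∈ˢ pair a b → c ≡ a ⊎ c ≡ b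
    ∈-pair⁻ a b c∈ with Subset.x∈p∪q⁻ ⁅ a ⁆ ⁅ b ⁆ c∈
    ... | inj₁ p = inj₁ (Subset.x∈⁅y⁆⇒x≡y a p)
    ... | inj₂ p = inj₂ (Subset.x∈⁅y⁆⇒x≡y b p)

    a∈pair : ∀ a b → a ∈ˢ pair a b
    a∈pair a b = Subset.x∈p∪q⁺ (inj₁ (Subset.x∈⁅x⁆ a))

    b∈pair : ∀ a b → b ∈ˢ pair a b
    b∈pair a b = Subset.x∈p∪q⁺ {p = ⁅ a ⁆} (inj₂ (Subset.x∈⁅x⁆ b))

    -- A pair detects equality of two letters: it has a unique minimiser precisely when they differ.
    separated : ∀ {a b} → f a ℕ.< f b → h a ≢ h b
    separated {a} {b} fa<fb ha≡hb with f⇒h (pair a b)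
      (a , a∈pair a b , λ k k∈ k≢a → [ (λ e → contradiction e k≢a) , (λ { ≡.refl → fa<fb }) ]′ (∈-pair⁻ a b k∈))
    ... | j , j∈ , min with ∈-pair⁻ a b j∈
    ...   | inj₁ ≡.refl = ℕ.<⇒≢ (min b (b∈pair a b) λ { ≡.refl → ℕ.<-irrefl ≡.refl fa<fb }) ha≡hb
    ...   | inj₂ ≡.refl = ℕ.<⇒≢ (min a (a∈pair a b) λ { ≡.refl → ℕ.<-irrefl ≡.refl fa<fb }) (≡.sym ha≡hb)

  ties-reflected : ∀ {a b} → h a ≡ h b → f a ≡ f b
  ties-reflected {a} {b} ha≡hb with ℕ.<-cmp (f a) (f b)
  ... | tri< p _ _ = contradiction ha≡hb (separated p)
  ... | tri≈ _ p _ = p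
  ... | tri> _ _ p = contradiction (≡.sym ha≡hb) (separated p)

  -- {a, b, c} has a unique minimiser for f, and neither a nor b can be the one for h.
  below-tied : ∀ {a b c} → a ≢ b → h a ≡ h b → f c ℕ.< f a → h c ℕ.< h a
  below-tied {a} {b} {c} a≢b ha≡hb fc<fa with f⇒h (pair a b ∪ ⁅ c ⁆)
    (c , Subset.x∈p∪q⁺ {p = pair a b} (inj₂ (Subset.x∈⁅x⁆ c)) , λ k k∈ k≢c →
      [ (λ k∈ab → [ (λ { ≡.refl → fc<fa }) , (λ { ≡.refl → ≡.subst (f c ℕ.<_) (ties-reflected ha≡hb) fc<fa }) ]′
                    (∈-pair⁻ a b k∈ab))
      , (λ k∈c → contradiction (Subset.x∈⁅y⁆⇒x≡y c k∈c) k≢c) ]′ (Subset.x∈p∪q⁻ (pair a b) ⁅ c ⁆ k∈))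
  ... | j , j∈ , min with Subset.x∈p∪q⁻ (pair a b) ⁅ c ⁆ j∈
  ...   | inj₁ j∈ab with ∈-pair⁻ a b j∈ab
  ...     | inj₁ ≡.refl = contradiction ha≡hb
    (ℕ.<⇒≢ (min b (Subset.x∈p∪q⁺ (inj₁ (b∈pair a b))) (a≢b ∘ ≡.sym)))
  ...     | inj₂ ≡.refl = contradiction (≡.sym ha≡hb)
    (ℕ.<⇒≢ (min a (Subset.x∈p∪q⁺ (inj₁ (a∈pair a b))) a≢b))
  below-tied {a} {b} {c} a≢b ha≡hb fc<fa | j , j∈ , min | inj₂ j∈c with Subset.x∈⁅y⁆⇒x≡y c j∈c
  ... | ≡.refl = min a (Subset.x∈p∪q⁺ (inj₁ (a∈pair a b))) λ { ≡.refl → ℕ.<-irrefl ≡.refl fc<fa }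

-- Two words with the same orthogonal sets differ only in the order of consecutive
-- singleton blocks, so the bijection matching the places in the two orders fixes
-- every tied letter.
module _ {n} {f h : Fin n → ℕ}
  (f⇒h : ∀ J → UniqueMin f J → UniqueMin h J) (h⇒f : ∀ J → UniqueMin h J → UniqueMin f J) where

  private
    τ : Fin n → Fin n
    τ a = proj₁ (injective⇒surjective (placeᶠ h) (placeᶠ-injective h) (placeᶠ f a))

    place-τ : ∀ a → place h (τ a) ≡ place f a
    place-τ a = Fin.fromℕ<-injective _ _ (place<n h (τ a)) (place<n f a)
      (proj₂ (injective⇒surjective (placeᶠ h) (placeᶠ-injective h) (placeᶠ f a)))

    τ-injective : ∀ {i j} → τ i ≡ τ j → i ≡ j
    τ-injective {i} {j} eq = place-injective f
      (≡.trans (≡.sym (place-τ i)) (≡.trans (≡.cong (place h) eq) (place-τ j)))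

    Tied-h⇒f : ∀ {a} → Tied h a → Tied f a
    Tied-h⇒f (b , a≢b , ha≡hb) = b , a≢b , ties-reflected f⇒h ha≡hb

    tied-f⇒h : ∀ {a c} → Tied f a → f c ℕ.< f a → h c ℕ.< h a
    tied-f⇒h (b , a≢b , fa≡fb) = below-tied f⇒h a≢b (ties-reflected h⇒f fa≡fb)

    tied-h⇒f : ∀ {a c} → Tied f a → h c ℕ.< h a → f c ℕ.< f a
    tied-h⇒f (b , a≢b , fa≡fb) = below-tied h⇒f a≢b fa≡fb

    -- The predecessors of a tied letter are the same in both words: the strictly smaller letters by
    -- `below-tied`, and the equal ones because ties agree and are broken by the same indices.
    tied-place : ∀ {a} → Tied f a → place f a ≡ place h a
    tied-place {a} tied = ℕ.≤-antisym
      (count-mono (precedes? f a) (precedes? h a) (allFin n) λ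
        { _ (inj₁ p) → inj₁ (tied-f⇒h tied p) ; _ (inj₂ (e , p)) → inj₂ (ties-reflected h⇒f e , p) })
      (count-mono (precedes? h a) (precedes? f a) (allFin n) λ
        { _ (inj₁ p) → inj₁ (tied-h⇒f tied p) ; _ (inj₂ (e , p)) → inj₂ (ties-reflected f⇒h e , p) })

    tied-below : ∀ {a} → Tied f a → below f a ≡ below h a
    tied-below {a} tied = ℕ.≤-antisym
      (count-mono (λ c → f c ℕ.<? f a) (λ c → h c ℕ.<? h a) (allFin n) λ _ → tied-f⇒h tied)
      (count-mono (λ c → h c ℕ.<? h a) (λ c → f c ℕ.<? f a) (allFin n) λ _ → tied-h⇒f tied)

    Tied? : ∀ a → Dec (Tied f a)
    Tied? a = Fin.any? λ b → ¬? (a Fin.≟ b) ×-dec (f a ℕ.≟ f b)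

    below-τ : ∀ a → below f a ≡ below h (τ a)
    below-τ a with Tied? a
    ... | yes tied = ≡.trans (tied-below tied) (≡.cong (below h) (place-injective h
                       (≡.trans (≡.sym (tied-place tied)) (≡.sym (place-τ a)))))
    ... | no untied = ≡.trans (≡.sym (untied-place f untied))
                        (≡.trans (≡.sym (place-τ a)) (untied-place h τa-untied))
      where
      -- If `τ a` were tied, it would have the same place in both words, hence the place of `a` in
      -- `f`; then `τ a` would be `a`, and `a` would be tied.
      τa-untied : ¬ Tied h (τ a)
      τa-untied t = untied (≡.subst (Tied f)
        (place-injective f (≡.trans (tied-place (Tied-h⇒f t)) (place-τ a))) (Tied-h⇒f t))

  -- `τ` is injective and matches equal values of `below f` and `below h`, so the two normalised
  -- words have the same monomial although they may differ as words.
  below-↭ : toList (tabulate (below f)) ↭ toList (tabulate (below h))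
  below-↭ = ↭-trans
    (↭-reflexive (≡.cong toList (Vec.tabulate-cong λ a →
      ≡.trans (below-τ a) (≡.sym (Vec.lookup∘tabulate (below h) (τ a))))))
    (toList-permute (tabulate (below h)) τ τ-injective)

-- Set compositions

module _ {n : ℕ} where

  card≡1⁻ : ∀ {p : Subset n} → ∣ p ∣ ≡ 1 → ∃[ j ] j ∈ˢ p × (∀ k → k ∈ˢ p → k ≡ j)
  card≡1⁻ {p} eq with nonempty? p
  ... | no p-empty = contradiction
    (≡.trans (≡.sym eq) (≡.trans (≡.cong ∣_∣ (Subset.Empty-unique p-empty)) (Subset.∣⊥∣≡0 n))) λ ()
  ... | yes (j , j∈p) = j , j∈p , unique′
    where
    unique′ : ∀ k → k ∈ˢ p → k ≡ j
    unique′ k k∈p with k Fin.≟ j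
    ... | yes k≡j = k≡j
    ... | no  k≢j = contradiction
      (ℕ.≤-trans (s≤s (ℕ.≤-trans (s≤s z≤n) (Subset.x∈p⇒∣p-x∣<∣p∣ (Subset.x∈p∧x≢y⇒x∈p-y k∈p k≢j))))
        (Subset.x∈p⇒∣p-x∣<∣p∣ j∈p))
      (λ 2≤ → ℕ.<-irrefl (≡.sym eq) 2≤)

  card≡1⁺ : ∀ {p : Subset n} {j} → j ∈ˢ p → (∀ k → k ∈ˢ p → k ≡ j) → ∣ p ∣ ≡ 1
  card≡1⁺ {p} {j} j∈p unique′ = ≡.trans (≡.cong ∣_∣ (Subset.⊆-antisym
    (λ {k} k∈p → ≡.subst (_∈ˢ ⁅ j ⁆) (≡.sym (unique′ k k∈p)) (Subset.x∈⁅x⁆ j))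
    (λ k∈j → ≡.subst (_∈ˢ p) (≡.sym (Subset.x∈⁅y⁆⇒x≡y j k∈j)) j∈p))) (Subset.∣⁅x⁆∣≡1 j)

  -- The word of a set composition. An element outside all blocks gets the number of blocks, a value
  -- that `Covers` rules out where it would matter.
  blockIndex : List (Subset n) → Fin n → ℕ
  blockIndex []       i = 0
  blockIndex (S ∷ Ss) i = if does (i Subset.∈? S) then 0 else suc (blockIndex Ss i)

  blockIndex-∈ : ∀ {S i} Ss → i ∈ˢ S → blockIndex (S ∷ Ss) i ≡ 0
  blockIndex-∈ {S} {i} Ss i∈S with i Subset.∈? S
  ... | yes _   = ≡.refl
  ... | no  i∉S = contradiction i∈S i∉S

  blockIndex-∉ : ∀ {S i} Ss → i ∉ˢ S → blockIndex (S ∷ Ss) i ≡ suc (blockIndex Ss i)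
  blockIndex-∉ {S} {i} Ss i∉S with i Subset.∈? S
  ... | yes i∈S = contradiction i∈S i∉S
  ... | no  _   = ≡.refl

  Covers : List (Subset n) → Fin n → Set
  Covers Ss i = ∃[ S ] S ∈ Ss × i ∈ˢ S

  -- If `A` meets the first block, its members of index 0 are those of `A ∩ S`, and these are the
  -- minimisers. Otherwise all indices on `A` are one larger than for the remaining blocks. Coverage
  -- excludes a minimiser in no block when the list runs out.
  firstIntersection⇔UniqueMin : ∀ Ss A → (∀ {i} → i ∈ˢ A → Covers Ss i) →
    (∣ firstIntersection A Ss ∣ ≡ 1 → UniqueMin (blockIndex Ss) A) ×
    (UniqueMin (blockIndex Ss) A → ∣ firstIntersection A Ss ∣ ≡ 1)
  firstIntersection⇔UniqueMin [] A covers =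
    (λ eq → contradiction (≡.trans (≡.sym (Subset.∣⊥∣≡0 n)) eq) λ ()) ,
    (λ (j , j∈A , _) → contradiction (proj₁ (proj₂ (covers j∈A))) λ ())
  firstIntersection⇔UniqueMin (S ∷ Ss) A covers with nonempty? (A ∩ S)
  ... | yes (i , i∈) = to , from
    where
    to : ∣ A ∩ S ∣ ≡ 1 → UniqueMin (blockIndex (S ∷ Ss)) A
    to eq with card≡1⁻ {A ∩ S} eq
    ... | j , j∈ , unique′ = j , proj₁ (Subset.x∈p∩q⁻ A S j∈) , λ k k∈A k≢j →
      ≡.subst (λ (x , y) → x ℕ.< y)
        (≡.cong₂ _,_ (≡.sym (blockIndex-∈ Ss (proj₂ (Subset.x∈p∩q⁻ A S j∈))))
          (≡.sym (blockIndex-∉ Ss λ k∈S → k≢j (unique′ k (Subset.x∈p∩q⁺ (k∈A , k∈S)))))) (s≤s z≤n)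
    from : UniqueMin (blockIndex (S ∷ Ss)) A → ∣ A ∩ S ∣ ≡ 1
    from (j , j∈A , min) = ≡.subst (λ k → ∣ A ∩ S ∣ ≡ 1) (only i i∈)
      (card≡1⁺ {A ∩ S} (≡.subst (_∈ˢ A ∩ S) (only i i∈) i∈) only)
      where
      only : ∀ k → k ∈ˢ (A ∩ S) → k ≡ j
      only k k∈ with k Fin.≟ j
      ... | yes k≡j = k≡j
      ... | no  k≢j with ≡.subst (_ ℕ.<_) (blockIndex-∈ Ss (proj₂ (Subset.x∈p∩q⁻ A S k∈)))
                          (min k (proj₁ (Subset.x∈p∩q⁻ A S k∈)) k≢j)
      ...   | ()
  ... | no A∩S=∅ = (λ eq → UniqueMin-mono (λ i∈ j∈ i<j →
                      ≡.subst (λ (x , y) → x ℕ.< y) (≡.cong₂ _,_ (≡.sym (index i∈)) (≡.sym (index j∈))) (s≤s i<j))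
                      (proj₁ ih eq)) ,
                   (λ u → proj₂ ih (UniqueMin-mono (λ i∈ j∈ i<j →
                      ℕ.s<s⁻¹ (≡.subst (λ (x , y) → x ℕ.< y) (≡.cong₂ _,_ (index i∈) (index j∈)) i<j)) u))
    where
    ∉S : ∀ {i} → i ∈ˢ A → i ∉ˢ S
    ∉S i∈A i∈S = A∩S=∅ (_ , Subset.x∈p∩q⁺ (i∈A , i∈S))
    index : ∀ {i} → i ∈ˢ A → blockIndex (S ∷ Ss) i ≡ suc (blockIndex Ss i)
    index i∈A = blockIndex-∉ Ss (∉S i∈A)
    covers′ : ∀ {i} → i ∈ˢ A → Covers Ss i
    covers′ i∈A with covers i∈A
    ... | _ , here ≡.refl , i∈S = contradiction i∈S (∉S i∈A)
    ... | T , there T∈ , i∈T  = T , T∈ , i∈T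
    ih = firstIntersection⇔UniqueMin Ss A covers′

  ∈-⋃⁻ : ∀ Ss {i} → i ∈ˢ ⋃ Ss → Covers Ss i
  ∈-⋃⁻ []       i∈ = contradiction i∈ Subset.∉⊥
  ∈-⋃⁻ (S ∷ Ss) i∈ with Subset.x∈p∪q⁻ S (⋃ Ss) i∈
  ... | inj₁ i∈S = S , here ≡.refl , i∈S
  ... | inj₂ i∈′ = let T , T∈ , i∈T = ∈-⋃⁻ Ss i∈′ in T , there T∈ , i∈T

  ∈-⋃⁺ : ∀ {Ss i} → Covers Ss i → i ∈ˢ ⋃ Ss
  ∈-⋃⁺ (S , here ≡.refl , i∈S) = Subset.x∈p∪q⁺ (inj₁ i∈S)
  ∈-⋃⁺ {T ∷ _} (S , there S∈ , i∈S) = Subset.x∈p∪q⁺ {p = T} (inj₂ (∈-⋃⁺ (S , S∈ , i∈S)))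

  -- An empty block meets no `A`. Level sets may be empty, but the blocks of a set composition may
  -- not.
  firstIntersection-nonempty : ∀ (A : Subset n) Ss → firstIntersection A (filter nonempty? Ss) ≡ firstIntersection A Ss
  firstIntersection-nonempty A []       = ≡.refl
  firstIntersection-nonempty A (S ∷ Ss) with nonempty? S
  ... | yes _ = ≡.cong (if does (nonempty? (A ∩ S)) then A ∩ S else_) (firstIntersection-nonempty A Ss)
  ... | no S-empty with nonempty? (A ∩ S)
  ...   | yes (i , i∈) = contradiction (i , proj₂ (Subset.x∈p∩q⁻ A S i∈)) S-empty
  ...   | no _ = firstIntersection-nonempty A Ss

  Orth⇒UniqueMin : ∀ {A} π → Orth A π → UniqueMin (blockIndex (SetComposition.blocks π)) A
  Orth⇒UniqueMin {A} π = proj₁ (firstIntersection⇔UniqueMin (SetComposition.blocks π) A λ _ →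
    ∈-⋃⁻ _ (≡.subst (_ ∈ˢ_) (≡.sym (SetComposition.covers π)) Subset.∈⊤))

  UniqueMin⇒Orth : ∀ {A} π → UniqueMin (blockIndex (SetComposition.blocks π)) A → Orth A π
  UniqueMin⇒Orth {A} π = proj₂ (firstIntersection⇔UniqueMin (SetComposition.blocks π) A λ _ →
    ∈-⋃⁻ _ (≡.subst (_ ∈ˢ_) (≡.sym (SetComposition.covers π)) Subset.∈⊤))

module _ {n} (f : Fin n → ℕ) where

  level : ℕ → Subset n
  level v = tabulate (λ i → does (f i ℕ.≟ v))

  ∈-level⁺ : ∀ {i v} → f i ≡ v → i ∈ˢ level v
  ∈-level⁺ {i} {v} eq =
    Vec.lookup⇒[]= i _ (≡.trans (Vec.lookup∘tabulate _ i) (dec-true (f i ℕ.≟ v) eq))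

  ∈-level⁻ : ∀ {i v} → i ∈ˢ level v → f i ≡ v
  ∈-level⁻ {i} {v} i∈ =
    does-true (f i ℕ.≟ v) (≡.trans (≡.sym (Vec.lookup∘tabulate (λ i → does (f i ℕ.≟ v)) i)) (Vec.[]=⇒lookup i∈))
    where
    does-true : ∀ {P : Set} (P? : Dec P) → does P? ≡ true → P
    does-true (yes p) _ = p

  levels : ℕ → ℕ → List (Subset n)
  levels v zero    = []
  levels v (suc k) = level v ∷ levels (suc v) k

  -- Empty levels are still present here, so the block index gives back `f` itself and not merely
  -- its order. The offset `v` serves the induction.
  blockIndex-levels : ∀ v k {i} → v ℕ.≤ f i → f i ℕ.< v ℕ.+ k → v ℕ.+ blockIndex (levels v k) i ≡ f i
  blockIndex-levels v zero    v≤ f<v+0 =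
    contradiction (≡.subst (_ ℕ.<_) (ℕ.+-identityʳ v) f<v+0) (ℕ.≤⇒≯ v≤)
  blockIndex-levels v (suc k) {i} v≤ f< with f i ℕ.≟ v
  ... | yes eq = ≡.trans (≡.cong (v ℕ.+_) (blockIndex-∈ (levels (suc v) k) (∈-level⁺ eq)))
                   (≡.trans (ℕ.+-identityʳ v) (≡.sym eq))
  ... | no f≢v = ≡.trans (≡.cong (v ℕ.+_) (blockIndex-∉ (levels (suc v) k) (f≢v ∘ ∈-level⁻)))
    (≡.trans (ℕ.+-suc v _) (blockIndex-levels (suc v) k (ℕ.≤∧≢⇒< v≤ (f≢v ∘ ≡.sym)) (≡.subst (f i ℕ.<_) (ℕ.+-suc v k) f<)))

  levels-covers : ∀ v k {i} → v ℕ.≤ f i → f i ℕ.< v ℕ.+ k → Covers (levels v k) i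
  levels-covers v zero    v≤ f<v+0 =
    contradiction (≡.subst (_ ℕ.<_) (ℕ.+-identityʳ v) f<v+0) (ℕ.≤⇒≯ v≤)
  levels-covers v (suc k) {i} v≤ f< with f i ℕ.≟ v
  ... | yes eq = level v , here ≡.refl , ∈-level⁺ eq
  ... | no f≢v = let S , S∈ , i∈ = levels-covers (suc v) k (ℕ.≤∧≢⇒< v≤ (f≢v ∘ ≡.sym)) (≡.subst (f i ℕ.<_) (ℕ.+-suc v k) f<)
                 in S , there S∈ , i∈

  levels-disjoint : ∀ v k → AllPairs (λ S T → Empty (S ∩ T)) (levels v k)
  levels-disjoint v zero    = []
  levels-disjoint v (suc k) = head-disjoint (suc v) k ℕ.≤-refl ∷ levels-disjoint (suc v) k
    where
    head-disjoint : ∀ w k → v ℕ.< w → All (λ T → Empty (level v ∩ T)) (levels w k)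
    head-disjoint w zero    v<w = []
    head-disjoint w (suc k) v<w =
      (λ (i , i∈) → let i∈v , i∈w = Subset.x∈p∩q⁻ (level v) (level w) i∈ in
         ℕ.<⇒≢ v<w (≡.trans (≡.sym (∈-level⁻ i∈v)) (∈-level⁻ i∈w))) ∷
      head-disjoint (suc w) k (ℕ.m<n⇒m<1+n v<w)

  module _ {N} (f<N : ∀ i → f i ℕ.< N) where

    levelComposition : SetComposition n
    levelComposition = record
      { blocks   = filter nonempty? (levels 0 N)
      ; nonempty = All.all-filter nonempty? (levels 0 N)
      ; disjoint = AllPairs.filter⁺ nonempty? (levels-disjoint 0 N)
      ; covers   = Subset.⊆-antisym Subset.⊆⊤ λ {i} _ →
          let S , S∈ , i∈S = levels-covers 0 N z≤n (f<N i) in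
          ∈-⋃⁺ (S , ∈-filter⁺ nonempty? S∈ (i , i∈S) , i∈S)
      }

    private
      characterisation = λ A → firstIntersection⇔UniqueMin (levels 0 N) A λ {i} _ → levels-covers 0 N z≤n (f<N i)

    Orth-level⇒UniqueMin : ∀ {A} → Orth A levelComposition → UniqueMin f A
    Orth-level⇒UniqueMin {A} orth = UniqueMin-cong (λ i → blockIndex-levels 0 N z≤n (f<N i))
      (proj₁ (characterisation A) (≡.trans (≡.cong (∣_∣ {n}) (≡.sym (firstIntersection-nonempty A (levels 0 N)))) orth))

    UniqueMin⇒Orth-level : ∀ {A} → UniqueMin f A → Orth A levelComposition
    UniqueMin⇒Orth-level {A} u = ≡.trans (≡.cong (∣_∣ {n}) (firstIntersection-nonempty A (levels 0 N)))
      (proj₂ (characterisation A) (UniqueMin-cong (λ i → ≡.sym (blockIndex-levels 0 N z≤n (f<N i))) u))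

variableBound-< : ∀ {x} m → x ∈ m → x ℕ.< variableBound m
variableBound-< (y ∷ m) (here ≡.refl) = s≤s (ℕ.m≤m⊔n y (foldr ℕ._⊔_ 0 m))
variableBound-< (y ∷ m) (there x∈)  = ℕ.<-≤-trans (variableBound-< m x∈) (s≤s (ℕ.m≤n⊔m y (foldr ℕ._⊔_ 0 m)))

-- The rank of a word

module Rank (em : ExcludedMiddle 0ℓ) where

  uniqueMin? : ∀ {n} (f : Fin n → ℕ) J → Dec (UniqueMin f J)
  uniqueMin? f J = em

  rank : ∀ {n} → (Fin n → ℕ) → ℕ
  rank {n} f = length (filter (uniqueMin? f) (nonemptySubsets n))

  -- A set with a unique minimiser for `h` only would make the inclusion of families strict, and
  -- with it the inequality of their sizes.
  rank-reflects : ∀ {n} {f h : Fin n → ℕ} → (∀ J → UniqueMin f J → UniqueMin h J) → rank h ℕ.≤ rank f →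
                  ∀ J → UniqueMin h J → UniqueMin f J
  rank-reflects {n} {f} {h} f⇒h h≤f J uh with uniqueMin? f J
  ... | yes uf = uf
  ... | no ¬uf = contradiction h≤f (ℕ.<⇒≱
    (count-strict (uniqueMin? f) (uniqueMin? h) (nonemptySubsets n) (λ _ → f⇒h _)
      (∈-nonemptySubsets⁺ (UniqueMin⇒Nonempty {f = h} uh)) uh ¬uf))

  rank-permute-≤ : ∀ {n} {f h : Fin n → ℕ} σ → (∀ i → h i ≡ f (σ ⟨$⟩ʳ i)) → rank h ℕ.≤ rank f
  rank-permute-≤ {n} {f} {h} σ h≡ = count-injection (uniqueMin? h) (uniqueMin? f) (image σ)
    (nonemptySubsets-unique n)
    (λ _ u → let u′ = UniqueMin-image {f = f} {h} σ h≡ u in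
             ∈-nonemptySubsets⁺ (UniqueMin⇒Nonempty {f = f} u′) , u′)
    (λ _ _ → image-injective σ)

  rank-↭ : ∀ {n} (f h : Vec ℕ n) → toList f ↭ toList h → rank (lookup f) ≡ rank (lookup h)
  rank-↭ f h f↭h = ℕ.≤-antisym
    (let σ , eq = ↭⇒permutation f h f↭h in rank-permute-≤ σ eq)
    (let σ , eq = ↭⇒permutation h f (↭-sym f↭h) in rank-permute-≤ σ eq)

argmin : ∀ {n} (f : Fin n → ℕ) {J} → Nonempty J →
         ∃[ m ] m ∈ˢ J × (∀ k → k ∈ˢ J → f m ℕ.≤ f k)
argmin f {J} (j , j∈J) = descend (f j) j j∈J ℕ.≤-refl
  where
  -- `N` bounds the current letter and decreases each time a smaller letter is found in `J`.
  descend : ∀ N j → j ∈ˢ J → f j ℕ.≤ N → ∃[ m ] m ∈ˢ J × (∀ k → k ∈ˢ J → f m ℕ.≤ f k)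
  descend N j j∈J fj≤N with Fin.any? (λ k → (k Subset.∈? J) ×-dec (f k ℕ.<? f j))
    where open import Relation.Nullary.Decidable using (_×-dec_)
  descend N       j j∈J fj≤N | no  none = j , j∈J , λ k k∈J → ℕ.≮⇒≥ λ fk<fj → none (k , k∈J , fk<fj)
  descend zero    j j∈J fj≤N | yes (k , k∈J , fk<fj) = contradiction (ℕ.<-≤-trans fk<fj fj≤N) λ ()
  descend (suc N) j j∈J fj≤N | yes (k , k∈J , fk<fj) = descend N k k∈J (ℕ.≤-pred (ℕ.≤-trans fk<fj fj≤N))

-- Inequalities and finite sums of real numbers

module Geometry (em : ExcludedMiddle 0ℓ) (ℝ : RealNumbers) where
  open RealNumbers ℝ
  open Polytopes ℝ
  open Sums +-commutativeMonoid using (sum; sum-cong-≋; ∑-comm; sum-permute; ∑-distrib-+)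
  open SemiringSum semiring using (*-distribˡ-sum)
  open import Algebra.Definitions.RawMonoid +-rawMonoid using () renaming (_×_ to _×ℕ_)
  open Mult +-monoid using (×-congʳ; ×-homo-+)
  open SemiringMult semiring using (×-comm-*)
  open import Algebra.Properties.Group +-group using (∙-cancelˡ)
  open import Algebra.Properties.CommutativeSemigroup +-commutativeSemigroup using (interchange)
  private module ≈-Reasoning = SetoidReasoning setoid

  ≤-resp : ∀ {x x′ y y′} → x ≈ x′ → y ≈ y′ → x ≤ y → x′ ≤ y′
  ≤-resp x≈ y≈ x≤y = ≤-respˡ-≈ x≈ (≤-respʳ-≈ y≈ x≤y)

  +-monoʳ-≤ : ∀ z {x y} → x ≤ y → z + x ≤ z + y
  +-monoʳ-≤ z x≤y = ≤-resp (+-comm _ z) (+-comm _ z) (+-monoˡ-≤ z x≤y)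

  +-mono-≤ : ∀ {w x y z} → w ≤ x → y ≤ z → w + y ≤ x + z
  +-mono-≤ {x = x} {y} w≤x y≤z = ≤-trans (+-monoˡ-≤ y w≤x) (+-monoʳ-≤ x y≤z)

  +-cancelˡ-≤ : ∀ z {x y} → z + x ≤ z + y → x ≤ y
  +-cancelˡ-≤ z {x} {y} h = ≤-resp (cancel x) (cancel y) (+-monoʳ-≤ (- z) h)
    where
    cancel : ∀ w → - z + (z + w) ≈ w
    cancel w = trans (sym (+-assoc _ _ _)) (trans (+-congʳ (-‿inverseˡ z)) (+-identityˡ w))

  -- Equality in a sum of inequalities forces equality in each of them. The uniqueness statements
  -- about faces below come down to this.
  +-squeeze : ∀ {x x′ y y′} → x ≤ x′ → y ≤ y′ → x′ + y′ ≤ x + y → x ≈ x′ × y ≈ y′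
  +-squeeze {x} {x′} {y} {y′} x≤ y≤ h =
    antisym x≤ (+-cancelˡ-≤ y (≤-resp (+-comm _ _) (+-comm _ _) (≤-trans (+-monoʳ-≤ x′ y≤) h))) ,
    antisym y≤ (+-cancelˡ-≤ x (≤-trans (+-monoˡ-≤ y′ x≤) h))

  *-monoʳ-≤ : ∀ {a x y} → 0# ≤ a → x ≤ y → a * x ≤ a * y
  *-monoʳ-≤ {a} {x} {y} 0≤a x≤y = ≤-resp (+-identityˡ _) eq
    (+-monoˡ-≤ (a * x) (*-nonneg 0≤a (≤-respˡ-≈ (-‿inverseʳ x) (+-monoˡ-≤ (- x) x≤y))))
    where
    eq : a * (y + - x) + a * x ≈ a * y
    eq = trans (sym (distribˡ a _ _))
      (*-congˡ (trans (+-assoc y _ _) (trans (+-congˡ (-‿inverseˡ x)) (+-identityʳ y))))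

  *-cancelˡ-pos : ∀ {a x y} → 0# < a → a * x ≈ a * y → x ≈ y
  *-cancelˡ-pos {a} {x} {y} (_ , 0≉a) ax≈ay with inverse a (0≉a ∘ sym)
  ... | u , au≈1 = begin
    x             ≈⟨ cancel x ⟨
    u * (a * x)   ≈⟨ *-congˡ ax≈ay ⟩
    u * (a * y)   ≈⟨ cancel y ⟩
    y             ∎
    where
    open ≈-Reasoning
    cancel : ∀ w → u * (a * w) ≈ w
    cancel w = trans (sym (*-assoc u a w))
      (trans (*-congʳ (trans (*-comm u a) au≈1)) (*-identityˡ w))

  ×-nonneg : ∀ k {x} → 0# ≤ x → 0# ≤ k ×ℕ x
  ×-nonneg zero    0≤x = ≤-refl
  ×-nonneg (suc k) 0≤x = +-nonneg 0≤x (×-nonneg k 0≤x)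

  ×-monoˡ-≤ : ∀ {k l} x → 0# ≤ x → k ℕ.≤ l → k ×ℕ x ≤ l ×ℕ x
  ×-monoˡ-≤ x 0≤x (z≤n {l}) = ×-nonneg l 0≤x
  ×-monoˡ-≤ x 0≤x (s≤s k≤l) = +-monoʳ-≤ x (×-monoˡ-≤ x 0≤x k≤l)

  ×-strict : ∀ {k l} x → 0# ≤ x → k ℕ.< l → k ×ℕ x ≈ l ×ℕ x → x ≈ 0#
  ×-strict {zero} {suc l} x 0≤x _ eq =
    antisym (≤-resp (+-identityʳ x) (sym eq) (+-monoʳ-≤ x (×-nonneg l 0≤x))) 0≤x
  ×-strict {suc k} {suc l} x 0≤x (s≤s k<l) eq = ×-strict x 0≤x k<l (∙-cancelˡ x _ _ eq)

  ×-zero : ∀ k {x} → x ≈ 0# → k ×ℕ x ≈ 0#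
  ×-zero zero    _   = refl
  ×-zero (suc k) x≈0 = trans (+-cong x≈0 (×-zero k x≈0)) (+-identityˡ 0#)

  sum-× : ∀ k {n} (x : Point n) → sum (λ i → k ×ℕ x i) ≈ k ×ℕ sum x
  sum-× zero    {zero}  x = refl
  sum-× zero    {suc n} x = trans (+-identityˡ _) (sum-× zero {n} (x ∘ suc))
  sum-× (suc k) x = trans (∑-distrib-+ x (λ i → k ×ℕ x i)) (+-congˡ (sum-× k x))

  sum-zero : ∀ {n} {x : Point n} → (∀ i → x i ≈ 0#) → sum x ≈ 0#
  sum-zero {zero}  _   = refl
  sum-zero {suc n} x≈0 = trans (+-cong (x≈0 zero) (sum-zero (x≈0 ∘ suc))) (+-identityˡ 0#)

  sum-single : ∀ {n} {x : Point n} m → (∀ i → i ≢ m → x i ≈ 0#) → sum x ≈ x m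
  sum-single zero    x≈0 = trans (+-congˡ (sum-zero λ i → x≈0 (suc i) λ ())) (+-identityʳ _)
  sum-single (suc m) x≈0 = trans
    (+-cong (x≈0 zero λ ()) (sum-single m λ i i≢m → x≈0 (suc i) (i≢m ∘ Fin.suc-injective)))
    (+-identityˡ _)

  sum-nonneg : ∀ {n} {x : Point n} → (∀ i → 0# ≤ x i) → 0# ≤ sum x
  sum-nonneg {zero}  _   = ≤-refl
  sum-nonneg {suc n} 0≤x = +-nonneg (0≤x zero) (sum-nonneg (0≤x ∘ suc))

  sum-mono-≤ : ∀ {n} {x y : Point n} → (∀ i → x i ≤ y i) → sum x ≤ sum y
  sum-mono-≤ {zero}  _   = ≤-refl
  sum-mono-≤ {suc n} x≤y = +-mono-≤ (x≤y zero) (sum-mono-≤ (x≤y ∘ suc))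

  sum-squeeze : ∀ {n} {x y : Point n} → (∀ i → x i ≤ y i) → sum y ≤ sum x → ∀ i → x i ≈ y i
  sum-squeeze {suc n} x≤y h i with +-squeeze (x≤y zero) (sum-mono-≤ (x≤y ∘ suc)) h | i
  ... | eq , _  | zero  = eq
  ... | _  , eq | suc j = sum-squeeze (x≤y ∘ suc) (≤-reflexive (sym eq)) j

  -- Simplices and linear functionals

  basis-diagonal : ∀ {n} (j : Fin n) → basis j j ≈ 1#
  basis-diagonal j = reflexive (≡.cong (if_then 1# else 0#) (dec-true (j Fin.≟ j) ≡.refl))

  basis-off-diagonal : ∀ {n} {i j : Fin n} → i ≢ j → basis j i ≈ 0#
  basis-off-diagonal {i = i} {j} i≢j = reflexive (≡.cong (if_then 1# else 0#) (dec-false (i Fin.≟ j) i≢j))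

  basis-nonneg : ∀ {n} (j i : Fin n) → 0# ≤ basis j i
  basis-nonneg j i with i Fin.≟ j
  ... | yes _ = 0≤1
  ... | no  _ = ≤-refl

  basis-permute : ∀ {n} (σ : Permutation′ n) j i → basis j (σ ⟨$⟩ʳ i) ≈ basis (σ ⟨$⟩ˡ j) i
  basis-permute σ j i with i Fin.≟ (σ ⟨$⟩ˡ j)
  ... | yes ≡.refl = trans (reflexive (≡.cong (basis j) (Perm.inverseʳ σ))) (basis-diagonal j)
  ... | no  i≢     = basis-off-diagonal λ eq → i≢ (≡.trans (≡.sym (Perm.inverseˡ σ)) (≡.cong (σ ⟨$⟩ˡ_) eq))

  sum-basis : ∀ {n} (j : Fin n) → sum (basis j) ≈ 1#
  sum-basis j = trans (sum-single j (λ i → basis-off-diagonal)) (basis-diagonal j)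

  basis∈simplex : ∀ {n} {J : Subset n} {j} → j ∈ˢ J → simplex J (basis j)
  basis∈simplex {j = j} j∈J = 1 , (λ _ → 1#) , (λ _ → basis j) , (λ _ → 0≤1) ,
    (λ _ → j , j∈J , λ _ → refl) , +-identityʳ 1# ,
    λ i → sym (trans (+-identityʳ _) (*-identityˡ _))

  ConvexHull-resp : ∀ {n} {S : Pred (Point n) 0ℓ} {x y} → x ≈ₚ y → ConvexHull S x → ConvexHull S y
  ConvexHull-resp x≈y (k , t , v , 0≤t , v∈S , ∑t≈1 , x≈) =
    k , t , v , 0≤t , v∈S , ∑t≈1 , λ j → trans (sym (x≈y j)) (x≈ j)

  module _ {n} {J : Subset n} {y : Point n} where

    private
      vertex-nonneg : ∀ {v} → vertices J v → ∀ i → 0# ≤ v i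
      vertex-nonneg (j , _ , v≈) i = ≤-respʳ-≈ (sym (v≈ i)) (basis-nonneg j i)

      vertex-sum : ∀ {v} → vertices J v → sum v ≈ 1#
      vertex-sum (j , _ , v≈) = trans (sum-cong-≋ v≈) (sum-basis j)

      vertex-∉ : ∀ {v} → vertices J v → ∀ {i} → i ∉ˢ J → v i ≈ 0#
      vertex-∉ (j , j∈J , v≈) {i} i∉J =
        trans (v≈ i) (basis-off-diagonal λ i≡j → i∉J (≡.subst (_∈ˢ J) (≡.sym i≡j) j∈J))

    -- Together with `simplex-sum` and `simplex-∉`, this is all that is used of a point of a simplex
    -- when a functional is bounded below on it.
    simplex-nonneg : simplex J y → ∀ i → 0# ≤ y i
    simplex-nonneg (k , t , v , 0≤t , v∈ , _ , y≈) i = ≤-respʳ-≈ (sym (y≈ i))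
      (sum-nonneg λ l → *-nonneg (0≤t l) (vertex-nonneg (v∈ l) i))

    simplex-sum : simplex J y → sum y ≈ 1#
    simplex-sum (k , t , v , 0≤t , v∈ , ∑t≈1 , y≈) = begin
      sum y                               ≈⟨ sum-cong-≋ y≈ ⟩
      sum (λ j → sum (λ l → t l * v l j)) ≈⟨ ∑-comm (λ j l → t l * v l j) ⟩
      sum (λ l → sum (λ j → t l * v l j)) ≈⟨ sum-cong-≋ (λ l → sym (*-distribˡ-sum (t l) (v l))) ⟩
      sum (λ l → t l * sum (v l))         ≈⟨ sum-cong-≋ (λ l → trans (*-congˡ (vertex-sum (v∈ l))) (*-identityʳ _)) ⟩
      sum t                               ≈⟨ ∑t≈1 ⟩
      1#                                  ∎
      where open ≈-Reasoning

    simplex-∉ : simplex J y → ∀ {i} → i ∉ˢ J → y i ≈ 0#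
    simplex-∉ (k , t , v , 0≤t , v∈ , ∑t≈1 , y≈) {i} i∉J =
      trans (y≈ i) (sum-zero λ l → trans (*-congˡ (vertex-∉ (v∈ l) i∉J)) (zeroʳ _))

  simplex-permute : ∀ {n} (σ : Permutation′ n) {J : Subset n} {y} →
                    simplex (image σ J) y → simplex J (y ∘ (σ ⟨$⟩ʳ_))
  simplex-permute σ (k , t , v , 0≤t , v∈ , ∑t≈1 , y≈) =
    k , t , (λ l → v l ∘ (σ ⟨$⟩ʳ_)) , 0≤t ,
    (λ l → let j , j∈ , v≈ = v∈ l in
       (σ ⟨$⟩ˡ j) , ∈-image⁻ σ j∈ , λ i → trans (v≈ (σ ⟨$⟩ʳ i)) (basis-permute σ j i)) ,
    ∑t≈1 , λ i → y≈ (σ ⟨$⟩ʳ i)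

  module _ {n} (f : Vec ℕ n) where

    private
      L : Point n → Carrier
      L = linearFunctional f

    linear-cong : ∀ {x y} → x ≈ₚ y → L x ≈ L y
    linear-cong x≈y = sum-cong-≋ λ i → ×-congʳ (suc (lookup f i)) (x≈y i)

    ×-distrib-+ : ∀ k x y → k ×ℕ (x + y) ≈ k ×ℕ x + k ×ℕ y
    ×-distrib-+ zero    x y = sym (+-identityˡ 0#)
    ×-distrib-+ (suc k) x y = trans (+-congˡ (×-distrib-+ k x y)) (interchange _ _ _ _)

    linear-+ : ∀ x y → L (λ i → x i + y i) ≈ L x + L y
    linear-+ x y = trans (sum-cong-≋ λ i → ×-distrib-+ (suc (lookup f i)) (x i) (y i))
                     (∑-distrib-+ (λ i → suc (lookup f i) ×ℕ x i) (λ i → suc (lookup f i) ×ℕ y i))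

    linear-* : ∀ a x → L (λ i → a * x i) ≈ a * L x
    linear-* a x = trans (sum-cong-≋ λ i → sym (×-comm-* (suc (lookup f i)) a (x i)))
                     (sym (*-distribˡ-sum a (λ i → suc (lookup f i) ×ℕ x i)))

    linear-basis : ∀ j → L (basis j) ≈ suc (lookup f j) ×ℕ 1#
    linear-basis j = trans
      (sum-single j λ i i≢j → ×-zero (suc (lookup f i)) (basis-off-diagonal i≢j))
      (×-congʳ (suc (lookup f j)) (basis-diagonal j))

    module _ {J : Subset n} {m} (min : ∀ k → k ∈ˢ J → lookup f m ℕ.≤ lookup f k)
             {y : Point n} (y∈ : simplex J y) where

      private
        termwise : ∀ i → suc (lookup f m) ×ℕ y i ≤ suc (lookup f i) ×ℕ y i
        termwise i with i Subset.∈? J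
        ... | yes i∈J = ×-monoˡ-≤ (y i) (simplex-nonneg y∈ i) (s≤s (min i i∈J))
        ... | no  i∉J = ≤-reflexive (trans (×-zero (suc (lookup f m)) (simplex-∉ y∈ i∉J))
                                      (sym (×-zero (suc (lookup f i)) (simplex-∉ y∈ i∉J))))

        weighted : sum (λ i → suc (lookup f m) ×ℕ y i) ≈ L (basis m)
        weighted = trans (sum-× (suc (lookup f m)) y)
                  (trans (×-congʳ (suc (lookup f m)) (simplex-sum y∈)) (sym (linear-basis m)))

      -- The weight of `m` is least on `J` and the coordinates sum to 1, so lowering every weight to
      -- it gives exactly the value at `basis m`.
      linear-simplex : L (basis m) ≤ L y
      linear-simplex = ≤-respˡ-≈ weighted (sum-mono-≤ termwise)

      -- Equal values force equality in every term, and on `J` away from `m` the weight is strictly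
      -- larger, so the coordinate vanishes. The coordinate at `m` is then the whole sum.
      simplex-face : (∀ k → k ∈ˢ J → k ≢ m → lookup f m ℕ.< lookup f k) →
                     L y ≤ L (basis m) → y ≈ₚ basis m
      simplex-face strict Ly≤ = coordinates
        where
        vanishes : ∀ i → i ≢ m → y i ≈ 0#
        vanishes i i≢m with i Subset.∈? J
        ... | yes i∈J = ×-strict (y i) (simplex-nonneg y∈ i) (s≤s (strict i i∈J i≢m))
                          (sum-squeeze termwise (≤-respʳ-≈ (sym weighted) Ly≤) i)
        ... | no  i∉J = simplex-∉ y∈ i∉J
        coordinates : y ≈ₚ basis m
        coordinates i with i Fin.≟ m
        ... | yes ≡.refl = trans (sym (sum-single i vanishes)) (simplex-sum y∈)
        ... | no  i≢m    = vanishes i i≢m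

  -- Minkowski sums and permutations of coordinates

  minkowskiSum-resp : ∀ {n} (Ps : List (Pred (Point n) 0ℓ)) {x y} → x ≈ₚ y →
                      minkowskiSum Ps x → minkowskiSum Ps y
  minkowskiSum-resp []       x≈y x≈0 i = trans (sym (x≈y i)) (x≈0 i)
  minkowskiSum-resp (P ∷ Ps) x≈y (p , q , p∈ , q∈ , x≈) =
    p , q , p∈ , q∈ , λ i → trans (sym (x≈y i)) (x≈ i)

  minkowskiSum-↭ : ∀ {n} {Ps Qs : List (Pred (Point n) 0ℓ)} → Ps ↭ Qs → ∀ {x} →
                   minkowskiSum Ps x → minkowskiSum Qs x
  minkowskiSum-↭ ↭.refl         x∈ = x∈
  minkowskiSum-↭ (↭.prep P Ps↭) (p , q , p∈ , q∈ , x≈) = p , q , p∈ , minkowskiSum-↭ Ps↭ q∈ , x≈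
  minkowskiSum-↭ (↭.swap P Q Ps↭) (p , _ , p∈ , (q , r , q∈ , r∈ , y≈) , x≈) =
    q , (λ i → p i + r i) , q∈ , (p , r , p∈ , minkowskiSum-↭ Ps↭ r∈ , λ _ → refl) ,
    λ i → trans (x≈ i) (trans (+-congˡ (y≈ i))
      (trans (sym (+-assoc _ _ _)) (trans (+-congʳ (+-comm _ _)) (+-assoc _ _ _))))
  minkowskiSum-↭ (↭.trans Ps↭ ↭Qs) x∈ = minkowskiSum-↭ ↭Qs (minkowskiSum-↭ Ps↭ x∈)

  ⟦⟧-resp : ∀ {n} (𝔮 : HypergraphicPolytope n) {x y} → x ≈ₚ y → ⟦ 𝔮 ⟧ x → ⟦ 𝔮 ⟧ y
  ⟦⟧-resp {n} 𝔮 = minkowskiSum-resp (map (λ J → coefficient 𝔮 J ⊙ simplex J) (nonemptySubsets n))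

  image-nonemptySubsets : ∀ {n} (σ : Permutation′ n) → nonemptySubsets n ↭ map (image σ) (nonemptySubsets n)
  image-nonemptySubsets {n} σ = unique-set⇒↭
    (nonemptySubsets-unique n)
    (Unique.map⁺ (image-injective σ) (nonemptySubsets-unique n))
    (λ {J} J∈ → let j , j∈J = ∈-nonemptySubsets⁻ J∈ in
       ≡.subst (_∈ map (image σ) (nonemptySubsets n)) (image-flip (Perm.flip σ) J)
         (∈-map⁺ (image σ) (∈-nonemptySubsets⁺ ((σ ⟨$⟩ˡ j) , ∈-image⁺′ (Perm.flip σ) j∈J))))
    image⊆
    where
    image⊆ : ∀ {J} → J ∈ map (image σ) (nonemptySubsets n) → J ∈ nonemptySubsets n
    image⊆ J∈ with ∈-map⁻ (image σ) J∈
    ... | I , I∈ , ≡.refl = let i , i∈I = ∈-nonemptySubsets⁻ I∈ in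
      ∈-nonemptySubsets⁺ ((σ ⟨$⟩ʳ i) , ∈-image⁺′ σ i∈I)

  -- `image σ` permutes the non-empty subsets, so the Minkowski sum may be reindexed by it;
  -- afterwards the coordinates are permuted summand by summand.
  ⟦⟧-permute : ∀ {n} (𝔭 𝔮 : HypergraphicPolytope n) σ →
               (∀ J → coefficient 𝔮 (image σ J) ≈ coefficient 𝔭 J) →
               ∀ {x} → ⟦ 𝔮 ⟧ x → ⟦ 𝔭 ⟧ (x ∘ (σ ⟨$⟩ʳ_))
  ⟦⟧-permute {n} 𝔭 𝔮 σ same x∈ =
    go (nonemptySubsets n) (minkowskiSum-↭ (↭.map⁺ _ (image-nonemptySubsets σ)) x∈)
    where
    go : ∀ Js {x} → minkowskiSum (map (λ J → coefficient 𝔮 J ⊙ simplex J) (map (image σ) Js)) x →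
         minkowskiSum (map (λ J → coefficient 𝔭 J ⊙ simplex J) Js) (x ∘ (σ ⟨$⟩ʳ_))
    go []       x≈0 i = x≈0 (σ ⟨$⟩ʳ i)
    go (J ∷ Js) (p , q , (y , y∈ , p≈) , q∈ , x≈) =
      p ∘ (σ ⟨$⟩ʳ_) , q ∘ (σ ⟨$⟩ʳ_) ,
      (y ∘ (σ ⟨$⟩ʳ_) , simplex-permute σ y∈ , λ i → trans (p≈ (σ ⟨$⟩ʳ i)) (*-congʳ (same J))) ,
      go Js q∈ , λ i → x≈ (σ ⟨$⟩ʳ i)

  ⟦⟧-permute-≐ : ∀ {n} (𝔭 𝔮 : HypergraphicPolytope n) σ →
                 (∀ J → coefficient 𝔮 (image σ J) ≈ coefficient 𝔭 J) →
                 ⟦ 𝔮 ⟧ ≐ (λ x → ⟦ 𝔭 ⟧ (x ∘ (σ ⟨$⟩ʳ_)))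
  ⟦⟧-permute-≐ 𝔭 𝔮 σ same = ⟦⟧-permute 𝔭 𝔮 σ same , λ {x} x∈ →
    ⟦⟧-resp 𝔮 (λ i → reflexive (≡.cong x (Perm.inverseʳ σ)))
      (⟦⟧-permute 𝔮 𝔭 (Perm.flip σ)
        (λ J → trans (sym (same (image (Perm.flip σ) J)))
                 (reflexive (≡.cong (coefficient 𝔮) (image-flip (Perm.flip σ) J)))) x∈)

  -- Genericity in terms of unique minimisers

  module _ {n} (𝔮 : HypergraphicPolytope n) (f : Vec ℕ n) where

    private
      a = coefficient 𝔮

      L : Point n → Carrier
      L = linearFunctional f

      ∑⟦_⟧ : List (Subset n) → Pred (Point n) 0ℓ
      ∑⟦ Js ⟧ = minkowskiSum (map (λ J → a J ⊙ simplex J) Js)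

      IsMinimiser : Subset n → Point n → Set
      IsMinimiser J v = ∃[ m ] m ∈ˢ J × (∀ k → k ∈ˢ J → lookup f m ℕ.≤ lookup f k) × v ≈ₚ basis m

      -- The point of the Minkowski sum that takes `v J` from each simplex. Keeping the choice `v`
      -- as a parameter allows two choices to be compared in `generic⇒uniqueMin`.
      ∑ᵥ : (Subset n → Point n) → List (Subset n) → Point n
      ∑ᵥ v Js i = foldr (λ J s → a J * v J i + s) 0# Js

      minimiser-simplex : ∀ {J v} → IsMinimiser J v → simplex J v
      minimiser-simplex (m , m∈J , _ , v≈) = ConvexHull-resp {S = vertices _} (λ i → sym (v≈ i)) (basis∈simplex m∈J)

      minimiser-≤ : ∀ {J v y} → IsMinimiser J v → simplex J y → L v ≤ L y
      minimiser-≤ (m , m∈J , min , v≈) y∈ =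
        ≤-respˡ-≈ (sym (linear-cong f v≈)) (linear-simplex f min y∈)

      ∑ᵥ∈ : ∀ {v} Js → (∀ {J} → J ∈ Js → IsMinimiser J (v J)) → ∑⟦ Js ⟧ (∑ᵥ v Js)
      ∑ᵥ∈ []       min i = refl
      ∑ᵥ∈ {v} (J ∷ Js) min = _ , ∑ᵥ v Js , (v J , minimiser-simplex (min (here ≡.refl)) , λ _ → refl) ,
        ∑ᵥ∈ Js (min ∘ there) , λ _ → refl

      linear-⊙⊞ : ∀ {x y z p} {c} → (∀ i → x i ≈ p i + z i) → (∀ i → p i ≈ c * y i) → L x ≈ c * L y + L z
      linear-⊙⊞ {x} {y} {z} {p} {c} x≈ p≈ = begin
        L x                          ≈⟨ linear-cong f x≈ ⟩
        L (λ i → p i + z i)          ≈⟨ linear-+ f p z ⟩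
        L p + L z                    ≈⟨ +-congʳ (linear-cong f p≈) ⟩
        L (λ i → c * y i) + L z      ≈⟨ +-congʳ (linear-* f c y) ⟩
        c * L y + L z                ∎
        where open ≈-Reasoning

      -- A linear functional on a Minkowski sum is minimised summand by summand.
      ∑ᵥ-≤ : ∀ {v} Js → (∀ {J} → J ∈ Js → IsMinimiser J (v J)) → ∀ {y} → ∑⟦ Js ⟧ y → L (∑ᵥ v Js) ≤ L y
      ∑ᵥ-≤ []       min y≈0 = ≤-reflexive (sym (linear-cong f y≈0))
      ∑ᵥ-≤ {v} (J ∷ Js) min {y} (p , z , (y′ , y′∈ , p≈) , z∈ , y≈) = ≤-resp
        (sym (linear-⊙⊞ {y = v J} {z = ∑ᵥ v Js} (λ _ → refl) (λ _ → refl)))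
        (sym (linear-⊙⊞ {y = y′} {z = z} y≈ p≈))
        (+-mono-≤ (*-monoʳ-≤ (nonneg 𝔮 J) (minimiser-≤ (min (here ≡.refl)) y′∈))
          (∑ᵥ-≤ Js (min ∘ there) z∈))

      unique⇒minimiser-face : ∀ {J v y} → UniqueMin (lookup f) J → IsMinimiser J v →
                              simplex J y → L y ≈ L v → y ≈ₚ v
      unique⇒minimiser-face {J} (j , j∈J , strict) (m , m∈J , min , v≈) y∈ Ly≈ i =
        trans (simplex-face f min y∈ (≡.subst (λ l → ∀ k → k ∈ˢ J → k ≢ l → lookup f l ℕ.< lookup f k) j≡m strict)
                (≤-reflexive (trans Ly≈ (linear-cong f v≈))) i)
              (sym (v≈ i))
        where
        j≡m : j ≡ m
        j≡m with m Fin.≟ j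
        ... | yes eq = ≡.sym eq
        ... | no m≢j = contradiction (strict m m∈J m≢j) (ℕ.≤⇒≯ (min j j∈J))

      -- A point of the face attains the minimum in every summand. Under a positive coefficient this
      -- leaves only the chosen vertex, and a summand with coefficient zero contributes nothing.
      ∑ᵥ-face : ∀ {v} Js → (∀ {J} → J ∈ Js → IsMinimiser J (v J)) →
                (∀ {J} → J ∈ Js → 0# < a J → UniqueMin (lookup f) J) →
                ∀ {y} → ∑⟦ Js ⟧ y → L y ≤ L (∑ᵥ v Js) → y ≈ₚ ∑ᵥ v Js
      ∑ᵥ-face []       min uniq y≈0 _ = y≈0
      ∑ᵥ-face {v} (J ∷ Js) min uniq {y} (p , z , (y′ , y′∈ , p≈) , z∈ , y≈) Ly≤ i
        with +-squeeze (*-monoʳ-≤ (nonneg 𝔮 J) (minimiser-≤ (min (here ≡.refl)) y′∈))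
               (∑ᵥ-≤ Js (min ∘ there) z∈)
               (≤-resp (linear-⊙⊞ {y = y′} {z = z} y≈ p≈)
                 (linear-⊙⊞ {y = v J} {z = ∑ᵥ v Js} (λ _ → refl) (λ _ → refl)) Ly≤)
      ... | aLv≈aLy′ , Lz≈ = trans (y≈ i) (+-cong (trans (p≈ i) head)
              (∑ᵥ-face Js (min ∘ there) (uniq ∘ there) z∈ (≤-reflexive (sym Lz≈)) i))
        where
        head : a J * y′ i ≈ a J * v J i
        head with em {P = a J ≈ 0#}
        ... | yes a≈0 = trans (trans (*-congʳ a≈0) (zeroˡ _)) (sym (trans (*-congʳ a≈0) (zeroˡ _)))
        ... | no  a≉0 = *-congˡ (unique⇒minimiser-face (uniq (here ≡.refl) 0<a) (min (here ≡.refl)) y′∈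
                          (sym (*-cancelˡ-pos 0<a aLv≈aLy′)) i)
          where
          0<a : 0# < a J
          0<a = nonneg 𝔮 J , a≉0 ∘ sym

      ∑ᵥ-mono : ∀ v w Js i → (∀ {J} → J ∈ Js → v J i ≤ w J i) → ∑ᵥ v Js i ≤ ∑ᵥ w Js i
      ∑ᵥ-mono v w []       i v≤w = ≤-refl
      ∑ᵥ-mono v w (J ∷ Js) i v≤w = +-mono-≤ (*-monoʳ-≤ (nonneg 𝔮 J) (v≤w (here ≡.refl))) (∑ᵥ-mono v w Js i (v≤w ∘ there))

      -- The choices need to be comparable in one coordinate only; there, equal sums of termwise
      -- ordered numbers have equal terms.
      ∑ᵥ-squeeze : ∀ v w Js i → (∀ {J} → J ∈ Js → v J i ≤ w J i) → ∑ᵥ v Js i ≈ ∑ᵥ w Js i →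
                   ∀ {J} → J ∈ Js → a J * v J i ≈ a J * w J i
      ∑ᵥ-squeeze v w (J ∷ Js) i v≤w eq J∈
        with +-squeeze (*-monoʳ-≤ (nonneg 𝔮 J) (v≤w (here ≡.refl))) (∑ᵥ-mono v w Js i (v≤w ∘ there))
               (≤-reflexive (sym eq)) | J∈
      ... | aJ≈ , _    | here ≡.refl = aJ≈
      ... | _   , rest | there J∈′   = ∑ᵥ-squeeze v w Js i (v≤w ∘ there) rest J∈′

      vertex : Subset n → Point n
      vertex J with nonempty? J
      ... | yes ne = basis (proj₁ (argmin (lookup f) ne))
      ... | no  _  = λ _ → 0#

      vertex-minimiser : ∀ {J} → J ∈ nonemptySubsets n → IsMinimiser J (vertex J)
      vertex-minimiser {J} J∈ with nonempty? J
      ... | yes ne = let m , m∈J , min = argmin (lookup f) ne in m , m∈J , min , λ _ → refl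
      ... | no ¬ne = contradiction (∈-nonemptySubsets⁻ J∈) ¬ne

    uniqueMin⇒generic : (∀ {J} → 𝓕 𝔮 J → UniqueMin (lookup f) J) → IsGeneric 𝔮 f
    uniqueMin⇒generic uniq =
      ∑ᵥ vertex Js , (∑ᵥ∈ Js vertex-minimiser , λ y → ∑ᵥ-≤ Js vertex-minimiser) ,
      λ y (y∈ , y≤) → ∑ᵥ-face Js vertex-minimiser (λ J∈ 0<a → uniq (∈-nonemptySubsets⁻ J∈ , 0<a)) y∈
        (y≤ (∑ᵥ vertex Js) (∑ᵥ∈ Js vertex-minimiser))
      where
      Js = nonemptySubsets n

    -- Two minimisers m and k of J would give two points of the face: those that
    -- choose m, respectively k, from J and the same vertices elsewhere.
    generic⇒uniqueMin : IsGeneric 𝔮 f → ∀ {J} → 𝓕 𝔮 J → UniqueMin (lookup f) J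
    generic⇒uniqueMin (x , _ , only) {J₀} (ne , 0<a) with argmin (lookup f) ne
    ... | m , m∈ , min = m , m∈ , strict
      where
      Js = nonemptySubsets n
      choose : Fin n → Subset n → Point n
      choose l J with Vec.≡-dec Bool._≟_ J J₀
      ... | yes _ = basis l
      ... | no  _ = vertex J
      choose-minimiser : ∀ {l} → l ∈ˢ J₀ → (∀ k → k ∈ˢ J₀ → lookup f l ℕ.≤ lookup f k) →
                         ∀ {J} → J ∈ Js → IsMinimiser J (choose l J)
      choose-minimiser {l} l∈ l-min {J} J∈ with Vec.≡-dec Bool._≟_ J J₀
      ... | yes ≡.refl = l , l∈ , l-min , λ _ → refl
      ... | no  _      = vertex-minimiser J∈
      choose-J₀ : ∀ l i → choose l J₀ i ≈ basis l i
      choose-J₀ l i with Vec.≡-dec Bool._≟_ J₀ J₀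
      ... | yes _  = refl
      ... | no ¬eq = contradiction ≡.refl ¬eq
      unique-point : ∀ {l} → l ∈ˢ J₀ → (∀ k → k ∈ˢ J₀ → lookup f l ℕ.≤ lookup f k) → ∑ᵥ (choose l) Js ≈ₚ x
      unique-point l∈ l-min = only _
        (∑ᵥ∈ Js (choose-minimiser l∈ l-min) , λ y → ∑ᵥ-≤ Js (choose-minimiser l∈ l-min))
      strict : ∀ k → k ∈ˢ J₀ → k ≢ m → lookup f m ℕ.< lookup f k
      strict k k∈ k≢m = ℕ.≤∧≢⇒< (min k k∈) λ fm≡fk →
        let k-min = λ l l∈ → ≡.subst (ℕ._≤ lookup f l) fm≡fk (min l l∈)
            points≈ = trans (unique-point k∈ k-min m) (sym (unique-point m∈ min m))
            -- In coordinate `m` the two choices agree outside `J₀`, and on `J₀` they give 0 and 1.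
            -- The sums being equal, the positive coefficient of `J₀` can be cancelled.
            a0≈a1 = ∑ᵥ-squeeze (choose k) (choose m) Js m smaller points≈ (∈-nonemptySubsets⁺ ne)
        in 0≉1 (begin
          0#               ≈⟨ basis-off-diagonal (k≢m ∘ ≡.sym) ⟨
          basis k m        ≈⟨ choose-J₀ k m ⟨
          choose k J₀ m    ≈⟨ *-cancelˡ-pos 0<a a0≈a1 ⟩
          choose m J₀ m    ≈⟨ choose-J₀ m m ⟩
          basis m m        ≈⟨ basis-diagonal m ⟩
          1#               ∎)
        where
        open ≈-Reasoning
        smaller : ∀ {J} → J ∈ Js → choose k J m ≤ choose m J m
        smaller {J} _ with Vec.≡-dec Bool._≟_ J J₀
        ... | yes _ = ≤-resp (sym (basis-off-diagonal (k≢m ∘ ≡.sym))) (sym (basis-diagonal m)) 0≤1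
        ... | no  _ = ≤-refl

  IsGeneric-≐ : ∀ {n} {𝔭 𝔮 : HypergraphicPolytope n} {f} → ⟦ 𝔭 ⟧ ≐ ⟦ 𝔮 ⟧ → IsGeneric 𝔭 f → IsGeneric 𝔮 f
  IsGeneric-≐ (p⊆q , q⊆p) (x , (x∈ , x≤) , only) =
    x , (p⊆q x∈ , λ y y∈ → x≤ y (q⊆p y∈)) , λ y (y∈ , y≤) → only y (q⊆p y∈ , λ z z∈ → y≤ z (p⊆q z∈))

  linear-permute : ∀ {n} (f g : Vec ℕ n) σ → (∀ i → lookup g i ≡ lookup f (σ ⟨$⟩ʳ i)) →
                   ∀ x → linearFunctional f x ≈ linearFunctional g (x ∘ (σ ⟨$⟩ʳ_))
  linear-permute f g σ g≡ x = trans (sum-permute (λ i → suc (lookup f i) ×ℕ x i) σ)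
    (sum-cong-≋ λ i → reflexive (≡.cong (λ k → suc k ×ℕ x (σ ⟨$⟩ʳ i)) (≡.sym (g≡ i))))

  ⟦⟧-permute-flip : ∀ {n} {𝔭 𝔮 : HypergraphicPolytope n} σ → ⟦ 𝔭 ⟧ ≐ (λ x → ⟦ 𝔮 ⟧ (x ∘ (σ ⟨$⟩ʳ_))) →
                    ⟦ 𝔮 ⟧ ≐ (λ x → ⟦ 𝔭 ⟧ (x ∘ (σ ⟨$⟩ˡ_)))
  ⟦⟧-permute-flip {𝔭 = 𝔭} {𝔮} σ (p⊆q , q⊆p) =
    (λ {x} x∈ → q⊆p (⟦⟧-resp 𝔮 (λ i → reflexive (≡.cong x (≡.sym (Perm.inverseˡ σ)))) x∈)) ,
    (λ {x} x∈ → ⟦⟧-resp 𝔮 (λ i → reflexive (≡.cong x (Perm.inverseˡ σ))) (p⊆q x∈))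

  IsGeneric-permute : ∀ {n} {𝔭 𝔮 : HypergraphicPolytope n} σ → ⟦ 𝔭 ⟧ ≐ (λ x → ⟦ 𝔮 ⟧ (x ∘ (σ ⟨$⟩ʳ_))) →
                      ∀ {f g} → (∀ i → lookup g i ≡ lookup f (σ ⟨$⟩ʳ i)) → IsGeneric 𝔭 f → IsGeneric 𝔮 g
  IsGeneric-permute {𝔭 = 𝔭} {𝔮} σ iso@(p⊆q , q⊆p) {f} {g} g≡ (x , (x∈ , x≤) , only) =
    x ∘ (σ ⟨$⟩ʳ_) ,
    (p⊆q x∈ , λ y y∈ → ≤-resp (linear-permute f g σ g≡ x) (sym (linear-back y)) (x≤ _ (back y∈))) ,
    λ y (y∈ , y≤) i → trans (reflexive (≡.cong y (≡.sym (Perm.inverseˡ σ))))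
      (only (y ∘ (σ ⟨$⟩ˡ_))
        (back y∈ , λ z z∈ → ≤-resp (linear-back y) (sym (linear-permute f g σ g≡ z)) (y≤ _ (p⊆q z∈)))
        (σ ⟨$⟩ʳ i))
    where
    back : ∀ {y} → ⟦ 𝔮 ⟧ y → ⟦ 𝔭 ⟧ (y ∘ (σ ⟨$⟩ˡ_))
    back = proj₁ (⟦⟧-permute-flip {𝔭 = 𝔭} {𝔮} σ iso)
    linear-back : ∀ y → linearFunctional g y ≈ linearFunctional f (y ∘ (σ ⟨$⟩ˡ_))
    linear-back = linear-permute g f (Perm.flip σ) λ i →
      ≡.trans (≡.cong (lookup f) (≡.sym (Perm.inverseʳ σ))) (≡.sym (g≡ (σ ⟨$⟩ˡ i)))

  -- Coefficients and families of sums

  private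
    _∈?_ : ∀ {n} (J : Subset n) 𝒜 → Dec (J ∈ 𝒜)
    _∈?_ = DecMembership._∈?_ (Vec.≡-dec Bool._≟_)

  coefficient-∈ : ∀ {n} (𝒜 : List (Subset n)) {J} → J ∈ 𝒜 → coefficient (𝓕⁻¹ 𝒜) J ≈ 1#
  coefficient-∈ 𝒜 {J} J∈ = reflexive (≡.cong (if_then 1# else 0#) (dec-true (J ∈? 𝒜) J∈))

  coefficient-∉ : ∀ {n} (𝒜 : List (Subset n)) {J} → ¬ J ∈ 𝒜 → coefficient (𝓕⁻¹ 𝒜) J ≈ 0#
  coefficient-∉ 𝒜 {J} J∉ = reflexive (≡.cong (if_then 1# else 0#) (dec-false (J ∈? 𝒜) J∉))

  coefficient-pos⁻ : ∀ {n} (𝒜 : List (Subset n)) {J} → 0# < coefficient (𝓕⁻¹ 𝒜) J → J ∈ 𝒜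
  coefficient-pos⁻ 𝒜 {J} (_ , 0≉) with em {P = J ∈ 𝒜}
  ... | yes J∈ = J∈
  ... | no J∉  = contradiction (sym (coefficient-∉ 𝒜 J∉)) 0≉

  coefficient-pos⁺ : ∀ {n} (𝒜 : List (Subset n)) {J} → J ∈ 𝒜 → 0# < coefficient (𝓕⁻¹ 𝒜) J
  coefficient-pos⁺ 𝒜 J∈ = ≤-respʳ-≈ (sym (coefficient-∈ 𝒜 J∈)) 0≤1 ,
    λ 0≈ → 0≉1 (trans 0≈ (coefficient-∈ 𝒜 J∈))

  -- Non-negative coefficients cannot cancel. With the two lemmas that follow, the family of a
  -- Minkowski sum is the union of the families.
  ⊕-pos⁻ : ∀ {n} (𝔭 𝔮 : HypergraphicPolytope n) {J} → 0# < coefficient (𝔭 ⊕ 𝔮) J →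
           0# < coefficient 𝔭 J ⊎ 0# < coefficient 𝔮 J
  ⊕-pos⁻ 𝔭 𝔮 {J} (_ , 0≉) with em {P = coefficient 𝔭 J ≈ 0#}
  ... | no  p≉0 = inj₁ (nonneg 𝔭 J , p≉0 ∘ sym)
  ... | yes p≈0 = inj₂ (nonneg 𝔮 J , λ 0≈q → 0≉ (sym (trans (+-cong p≈0 (sym 0≈q)) (+-identityˡ 0#))))

  ⊕-pos⁺ˡ : ∀ {n} (𝔭 𝔮 : HypergraphicPolytope n) {J} → 0# < coefficient 𝔭 J → 0# < coefficient (𝔭 ⊕ 𝔮) J
  ⊕-pos⁺ˡ 𝔭 𝔮 {J} (0≤p , 0≉p) = +-nonneg 0≤p (nonneg 𝔮 J) , λ 0≈ →
    0≉p (proj₁ (+-squeeze 0≤p (nonneg 𝔮 J) (≤-reflexive (trans (sym 0≈) (sym (+-identityˡ 0#))))))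

  ⊕-pos⁺ʳ : ∀ {n} (𝔭 𝔮 : HypergraphicPolytope n) {J} → 0# < coefficient 𝔮 J → 0# < coefficient (𝔭 ⊕ 𝔮) J
  ⊕-pos⁺ʳ 𝔭 𝔮 {J} (0≤q , 0≉q) = +-nonneg (nonneg 𝔭 J) 0≤q , λ 0≈ →
    0≉q (proj₂ (+-squeeze (nonneg 𝔭 J) 0≤q (≤-reflexive (trans (sym 0≈) (sym (+-identityˡ 0#))))))

-- Power series and quasisymmetry

StrictlyMonotoneOn : List ℕ → (ℕ → ℕ) → Set
StrictlyMonotoneOn m g = ∀ {x y} → x ∈ m → y ∈ m → x ℕ.< y → g x ℕ.< g y

strictlyMonotoneOn-injective : ∀ {m g} → StrictlyMonotoneOn m g →
                               ∀ {x y} → x ∈ m → y ∈ m → g x ≡ g y → x ≡ y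
strictlyMonotoneOn-injective mono {x} {y} x∈ y∈ gx≡gy with ℕ.<-cmp x y
... | tri< p _ _ = contradiction gx≡gy (ℕ.<⇒≢ (mono x∈ y∈ p))
... | tri≈ _ p _ = p
... | tri> _ _ p = contradiction (≡.sym gx≡gy) (ℕ.<⇒≢ (mono y∈ x∈ p))

filter-split : ∀ {a p} {A : Set a} {P : Pred A p} (P? : Decidable P) xs →
               xs ↭ filter P? xs ++ filter (¬? ∘ P?) xs
filter-split P? []       = ↭-refl
filter-split P? (x ∷ xs) with P? x
... | yes _ = ↭.prep x (filter-split P? xs)
... | no  _ = ↭-trans (↭.prep x (filter-split P? xs)) (↭-sym (↭.shift x (filter P? xs) _))

all-≡⇒replicate : ∀ {a} {A : Set a} {v : A} {xs} → All (_≡ v) xs → xs ≡ replicate (length xs) v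
all-≡⇒replicate []            = ≡.refl
all-≡⇒replicate (≡.refl ∷ eqs) = ≡.cong (_ ∷_) (all-≡⇒replicate eqs)

module Monomials {c ℓ} (K : CommutativeRing c ℓ) where
  open Series K
  private module K = CommutativeRing K

  map-powerProduct : ∀ g {k} (i α : Vector ℕ k) → map g (powerProduct i α) ≡ powerProduct (g ∘ i) α
  map-powerProduct g {zero}  i α = ≡.refl
  map-powerProduct g {suc k} i α = ≡.trans
    (List.map-++ g (replicate (α zero) (i zero)) (powerProduct (i ∘ suc) (α ∘ suc)))
    (≡.cong₂ _++_ (List.map-replicate g (α zero) (i zero)) (map-powerProduct g (i ∘ suc) (α ∘ suc)))

  powerProduct-cong : ∀ {k} {i j : Vector ℕ k} α → (∀ t → i t ≡ j t) → powerProduct i α ≡ powerProduct j α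
  powerProduct-cong α i≡j = ≡.cong List.concat
    (List.tabulate-cong λ t → ≡.cong (replicate (α t)) (i≡j t))

  ∈-powerProduct⁻ : ∀ {k} (i α : Vector ℕ k) {x} → x ∈ powerProduct i α → ∃[ t ] i t ≡ x
  ∈-powerProduct⁻ {suc k} i α x∈ with ∈-++⁻ (replicate (α zero) (i zero)) x∈
  ... | inj₁ x∈₁ = zero , ≡.sym (All.lookup (replicate-≡ (α zero)) x∈₁)
    where
    replicate-≡ : ∀ a → All (_≡ i zero) (replicate a (i zero))
    replicate-≡ zero    = []
    replicate-≡ (suc a) = ≡.refl ∷ replicate-≡ a
  ... | inj₂ x∈₂ = let t , eq = ∈-powerProduct⁻ (i ∘ suc) (α ∘ suc) x∈₂ in suc t , eq

  -- The lower bound `v` lets a smaller index be put in front; `occurs` lets a relabelling that is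
  -- monotone only on the letters of `m` be applied to the indices.
  record Factorisation (m : Monomial) (v : ℕ) : Set where
    field
      {k}        : ℕ
      indices    : Vector ℕ k
      exponents  : Vector ℕ k
      positive   : ∀ t → 0 ℕ.< exponents t
      increasing : StrictlyIncreasing indices
      bounded    : ∀ t → v ℕ.≤ indices t
      occurs     : ∀ t → indices t ∈ m
      factored   : m ↭ powerProduct indices exponents

  -- The values from `v` on are tried in turn and all copies of each are split off. A value that
  -- does not occur is skipped, because exponents have to be positive.
  factorise-from : ∀ N v m → (∀ {x} → x ∈ m → v ℕ.≤ x × x ℕ.< v ℕ.+ N) → Factorisation m v
  factorise-from zero v [] _ = record
    { k = 0 ; indices = λ () ; exponents = λ () ; positive = λ () ; increasing = λ { {()} }
    ; bounded = λ () ; occurs = λ () ; factored = ↭-refl }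
  factorise-from zero v (x ∷ m) range =
    let v≤x , x<v = range (here ≡.refl) in
    contradiction (≡.subst (x ℕ.<_) (ℕ.+-identityʳ v) x<v) (ℕ.≤⇒≯ v≤x)
  factorise-from (suc N) v m range
    with length (filter (ℕ._≟ v) m) | all-≡⇒replicate (All.all-filter (ℕ._≟ v) m) | factorise-from N (suc v) (filter (¬? ∘ (ℕ._≟ v)) m) range′
    where
    range′ : ∀ {x} → x ∈ filter (¬? ∘ (ℕ._≟ v)) m → suc v ℕ.≤ x × x ℕ.< suc v ℕ.+ N
    range′ {x} x∈ with ∈-filter⁻ (¬? ∘ (ℕ._≟ v)) {xs = m} x∈
    ... | x∈m , x≢v = let v≤x , x< = range x∈m in
      ℕ.≤∧≢⇒< v≤x (x≢v ∘ ≡.sym) , ≡.subst (x ℕ.<_) (ℕ.+-suc v N) x<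
  ... | zero | eq | rest = record
    { Factorisation rest
    ; bounded  = λ t → ℕ.<⇒≤ (Factorisation.bounded rest t)
    ; occurs   = λ t → proj₁ (∈-filter⁻ (¬? ∘ (ℕ._≟ v)) {xs = m} (Factorisation.occurs rest t))
    ; factored = ↭-trans (≡.subst (λ l → m ↭ l ++ filter (¬? ∘ (ℕ._≟ v)) m) eq (filter-split (ℕ._≟ v) m))
                   (Factorisation.factored rest)
    }
  ... | suc a | eq | rest = record
    { indices    = v Vector.∷ indices
    ; exponents  = suc a Vector.∷ exponents
    ; positive   = λ { zero → s≤s z≤n ; (suc t) → positive t }
    ; increasing = λ { {zero} {suc t} _ → bounded t ; {suc s} {suc t} (s≤s s<t) → increasing s<t }
    ; bounded    = λ { zero → ℕ.≤-refl ; (suc t) → ℕ.<⇒≤ (bounded t) }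
    ; occurs     = λ
      { zero    → proj₁ (∈-filter⁻ (ℕ._≟ v) {xs = m} (≡.subst (v ∈_) (≡.sym eq) (here ≡.refl)))
      ; (suc t) → proj₁ (∈-filter⁻ (¬? ∘ (ℕ._≟ v)) {xs = m} (occurs t)) }
    ; factored   = ↭-trans (≡.subst (λ l → m ↭ l ++ filter (¬? ∘ (ℕ._≟ v)) m) eq (filter-split (ℕ._≟ v) m))
                     (↭.++⁺ˡ (replicate (suc a) v) factored)
    }
    where open Factorisation rest

  factorise : ∀ m → Factorisation m 0
  factorise m = factorise-from (variableBound m) 0 m λ x∈ → z≤n , variableBound-< m x∈

  Quasisymmetric : PowerSeries → Set ℓ
  Quasisymmetric F = ∀ {k} (α i j : Vector ℕ k) → (∀ t → 0 ℕ.< α t) →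
    StrictlyIncreasing i → StrictlyIncreasing j → (F ⟨$⟩ powerProduct i α) K.≈ (F ⟨$⟩ powerProduct j α)

  -- Factorising `m` turns the relabelling into a change of indices with the same exponents, which
  -- is the situation of the definition.
  quasisymmetric-relabel : ∀ {F} → Quasisymmetric F → ∀ {m g} → StrictlyMonotoneOn m g →
                           (F ⟨$⟩ m) K.≈ (F ⟨$⟩ map g m)
  quasisymmetric-relabel {F} quasi {m} {g} mono = begin
    F ⟨$⟩ m                                          ≈⟨ Func.cong F factored ⟩
    F ⟨$⟩ powerProduct indices exponents             ≈⟨ quasi exponents indices (g ∘ indices) positive increasing
                                                          (λ s<t → mono (occurs _) (occurs _) (increasing s<t)) ⟩
    F ⟨$⟩ powerProduct (g ∘ indices) exponents       ≡⟨ ≡.cong (F ⟨$⟩_) (map-powerProduct g indices exponents) ⟨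
    F ⟨$⟩ map g (powerProduct indices exponents)     ≈⟨ Func.cong F (↭.map⁺ g factored) ⟨
    F ⟨$⟩ map g m                                    ∎
    where
    open Factorisation (factorise m)
    open SetoidReasoning K.setoid

  -- Values other than the i t are sent to the junk value 0.
  transfer : ∀ {k} → Vector ℕ k → Vector ℕ k → ℕ → ℕ
  transfer i j v with Fin.any? (λ t → i t ℕ.≟ v)
  ... | yes (t , _) = j t
  ... | no  _       = 0

  strictlyIncreasing-injective : ∀ {k} {i : Vector ℕ k} → StrictlyIncreasing i → ∀ {s t} → i s ≡ i t → s ≡ t
  strictlyIncreasing-injective increasing {s} {t} eq with Fin.<-cmp s t
  ... | tri< p _ _ = contradiction eq (ℕ.<⇒≢ (increasing p))
  ... | tri≈ _ p _ = p
  ... | tri> _ _ p = contradiction (≡.sym eq) (ℕ.<⇒≢ (increasing p))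

  strictlyIncreasing-reflects : ∀ {k} {i : Vector ℕ k} → StrictlyIncreasing i → ∀ {s t} → i s ℕ.< i t → s <ᶠ t
  strictlyIncreasing-reflects increasing {s} {t} is<it with Fin.<-cmp s t
  ... | tri< p _ _      = p
  ... | tri≈ _ ≡.refl _ = contradiction is<it (ℕ.<-irrefl ≡.refl)
  ... | tri> _ _ p      = contradiction is<it (ℕ.<-asym (increasing p))

  module _ {k} {i j : Vector ℕ k} (i↗ : StrictlyIncreasing i) (j↗ : StrictlyIncreasing j) where

    transfer-≡ : ∀ t → transfer i j (i t) ≡ j t
    transfer-≡ t with Fin.any? (λ s → i s ℕ.≟ i t)
    ... | yes (s , is≡it) = ≡.cong j (strictlyIncreasing-injective {i = i} i↗ is≡it)
    ... | no  none        = contradiction (t , ≡.refl) none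

    transfer-mono : ∀ α → StrictlyMonotoneOn (powerProduct i α) (transfer i j)
    transfer-mono α x∈ y∈ x<y with ∈-powerProduct⁻ i α x∈ | ∈-powerProduct⁻ i α y∈
    ... | s , ≡.refl | t , ≡.refl = ≡.subst (λ (a , b) → a ℕ.< b)
      (≡.cong₂ _,_ (≡.sym (transfer-≡ s)) (≡.sym (transfer-≡ t)))
      (j↗ (strictlyIncreasing-reflects {i = i} i↗ x<y))

    map-transfer : ∀ α → map (transfer i j) (powerProduct i α) ≡ powerProduct j α
    map-transfer α = ≡.trans (map-powerProduct (transfer i j) i α) (powerProduct-cong α transfer-≡)

-- Counting generic words, and quasisymmetry of the image

module Symmetrisation (em : ∀ {a} → ExcludedMiddle a) {c ℓ} (K : CommutativeRing c ℓ) (ℝ : RealNumbers) where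
  open HGPSpace em K ℝ
  open Polytopes ℝ
  open Geometry em ℝ
  open Monomials K
  private
    module K = CommutativeRing K
    module ℝ = RealNumbers ℝ
  open import Algebra.Definitions.RawMonoid K.+-rawMonoid using () renaming (_×_ to _×ℕ_)
  open Exponentiation K.semiring using (_^_)
  open RingProperties K.ring using (-1*x≈-x)
  open Mult K.+-monoid using (×-homo-+; ×-congˡ)
  private module K-Reasoning = SetoidReasoning K.setoid

  count : ∀ {n} → HypergraphicPolytope n → Monomial → ℕ
  count 𝔮 m = length (genericFunctions 𝔮 m)

  ∈-bounded : ∀ {n} (f : Vec ℕ n) {m} → toList f ↭ m → f ∈ boundedFunctions n (variableBound m)
  ∈-bounded f {m} f↭m = ∈-boundedFunctions⁺ f λ i → variableBound-< m (↭.∈-resp-↭ f↭m (∈-toList⁺ f i))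

  count-≤ : ∀ {n} {𝔭 𝔮 : HypergraphicPolytope n} {m m′} (φ : Vec ℕ n → Vec ℕ n) →
            (∀ f → IsGeneric 𝔭 f → toList f ↭ m → IsGeneric 𝔮 (φ f) × toList (φ f) ↭ m′) →
            (∀ {f g} → toList f ↭ m → toList g ↭ m → φ f ≡ φ g → f ≡ g) →
            count 𝔭 m ℕ.≤ count 𝔮 m′
  count-≤ {n} {m = m} φ into inj = count-injection (λ _ → em) (λ _ → em) φ
    (boundedFunctions-unique n (variableBound m))
    (λ {f} _ (gen , f↭m) → let gen′ , φf↭ = into f gen f↭m in ∈-bounded (φ f) φf↭ , gen′ , φf↭)
    (λ (_ , f↭m) (_ , g↭m) → inj f↭m g↭m)

  count-cong : ∀ {n} {𝔭 𝔮 : HypergraphicPolytope n} →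
               (∀ f → IsGeneric 𝔭 f → IsGeneric 𝔮 f) → (∀ f → IsGeneric 𝔮 f → IsGeneric 𝔭 f) →
               ∀ m → count 𝔭 m ≡ count 𝔮 m
  count-cong {𝔭 = 𝔭} {𝔮} p⇒q q⇒p m = ℕ.≤-antisym
    (count-≤ {𝔭 = 𝔭} {𝔮} (λ f → f) (λ f gen f↭m → p⇒q f gen , f↭m) (λ _ _ eq → eq))
    (count-≤ {𝔭 = 𝔮} {𝔭} (λ f → f) (λ f gen f↭m → q⇒p f gen , f↭m) (λ _ _ eq → eq))

  count-zero? : ∀ {n} (𝔮 : HypergraphicPolytope n) m →
                count 𝔮 m ≡ 0 ⊎ (∃[ f ] IsGeneric 𝔮 f × toList f ↭ m)
  count-zero? {n} 𝔮 m = search (genericFunctions 𝔮 m) (λ f∈ →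
    proj₂ (∈-filter⁻ (λ f → em {P = IsGeneric 𝔮 f × toList f ↭ m}) {xs = boundedFunctions n (variableBound m)} f∈))
    where
    search : ∀ {p} {P : Pred (Vec ℕ n) p} fs → (∀ {f} → f ∈ fs → P f) → length fs ≡ 0 ⊎ ∃ P
    search []       _   = inj₁ ≡.refl
    search (f ∷ fs) all = inj₂ (f , all (here ≡.refl))

  count-positive : ∀ {n} (𝔮 : HypergraphicPolytope n) f → IsGeneric 𝔮 f →
                   ∃[ k ] count 𝔮 (toList f) ≡ suc k
  count-positive 𝔮 f gen = positive
    (∈-filter⁺ (λ g → em {P = IsGeneric 𝔮 g × toList g ↭ toList f}) (∈-bounded f ↭-refl) (gen , ↭-refl))
    where
    positive : ∀ {fs : List (Vec ℕ _)} → f ∈ fs → ∃[ k ] length fs ≡ suc k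
    positive {_ ∷ fs} _ = length fs , ≡.refl

  -- Genericity is a statement about unique minimisers, so it depends only on the order of the
  -- letters.
  generic-relabel : ∀ {n} {𝔮 : HypergraphicPolytope n} {f g} → StrictlyMonotoneOn (toList f) g →
                    IsGeneric 𝔮 f → IsGeneric 𝔮 (Vec.map g f)
  generic-relabel {𝔮 = 𝔮} {f} {g} mono gen = uniqueMin⇒generic 𝔮 (Vec.map g f) λ {J} J∈ →
    UniqueMin-mono {f = lookup f} (λ {a} {b} _ _ fa<fb → ≡.subst (λ (x , y) → x ℕ.< y)
        (≡.cong₂ _,_ (≡.sym (Vec.lookup-map a g f)) (≡.sym (Vec.lookup-map b g f)))
        (mono (∈-toList⁺ f a) (∈-toList⁺ f b) fa<fb))
      (generic⇒uniqueMin 𝔮 f gen J∈)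

  map-injective : ∀ {g : ℕ → ℕ} {n} (f f′ : Vec ℕ n) → (∀ a → g (lookup f a) ≡ g (lookup f′ a) → lookup f a ≡ lookup f′ a) →
                  Vec.map g f ≡ Vec.map g f′ → f ≡ f′
  map-injective []      []        _   _  = ≡.refl
  map-injective (x ∷ f) (x′ ∷ f′) inj eq = ≡.cong₂ _∷_
    (inj zero (Vec.∷-injectiveˡ eq)) (map-injective f f′ (inj ∘ suc) (Vec.∷-injectiveʳ eq))

  count-relabel-≤ : ∀ {n} (𝔮 : HypergraphicPolytope n) {m g} → StrictlyMonotoneOn m g →
                    count 𝔮 m ℕ.≤ count 𝔮 (map g m)
  count-relabel-≤ 𝔮 {m} {g} mono = count-≤ {𝔭 = 𝔮} {𝔮} (Vec.map g)
    (λ f gen f↭m →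
      generic-relabel {𝔮 = 𝔮} {f} (λ x∈ y∈ → mono (↭.∈-resp-↭ f↭m x∈) (↭.∈-resp-↭ f↭m y∈)) gen ,
      ↭-trans (↭-reflexive (Vec.toList-map g f)) (↭.map⁺ g f↭m))
    (λ {f} {f′} f↭m f′↭m → map-injective f f′ λ a →
      strictlyMonotoneOn-injective mono (↭.∈-resp-↭ f↭m (∈-toList⁺ f a)) (↭.∈-resp-↭ f′↭m (∈-toList⁺ f′ a)))

  count-quasisymmetric : ∀ {n} (𝔮 : HypergraphicPolytope n) {k} (α i j : Vector ℕ k) →
    StrictlyIncreasing i → StrictlyIncreasing j → count 𝔮 (powerProduct i α) ℕ.≤ count 𝔮 (powerProduct j α)
  count-quasisymmetric 𝔮 α i j i↗ j↗ = ≡.subst (λ m → count 𝔮 (powerProduct i α) ℕ.≤ count 𝔮 m)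
    (map-transfer {i = i} {j} i↗ j↗ α) (count-relabel-≤ 𝔮 (transfer-mono {i = i} {j} i↗ j↗ α))

  Ψ-quasisymmetric : ∀ x → Quasisymmetric (Ψ x)
  Ψ-quasisymmetric [ 𝔮 ]    α i j pos i↗ j↗ = ×-congˡ (ℕ.≤-antisym
    (count-quasisymmetric 𝔮 α i j i↗ j↗) (count-quasisymmetric 𝔮 α j i j↗ i↗))
  Ψ-quasisymmetric 0ᴴ       α i j pos i↗ j↗ = K.refl
  Ψ-quasisymmetric (x +ᴴ y) α i j pos i↗ j↗ =
    K.+-cong (Ψ-quasisymmetric x α i j pos i↗ j↗) (Ψ-quasisymmetric y α i j pos i↗ j↗)
  Ψ-quasisymmetric (a · x)  α i j pos i↗ j↗ = K.*-congˡ (Ψ-quasisymmetric x α i j pos i↗ j↗)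

  count-degree : ∀ {n} (𝔮 : HypergraphicPolytope n) m → n ≢ length m → count 𝔮 m ≡ 0
  count-degree 𝔮 m n≢ with count-zero? 𝔮 m
  ... | inj₁ eq = eq
  ... | inj₂ (f , _ , f↭m) = contradiction (≡.trans (≡.sym (Vec.length-toList f)) (↭.↭-length f↭m)) n≢

  Ψ-boundedDegree : ∀ x → ∃[ d ] (∀ m → d ℕ.< length m → (Ψ x ⟨$⟩ m) K.≈ K.0#)
  Ψ-boundedDegree ([_] {n} 𝔮) = n , λ m n<m → ×-congˡ (count-degree 𝔮 m (ℕ.<⇒≢ n<m))
  Ψ-boundedDegree 0ᴴ          = 0 , λ m _ → K.refl
  Ψ-boundedDegree (x +ᴴ y)    = let d , x≈0 = Ψ-boundedDegree x ; e , y≈0 = Ψ-boundedDegree y in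
    d ℕ.⊔ e , λ m d⊔e<m → K.trans
      (K.+-cong (x≈0 m (ℕ.≤-<-trans (ℕ.m≤m⊔n d e) d⊔e<m)) (y≈0 m (ℕ.≤-<-trans (ℕ.m≤n⊔m d e) d⊔e<m)))
      (K.+-identityˡ K.0#)
  Ψ-boundedDegree (a · x)     = let d , x≈0 = Ψ-boundedDegree x in
    d , λ m d<m → K.trans (K.*-congˡ (x≈0 m d<m)) (K.zeroʳ a)

  Ψ-cong : ∀ {x y} → x ≈ᴴ y → Ψ x ≈ˢ Ψ y
  Ψ-cong ≈-refl m = K.refl
  Ψ-cong (≈-sym p) m = K.sym (Ψ-cong p m)
  Ψ-cong (≈-trans p q) m = K.trans (Ψ-cong p m) (Ψ-cong q m)
  Ψ-cong ([]-cong {𝔭 = 𝔭} {𝔮} p≐q@(p⊆q , q⊆p)) m = ×-congˡ (count-cong {𝔭 = 𝔭} {𝔮}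
    (λ f → IsGeneric-≐ {𝔭 = 𝔭} {𝔮} {f} p≐q) (λ f → IsGeneric-≐ {𝔭 = 𝔮} {𝔭} {f} (q⊆p , p⊆q)) m)
  Ψ-cong (+-cong p q) m = K.+-cong (Ψ-cong p m) (Ψ-cong q m)
  Ψ-cong (·-cong a≈ p) m = K.*-cong a≈ (Ψ-cong p m)
  Ψ-cong (+-assoc x y z) m = K.+-assoc _ _ _
  Ψ-cong (+-comm x y) m = K.+-comm _ _
  Ψ-cong (+-identityˡ x) m = K.+-identityˡ _
  Ψ-cong (·-zeroˡ x) m = K.zeroˡ _
  Ψ-cong (·-identityˡ x) m = K.*-identityˡ _
  Ψ-cong (·-assoc a b x) m = K.*-assoc _ _ _
  Ψ-cong (·-distribˡ a x y) m = K.distribˡ _ _ _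
  Ψ-cong (·-distribʳ a b x) m = K.distribʳ _ _ _

  𝓕-generic : ∀ {n} {𝔭 𝔮 : HypergraphicPolytope n} → (∀ {J} → 𝓕 𝔮 J → 𝓕 𝔭 J) →
              ∀ f → IsGeneric 𝔭 f → IsGeneric 𝔮 f
  𝓕-generic {𝔭 = 𝔭} {𝔮} 𝓕⊆ f gen = uniqueMin⇒generic 𝔮 f λ J∈ → generic⇒uniqueMin 𝔭 f gen (𝓕⊆ J∈)

  permute-count-≤ : ∀ {n} {𝔭 𝔮 : HypergraphicPolytope n} σ → ⟦ 𝔭 ⟧ ≐ (λ x → ⟦ 𝔮 ⟧ (x ∘ (σ ⟨$⟩ʳ_))) →
                    ∀ m → count 𝔭 m ℕ.≤ count 𝔮 m
  permute-count-≤ {𝔭 = 𝔭} {𝔮} σ iso m = count-≤ {𝔭 = 𝔭} {𝔮} (λ f → tabulate (lookup f ∘ (σ ⟨$⟩ʳ_)))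
    (λ f gen f↭m → IsGeneric-permute {𝔭 = 𝔭} {𝔮} σ iso {f} {tabulate (lookup f ∘ (σ ⟨$⟩ʳ_))} (λ i → Vec.lookup∘tabulate _ i) gen ,
      ↭-trans (toList-permute f (σ ⟨$⟩ʳ_) (Fin-injective σ)) f↭m)
    (λ {f} {g} _ _ eq → Vec-ext f g λ i → begin
      lookup f i                                     ≡⟨ ≡.cong (lookup f) (Perm.inverseʳ σ) ⟨
      lookup f (σ ⟨$⟩ʳ (σ ⟨$⟩ˡ i))                    ≡⟨ Vec.lookup∘tabulate _ (σ ⟨$⟩ˡ i) ⟨
      lookup (tabulate (lookup f ∘ (σ ⟨$⟩ʳ_))) _      ≡⟨ ≡.cong (λ v → lookup v (σ ⟨$⟩ˡ i)) eq ⟩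
      lookup (tabulate (lookup g ∘ (σ ⟨$⟩ʳ_))) _      ≡⟨ Vec.lookup∘tabulate _ (σ ⟨$⟩ˡ i) ⟩
      lookup g (σ ⟨$⟩ʳ (σ ⟨$⟩ˡ i))                    ≡⟨ ≡.cong (lookup g) (Perm.inverseʳ σ) ⟩
      lookup g i                                     ∎)
    where
    open ≡.≡-Reasoning
    Fin-injective : ∀ {n} (σ : Permutation′ n) {i j} → σ ⟨$⟩ʳ i ≡ σ ⟨$⟩ʳ j → i ≡ j
    Fin-injective σ eq = ≡.trans (≡.sym (Perm.inverseˡ σ)) (≡.trans (≡.cong (σ ⟨$⟩ˡ_) eq) (Perm.inverseˡ σ))
    Vec-ext : ∀ {n} (f g : Vec ℕ n) → (∀ i → lookup f i ≡ lookup g i) → f ≡ g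
    Vec-ext f g eq = ≡.trans (≡.sym (Vec.tabulate∘lookup f))
      (≡.trans (Vec.tabulate-cong eq) (Vec.tabulate∘lookup g))

  generic-⊕⁻ : ∀ {n} (𝒜 𝒯 : List (Subset n)) f → IsGeneric (𝓕⁻¹ 𝒜 ⊕ 𝓕⁻¹ 𝒯) f →
               ∀ {J} → Nonempty J → J ∈ 𝒜 ⊎ J ∈ 𝒯 → UniqueMin (lookup f) J
  generic-⊕⁻ 𝒜 𝒯 f gen ne (inj₁ J∈) = generic⇒uniqueMin (𝓕⁻¹ 𝒜 ⊕ 𝓕⁻¹ 𝒯) f gen
    (ne , ⊕-pos⁺ˡ (𝓕⁻¹ 𝒜) (𝓕⁻¹ 𝒯) (coefficient-pos⁺ 𝒜 J∈))
  generic-⊕⁻ 𝒜 𝒯 f gen ne (inj₂ J∈) = generic⇒uniqueMin (𝓕⁻¹ 𝒜 ⊕ 𝓕⁻¹ 𝒯) f gen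
    (ne , ⊕-pos⁺ʳ (𝓕⁻¹ 𝒜) (𝓕⁻¹ 𝒯) (coefficient-pos⁺ 𝒯 J∈))

  generic-⊕⁺ : ∀ {n} (𝒜 𝒯 : List (Subset n)) f →
               (∀ {J} → Nonempty J → J ∈ 𝒜 ⊎ J ∈ 𝒯 → UniqueMin (lookup f) J) →
               IsGeneric (𝓕⁻¹ 𝒜 ⊕ 𝓕⁻¹ 𝒯) f
  generic-⊕⁺ 𝒜 𝒯 f uniq = uniqueMin⇒generic (𝓕⁻¹ 𝒜 ⊕ 𝓕⁻¹ 𝒯) f λ (ne , 0<) →
    uniq ne ([ inj₁ ∘ coefficient-pos⁻ 𝒜 , inj₂ ∘ coefficient-pos⁻ 𝒯 ]′ (⊕-pos⁻ (𝓕⁻¹ 𝒜) (𝓕⁻¹ 𝒯) 0<))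

  -- Alternating sums over sublists

  private
    indicator : ∀ {p} {P : Set p} → Dec P → ℕ
    indicator d = if does d then 1 else 0

    indicator-cong : ∀ {p q} {P : Set p} {Q : Set q} (P? : Dec P) (Q? : Dec Q) →
                     (P → Q) → (Q → P) → indicator P? ≡ indicator Q?
    indicator-cong (yes _) (yes _) _   _   = ≡.refl
    indicator-cong (yes p) (no ¬q) P⇒Q _   = contradiction (P⇒Q p) ¬q
    indicator-cong (no ¬p) (yes q) _   Q⇒P = contradiction (Q⇒P q) ¬p
    indicator-cong (no _)  (no _)  _   _   = ≡.refl

    indicator-no : ∀ {p} {P : Set p} (P? : Dec P) → ¬ P → indicator P? ≡ 0
    indicator-no (yes p) ¬p = contradiction p ¬p
    indicator-no (no _)  _  = ≡.refl

    length-filter-∷ : ∀ {a p} {A : Set a} {P : Pred A p} (P? : Decidable P) x xs →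
                      length (filter P? (x ∷ xs)) ≡ indicator (P? x) ℕ.+ length (filter P? xs)
    length-filter-∷ P? x xs with P? x
    ... | yes _ = ≡.refl
    ... | no  _ = ≡.refl

    module _ {n : ℕ} where

      -- The coefficient of a monomial in a modular sum, once `φ 𝒯` is the number of its words that
      -- are generic for the term of `𝒯`.
      alternating : (List (Subset n) → ℕ) → List (List (Subset n)) → K.Carrier
      alternating φ = foldr (λ 𝒯 s → ((K.- K.1#) ^ length 𝒯) K.* (φ 𝒯 ×ℕ K.1#) K.+ s) K.0#

      alternating-cong : ∀ {φ ψ} 𝒯s → (∀ {𝒯} → 𝒯 ∈ 𝒯s → φ 𝒯 ≡ ψ 𝒯) → alternating φ 𝒯s K.≈ alternating ψ 𝒯s
      alternating-cong []       _  = K.refl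
      alternating-cong (𝒯 ∷ 𝒯s) φ≡ψ =
        K.+-cong (K.*-congˡ (×-congˡ (φ≡ψ (here ≡.refl)))) (alternating-cong 𝒯s (φ≡ψ ∘ there))

      alternating-zero : ∀ 𝒯s → alternating (λ _ → 0) 𝒯s K.≈ K.0#
      alternating-zero []       = K.refl
      alternating-zero (𝒯 ∷ 𝒯s) = K.trans (K.+-cong (K.zeroʳ _) (alternating-zero 𝒯s)) (K.+-identityˡ _)

      alternating-+ : ∀ φ ψ 𝒯s →
        alternating (λ 𝒯 → φ 𝒯 ℕ.+ ψ 𝒯) 𝒯s K.≈ alternating φ 𝒯s K.+ alternating ψ 𝒯s
      alternating-+ φ ψ []       = K.sym (K.+-identityˡ _)
      alternating-+ φ ψ (𝒯 ∷ 𝒯s) = K.trans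
        (K.+-cong (K.trans (K.*-congˡ (×-homo-+ K.1# (φ 𝒯) (ψ 𝒯))) (K.distribˡ _ _ _)) (alternating-+ φ ψ 𝒯s))
        (interchange _ _ _ _)
        where open import Algebra.Properties.CommutativeSemigroup K.+-commutativeSemigroup using (interchange)

      alternating-++ : ∀ φ 𝒯s 𝒰s → alternating φ (𝒯s ++ 𝒰s) K.≈ alternating φ 𝒯s K.+ alternating φ 𝒰s
      alternating-++ φ []       𝒰s = K.sym (K.+-identityˡ _)
      alternating-++ φ (𝒯 ∷ 𝒯s) 𝒰s = K.trans (K.+-congˡ (alternating-++ φ 𝒯s 𝒰s)) (K.sym (K.+-assoc _ _ _))

      alternating-∷ : ∀ φ B 𝒯s →
        alternating φ (map (B ∷_) 𝒯s) K.≈ (K.- K.1#) K.* alternating (φ ∘ (B ∷_)) 𝒯s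
      alternating-∷ φ B []       = K.sym (K.zeroʳ _)
      alternating-∷ φ B (𝒯 ∷ 𝒯s) = K.trans
        (K.+-cong (K.*-assoc _ _ _) (alternating-∷ φ B 𝒯s)) (K.sym (K.distribˡ _ _ _))

      cancelling : ∀ x → (K.- K.1#) K.* x K.+ x K.≈ K.0#
      cancelling x = K.trans (K.+-congʳ (-1*x≈-x x)) (K.-‿inverseˡ x)

      -- Sublists are paired by whether they contain the first member `B`. If `O B` holds, each pair
      -- cancels; otherwise only the sublists without `B` contribute, and the witness lies further
      -- down the list.
      alternating-sublists : ∀ {o} (O : Pred (Subset n) o) φ ℬ → (∀ {B} → B ∈ ℬ → Dec (O B)) →
        (∀ {B 𝒯} → B ∈ ℬ → O B → φ (B ∷ 𝒯) ≡ φ 𝒯) →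
        (∀ {B 𝒯} → B ∈ ℬ → ¬ O B → φ (B ∷ 𝒯) ≡ 0) →
        ∀ {B} → B ∈ ℬ → O B → alternating φ (sublists ℬ) K.≈ K.0#
      alternating-sublists O φ (B ∷ ℬ) O? keep kill {B′} B′∈ OB′ = begin
        alternating φ (map (B ∷_) (sublists ℬ) ++ sublists ℬ)
          ≈⟨ alternating-++ φ (map (B ∷_) (sublists ℬ)) (sublists ℬ) ⟩
        alternating φ (map (B ∷_) (sublists ℬ)) K.+ alternating φ (sublists ℬ)
          ≈⟨ K.+-congʳ (alternating-∷ φ B (sublists ℬ)) ⟩
        (K.- K.1#) K.* alternating (φ ∘ (B ∷_)) (sublists ℬ) K.+ alternating φ (sublists ℬ)
          ≈⟨ cases (O? (here ≡.refl)) ⟩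
        K.0# ∎
        where
        open K-Reasoning
        cases : Dec (O B) →
          (K.- K.1#) K.* alternating (φ ∘ (B ∷_)) (sublists ℬ) K.+ alternating φ (sublists ℬ) K.≈ K.0#
        cases (yes OB) = K.trans
          (K.+-congʳ (K.*-congˡ (alternating-cong (sublists ℬ) λ _ → keep (here ≡.refl) OB))) (cancelling _)
        cases (no ¬OB) = K.trans
          (K.+-cong (K.trans (K.*-congˡ (K.trans (alternating-cong (sublists ℬ) λ _ → kill (here ≡.refl) ¬OB)
                                  (alternating-zero (sublists ℬ)))) (K.zeroʳ _))
            (alternating-sublists O φ ℬ (O? ∘ there) (keep ∘ there) (kill ∘ there) (later B′∈) OB′))
          (K.+-identityˡ _)
          where
          later : B′ ∈ B ∷ ℬ → B′ ∈ ℬ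
          later (here ≡.refl) = contradiction OB′ ¬OB
          later (there B′∈ℬ)  = B′∈ℬ

  -- The relations lie in the kernel

  module _ {n} (𝒜 ℬ : Family n) where

    private
      summand : List (Subset n) → HypergraphicPolytope n
      summand 𝒯 = 𝓕⁻¹ (members 𝒜) ⊕ 𝓕⁻¹ 𝒯

    Ψ-modularSum : ∀ m → (Ψ (modularSum 𝒜 ℬ) ⟨$⟩ m) K.≈ alternating (λ 𝒯 → count (summand 𝒯) m) (sublists (members ℬ))
    Ψ-modularSum m = go (sublists (members ℬ))
      where
      go : ∀ 𝒯s → (Ψ (sumᴴ (map (λ 𝒯 → ((K.- K.1#) ^ length 𝒯) · [ summand 𝒯 ]) 𝒯s)) ⟨$⟩ m) K.≈
                  alternating (λ 𝒯 → count (summand 𝒯) m) 𝒯s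
      go []       = K.refl
      go (𝒯 ∷ 𝒯s) = K.+-congˡ (go 𝒯s)

    -- For a fixed word f the alternating sum is [f ⊥ 𝒜] ∏ (1 - [f ⊥ B]) over B ∈ ℬ.
    modular⇒kernel : (∀ π → (∃[ A ] A ∈ members 𝒜 × ¬ Orth A π) ⊎ (∃[ B ] B ∈ members ℬ × Orth B π)) →
                     Ψ (modularSum 𝒜 ℬ) ≈ˢ 0ˢ
    modular⇒kernel covering m = K.trans (Ψ-modularSum m) (total (boundedFunctions n (variableBound m)))
      where
      open K-Reasoning
      f< : (f : Vec ℕ n) → ∀ i → lookup f i ℕ.< variableBound (toList f)
      f< f i = variableBound-< (toList f) (∈-toList⁺ f i)
      Contributes : List (Subset n) → Vec ℕ n → Set
      Contributes 𝒯 f = IsGeneric (summand 𝒯) f × toList f ↭ m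
      contributes? : ∀ 𝒯 f → Dec (Contributes 𝒯 f)
      contributes? 𝒯 f = em
      single : ∀ f → alternating (λ 𝒯 → indicator (contributes? 𝒯 f)) (sublists (members ℬ)) K.≈ K.0#
      single f with em {P = toList f ↭ m}
      ... | no f↭̸m = K.trans (alternating-cong (sublists (members ℬ)) λ {𝒯} _ →
                       indicator-no (contributes? 𝒯 f) (λ (_ , f↭m) → f↭̸m f↭m))
                     (alternating-zero (sublists (members ℬ)))
      ... | yes f↭m with covering (levelComposition (lookup f) (f< f))
      -- `f` is generic for no term, because the family of every term contains `A`.
      ...   | inj₁ (A , A∈ , ¬orth) =
        K.trans (alternating-cong (sublists (members ℬ)) λ {𝒯} _ →
          indicator-no (contributes? 𝒯 f) λ (gen , _) →
            ¬orth (UniqueMin⇒Orth-level (lookup f) (f< f)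
              (generic-⊕⁻ (members 𝒜) 𝒯 f gen (All.lookup (nonempty 𝒜) A∈) (inj₁ A∈))))
          (alternating-zero (sublists (members ℬ)))
      -- Adding to `𝒯` a set on which `f` has a unique minimiser does not change whether `f` is
      -- generic; adding any other member of `ℬ` destroys genericity.
      ...   | inj₂ (B , B∈ , orth) = alternating-sublists (UniqueMin (lookup f)) _ (members ℬ) (λ _ → em)
        (λ {B} {𝒯} B∈ u → indicator-cong (contributes? (B ∷ 𝒯) f) (contributes? 𝒯 f)
          (λ (gen , _) → generic-⊕⁺ (members 𝒜) 𝒯 f (λ ne → λ
             { (inj₁ J∈) → generic-⊕⁻ (members 𝒜) (B ∷ 𝒯) f gen ne (inj₁ J∈)
             ; (inj₂ J∈) → generic-⊕⁻ (members 𝒜) (B ∷ 𝒯) f gen ne (inj₂ (there J∈)) }) , f↭m)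
          (λ (gen , _) → generic-⊕⁺ (members 𝒜) (B ∷ 𝒯) f (λ ne → λ
             { (inj₁ J∈) → generic-⊕⁻ (members 𝒜) 𝒯 f gen ne (inj₁ J∈)
             ; (inj₂ (here ≡.refl)) → u
             ; (inj₂ (there J∈)) → generic-⊕⁻ (members 𝒜) 𝒯 f gen ne (inj₂ J∈) }) , f↭m))
        (λ {B} {𝒯} B∈ ¬u → indicator-no (contributes? (B ∷ 𝒯) f) λ (gen , _) →
          ¬u (generic-⊕⁻ (members 𝒜) (B ∷ 𝒯) f gen (All.lookup (nonempty ℬ) B∈) (inj₂ (here ≡.refl))))
        B∈ (Orth-level⇒UniqueMin (lookup f) (f< f) orth)
      -- The sum over words and the alternating sum over sublists are exchanged, one word at a time.
      total : ∀ fs → alternating (λ 𝒯 → length (filter (contributes? 𝒯) fs)) (sublists (members ℬ)) K.≈ K.0#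
      total []       = alternating-zero (sublists (members ℬ))
      total (f ∷ fs) = begin
        alternating (λ 𝒯 → length (filter (contributes? 𝒯) (f ∷ fs))) (sublists (members ℬ))
          ≈⟨ alternating-cong (sublists (members ℬ)) (λ {𝒯} _ → length-filter-∷ (contributes? 𝒯) f fs) ⟩
        alternating (λ 𝒯 → indicator (contributes? 𝒯 f) ℕ.+ length (filter (contributes? 𝒯) fs)) (sublists (members ℬ))
          ≈⟨ alternating-+ (λ 𝒯 → indicator (contributes? 𝒯 f)) (λ 𝒯 → length (filter (contributes? 𝒯) fs)) (sublists (members ℬ)) ⟩
        alternating (λ 𝒯 → indicator (contributes? 𝒯 f)) (sublists (members ℬ)) K.+
        alternating (λ 𝒯 → length (filter (contributes? 𝒯) fs)) (sublists (members ℬ))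
          ≈⟨ K.+-cong (single f) (total fs) ⟩
        K.0# K.+ K.0#
          ≈⟨ K.+-identityˡ _ ⟩
        K.0# ∎

  difference⇒kernel : ∀ {n} {𝔭 𝔮 : HypergraphicPolytope n} → (∀ m → count 𝔭 m ≡ count 𝔮 m) →
                      Ψ ([ 𝔭 ] -ᴴ [ 𝔮 ]) ≈ˢ 0ˢ
  difference⇒kernel same m = K.trans (K.+-cong (×-congˡ (same m)) (-1*x≈-x _)) (K.-‿inverseʳ _)

  relation⇒kernel : ∀ {x} → Relation x → Ψ x ≈ˢ 0ˢ
  relation⇒kernel (simple 𝔭 𝔮 (p⊆q , q⊆p)) = difference⇒kernel {𝔭 = 𝔭} {𝔮}
    (count-cong {𝔭 = 𝔭} {𝔮} (𝓕-generic {𝔭 = 𝔭} {𝔮} q⊆p) (𝓕-generic {𝔭 = 𝔮} {𝔭} p⊆q))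
  relation⇒kernel (modular 𝒜 ℬ _ covering) = modular⇒kernel 𝒜 ℬ covering
  relation⇒kernel (isomorphism 𝔭 𝔮 σ iso) = difference⇒kernel {𝔭 = 𝔭} {𝔮} λ m → ℕ.≤-antisym
    (permute-count-≤ {𝔭 = 𝔭} {𝔮} σ iso m)
    (permute-count-≤ {𝔭 = 𝔮} {𝔭} (Perm.flip σ) (⟦⟧-permute-flip {𝔭 = 𝔭} {𝔮} σ iso) m)

  span⇒kernel : ∀ {x} → Span Relation x → Ψ x ≈ˢ 0ˢ
  span⇒kernel (generator r)  m = relation⇒kernel r m
  span⇒kernel zeroᴴ          m = K.refl
  span⇒kernel (add s t)      m = K.trans (K.+-cong (span⇒kernel s m) (span⇒kernel t m)) (K.+-identityˡ _)
  span⇒kernel (scale a s)    m = K.trans (K.*-congˡ (span⇒kernel s m)) (K.zeroʳ a)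
  span⇒kernel (resp x≈y s)   m = K.trans (K.sym (Ψ-cong x≈y m)) (span⇒kernel s m)

-- Both eliminations take out a word of least rank and rely on the rank bound for those left.
extractMin : ∀ {a} {A : Set a} (r : A → ℕ) x xs →
             ∃[ y ] ∃[ ys ] x ∷ xs ↭ y ∷ ys × All (λ z → r y ℕ.≤ r z) ys
extractMin r x []        = x , [] , ↭-refl , []
extractMin r x (x′ ∷ xs) with extractMin r x′ xs
... | y , ys , xs↭ , min with r x ℕ.≤? r y
...   | yes rx≤ry = x , x′ ∷ xs , ↭-refl ,
        ↭.All-resp-↭ (↭-sym xs↭) (rx≤ry ∷ All.map (ℕ.≤-trans rx≤ry) min)
...   | no  rx≰ry = y , x ∷ ys , ↭-trans (↭.prep x xs↭) (↭.swap x y ↭-refl) , ℕ.≰⇒≥ rx≰ry ∷ min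

-- The dimension is part of a word, as a formal combination may mix dimensions.
Word : Set
Word = Σ ℕ (Vec ℕ)

letters : Word → Monomial
letters (_ , f) = toList f

module Kernel (em : ∀ {a} → ExcludedMiddle a) {c ℓ} (K : CommutativeRing c ℓ)
  (isField : IsField K) (char0 : CharacteristicZero K) (ℝ : RealNumbers) where
  open HGPSpace em K ℝ
  open Polytopes ℝ
  open Geometry em ℝ
  open Monomials K
  open Symmetrisation em K ℝ
  open Rank em
  open IsField isField
  private
    module K = CommutativeRing K
    module ℝ = RealNumbers ℝ
  open import Algebra.Definitions.RawMonoid K.+-rawMonoid using () renaming (_×_ to _×ℕ_)
  open Exponentiation K.semiring using (_^_)
  open RingProperties K.ring using (-1*x≈-x; -‿distribˡ-*)
  open Mult K.+-monoid using (×-congˡ)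

  -- Congruence modulo the relations

  +ᴴ-commutativeMonoid : CommutativeMonoid c (c ⊔ ℓ)
  +ᴴ-commutativeMonoid = record
    { Carrier = HGP ; _≈_ = _≈ᴴ_ ; _∙_ = _+ᴴ_ ; ε = 0ᴴ
    ; isCommutativeMonoid = record
      { isMonoid = record
        { isSemigroup = record
          { isMagma = record
            { isEquivalence = record { refl = ≈-refl ; sym = ≈-sym ; trans = ≈-trans }
            ; ∙-cong = +-cong }
          ; assoc = +-assoc }
        ; identity = +-identityˡ , λ x → ≈-trans (+-comm x 0ᴴ) (+-identityˡ x) }
      ; comm = +-comm } }

  private
    module H = CommutativeMonoid +ᴴ-commutativeMonoid
    open CommutativeSemigroupProperties H.commutativeSemigroup using (interchange; x∙yz≈y∙xz)

  ·-zeroʳ : ∀ a → a · 0ᴴ ≈ᴴ 0ᴴ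
  ·-zeroʳ a = ≈-trans (·-cong K.refl (≈-sym (·-zeroˡ 0ᴴ)))
    (≈-trans (≈-sym (·-assoc a K.0# 0ᴴ)) (≈-trans (·-cong (K.zeroʳ a) ≈-refl) (·-zeroˡ 0ᴴ)))

  inverseʳ : ∀ x → x +ᴴ (K.- K.1#) · x ≈ᴴ 0ᴴ
  inverseʳ x = ≈-trans (+-cong (≈-sym (·-identityˡ x)) ≈-refl)
    (≈-trans (≈-sym (·-distribʳ K.1# (K.- K.1#) x))
      (≈-trans (·-cong (K.-‿inverseʳ K.1#) ≈-refl) (·-zeroˡ x)))

  infix 4 _≃_
  -- The difference is kept as a summand and not formed by subtraction, which makes sums and
  -- multiples of congruences immediate.
  _≃_ : HGP → HGP → Set (c ⊔ ℓ)
  x ≃ y = ∃[ r ] Span Relation r × x ≈ᴴ y +ᴴ r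

  ≈⇒≃ : ∀ {x y} → x ≈ᴴ y → x ≃ y
  ≈⇒≃ x≈y = 0ᴴ , zeroᴴ , ≈-trans x≈y (≈-sym (H.identityʳ _))

  ≃-trans : ∀ {x y z} → x ≃ y → y ≃ z → x ≃ z
  ≃-trans (r , r∈ , x≈) (s , s∈ , y≈) =
    s +ᴴ r , add s∈ r∈ , ≈-trans x≈ (≈-trans (+-cong y≈ ≈-refl) (+-assoc _ s r))

  ≃-sym : ∀ {x y} → x ≃ y → y ≃ x
  ≃-sym {x} {y} (r , r∈ , x≈) = (K.- K.1#) · r , scale _ r∈ , ≈-sym
    (≈-trans (+-cong x≈ ≈-refl) (≈-trans (+-assoc y r _)
      (≈-trans (+-cong ≈-refl (inverseʳ r)) (H.identityʳ y))))

  ≃-+ : ∀ {x x′ y y′} → x ≃ x′ → y ≃ y′ → x +ᴴ y ≃ x′ +ᴴ y′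
  ≃-+ (r , r∈ , x≈) (s , s∈ , y≈) = r +ᴴ s , add r∈ s∈ , ≈-trans (+-cong x≈ y≈) (interchange _ _ _ _)

  ≃-· : ∀ a {x x′} → x ≃ x′ → a · x ≃ a · x′
  ≃-· a (r , r∈ , x≈) = a · r , scale a r∈ , ≈-trans (·-cong K.refl x≈) (·-distribˡ a _ r)

  ≃-setoid : Setoid c (c ⊔ ℓ)
  ≃-setoid = record
    { Carrier = HGP ; _≈_ = _≃_
    ; isEquivalence = record { refl = ≈⇒≃ ≈-refl ; sym = ≃-sym ; trans = ≃-trans } }

  private
    module ≃-Reasoning = SetoidReasoning ≃-setoid
    module K-Reasoning = SetoidReasoning K.setoid

  span⇒≃0 : ∀ {x} → Span Relation x → x ≃ 0ᴴ
  span⇒≃0 {x} x∈ = x , x∈ , ≈-sym (+-identityˡ x)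

  ≃0⇒span : ∀ {x} → x ≃ 0ᴴ → Span Relation x
  ≃0⇒span (r , r∈ , x≈) = resp (≈-trans (≈-sym (+-identityˡ r)) (≈-sym x≈)) r∈

  difference⇒≃ : ∀ {x y} → Relation (x -ᴴ y) → x ≃ y
  difference⇒≃ {x} {y} rel = x -ᴴ y , generator rel , ≈-sym
    (≈-trans (x∙yz≈y∙xz y x _) (≈-trans (+-cong ≈-refl (inverseʳ y)) (H.identityʳ x)))

  ≃⇒Ψ≈ : ∀ {x y} → x ≃ y → Ψ x ≈ˢ Ψ y
  ≃⇒Ψ≈ {x} {y} (r , r∈ , x≈) m = K.trans (Ψ-cong x≈ m)
    (K.trans (K.+-congˡ (span⇒kernel r∈ m)) (K.+-identityʳ _))

  simple-≃ : ∀ {n} {𝔭 𝔮 : HypergraphicPolytope n} →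
             (∀ {J} → 𝓕 𝔭 J → 𝓕 𝔮 J) → (∀ {J} → 𝓕 𝔮 J → 𝓕 𝔭 J) → [ 𝔭 ] ≃ [ 𝔮 ]
  simple-≃ {𝔭 = 𝔭} {𝔮} p⊆q q⊆p = difference⇒≃ (simple 𝔭 𝔮 (p⊆q , q⊆p))

  -- Word polytopes and triangularity

  -- These sets form A_f; `rank (lookup f)` is their number and `wordPolytope f` is P_f.
  orthogonal : ∀ {n} → Vec ℕ n → List (Subset n)
  orthogonal {n} f = filter (uniqueMin? (lookup f)) (nonemptySubsets n)

  ∈-orthogonal⁺ : ∀ {n} (f : Vec ℕ n) {J} → UniqueMin (lookup f) J → J ∈ orthogonal f
  ∈-orthogonal⁺ f u = ∈-filter⁺ (uniqueMin? (lookup f)) (∈-nonemptySubsets⁺ (UniqueMin⇒Nonempty {f = lookup f} u)) u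

  ∈-orthogonal⁻ : ∀ {n} (f : Vec ℕ n) {J} → J ∈ orthogonal f → UniqueMin (lookup f) J
  ∈-orthogonal⁻ {n} f J∈ = proj₂ (∈-filter⁻ (uniqueMin? (lookup f)) {xs = nonemptySubsets n} J∈)

  wordPolytope : ∀ {n} → Vec ℕ n → HypergraphicPolytope n
  wordPolytope f = 𝓕⁻¹ (orthogonal f)

  𝓕-word⁻ : ∀ {n} (f : Vec ℕ n) {J} → 𝓕 (wordPolytope f) J → UniqueMin (lookup f) J
  𝓕-word⁻ f (_ , 0<) = ∈-orthogonal⁻ f (coefficient-pos⁻ (orthogonal f) 0<)

  𝓕-word⁺ : ∀ {n} (f : Vec ℕ n) {J} → UniqueMin (lookup f) J → 𝓕 (wordPolytope f) J
  𝓕-word⁺ f u = UniqueMin⇒Nonempty {f = lookup f} u , coefficient-pos⁺ (orthogonal f) (∈-orthogonal⁺ f u)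

  infix 4 _⊑_
  _⊑_ : ∀ {n} → Vec ℕ n → Vec ℕ n → Set
  f ⊑ h = ∀ J → UniqueMin (lookup f) J → UniqueMin (lookup h) J

  generic⇒⊑ : ∀ {n} (f h : Vec ℕ n) → IsGeneric (wordPolytope f) h → f ⊑ h
  generic⇒⊑ f h gen J u = generic⇒uniqueMin (wordPolytope f) h gen (𝓕-word⁺ f u)

  word-generic : ∀ {n} (f : Vec ℕ n) → IsGeneric (wordPolytope f) f
  word-generic f = uniqueMin⇒generic (wordPolytope f) f (𝓕-word⁻ f)

  ⊑-antisym-≃ : ∀ {n} (f h : Vec ℕ n) → f ⊑ h → h ⊑ f → [ wordPolytope f ] ≃ [ wordPolytope h ]
  ⊑-antisym-≃ f h f⊑h h⊑f = simple-≃ {𝔭 = wordPolytope f} {wordPolytope h}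
    (λ {J} J∈ → 𝓕-word⁺ h (f⊑h J (𝓕-word⁻ f J∈))) (λ {J} J∈ → 𝓕-word⁺ f (h⊑f J (𝓕-word⁻ h J∈)))

  -- The permutation between the words carries unique minimisers along, hence permutes the
  -- coefficients and gives an isomorphism relation.
  ↭⇒≃ : ∀ {n} (f h : Vec ℕ n) → toList f ↭ toList h → [ wordPolytope f ] ≃ [ wordPolytope h ]
  ↭⇒≃ f h f↭h with ↭⇒permutation h f (↭-sym f↭h)
  ... | σ , h≡ = difference⇒≃ (isomorphism (wordPolytope f) (wordPolytope h) σ
    (⟦⟧-permute-≐ (wordPolytope h) (wordPolytope f) σ same))
    where
    same : ∀ J → coefficient (wordPolytope f) (image σ J) ℝ.≈ coefficient (wordPolytope h) J
    same J with em {P = UniqueMin (lookup h) J}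
    ... | yes u = ℝ.trans
      (coefficient-∈ (orthogonal f) (∈-orthogonal⁺ f (UniqueMin-image {f = lookup f} {lookup h} σ h≡ u)))
      (ℝ.sym (coefficient-∈ (orthogonal h) (∈-orthogonal⁺ h u)))
    ... | no ¬u = ℝ.trans
      (coefficient-∉ (orthogonal f) λ J∈ → ¬u (UniqueMin-image⁻ {f = lookup f} {lookup h} σ h≡ (∈-orthogonal⁻ f J∈)))
      (ℝ.sym (coefficient-∉ (orthogonal h) λ J∈ → ¬u (∈-orthogonal⁻ h J∈)))

  rankʷ : Word → ℕ
  rankʷ (_ , f) = rank (lookup f)

  [_]ʷ : Word → HGP
  [ _ , f ]ʷ = [ wordPolytope f ]

  countʷ : Word → Monomial → ℕ
  countʷ (_ , f) = count (wordPolytope f)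

  -- As g ⊑ h forces rank g ≤ rank h = rank f, the matrix of coefficients is triangular.
  triangular : ∀ u {n} (f : Vec ℕ n) → countʷ u (toList f) ≡ 0 ⊎
    (Σ (Vec ℕ n) λ g → Σ (Vec ℕ n) λ h → u ≡ (n , g) × g ⊑ h × toList h ↭ toList f)
  triangular (n′ , g) {n} f with count-zero? (wordPolytope g) (toList f)
  ... | inj₁ eq = inj₁ eq
  -- Rearrangements have equal length, so `g` and `f` belong to the same dimension.
  ... | inj₂ (h , gen , h↭f)
    with ≡.trans (≡.sym (Vec.length-toList h)) (≡.trans (↭.↭-length h↭f) (Vec.length-toList f))
  ...   | ≡.refl = inj₂ (g , h , ≡.refl , generic⇒⊑ g h gen , h↭f)

  -- Spanning by word polytopes

  combination : List (K.Carrier × Word) → HGP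
  combination = foldr (λ (a , w) x → a · [ w ]ʷ +ᴴ x) 0ᴴ

  combination-++ : ∀ L M → combination (L ++ M) ≈ᴴ combination L +ᴴ combination M
  combination-++ []      M = ≈-sym (+-identityˡ _)
  combination-++ (_ ∷ L) M = ≈-trans (+-cong ≈-refl (combination-++ L M)) (≈-sym (+-assoc _ _ _))

  combination-· : ∀ a L → combination (map (λ (b , w) → a K.* b , w) L) ≈ᴴ a · combination L
  combination-· a []            = ≈-sym (·-zeroʳ a)
  combination-· a ((b , w) ∷ L) =
    ≈-trans (+-cong (·-assoc a b _) (combination-· a L)) (≈-sym (·-distribˡ a _ _))

  combination-↭ : ∀ {L M} → L ↭ M → combination L ≈ᴴ combination M
  combination-↭ ↭.refl          = ≈-refl
  combination-↭ (↭.prep _ L↭M)   = +-cong ≈-refl (combination-↭ L↭M)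
  combination-↭ (↭.swap _ _ L↭M) =
    ≈-trans (+-cong ≈-refl (+-cong ≈-refl (combination-↭ L↭M))) (x∙yz≈y∙xz _ _ _)
  combination-↭ (↭.trans p q)    = ≈-trans (combination-↭ p) (combination-↭ q)

  Spanned : HGP → Set (c ⊔ ℓ)
  Spanned x = ∃[ L ] x ≃ combination L

  spanned-≃ : ∀ {x y} → x ≃ y → Spanned y → Spanned x
  spanned-≃ x≃y (L , y≃) = L , ≃-trans x≃y y≃

  spanned-+ : ∀ {x y} → Spanned x → Spanned y → Spanned (x +ᴴ y)
  spanned-+ (L , x≃) (M , y≃) = L ++ M , ≃-trans (≃-+ x≃ y≃) (≈⇒≃ (≈-sym (combination-++ L M)))

  spanned-· : ∀ a {x} → Spanned x → Spanned (a · x)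
  spanned-· a (L , x≃) = map (λ (b , w) → a K.* b , w) L , ≃-trans (≃-· a x≃) (≈⇒≃ (≈-sym (combination-· a L)))

  spanned-word : ∀ w → Spanned [ w ]ʷ
  spanned-word w = (K.1# , w) ∷ [] , ≈⇒≃ (≈-sym (≈-trans (H.identityʳ _) (·-identityˡ _)))

  -- The measure that decreases along the expansion in `spanned-polytope`.
  missing : ∀ {n} → HypergraphicPolytope n → ℕ
  missing {n} 𝔮 = length (filter (λ J → em {P = ¬ 𝓕 𝔮 J}) (nonemptySubsets n))

  module _ {n} (𝔮 : HypergraphicPolytope n) where

    private
      in? : ∀ J → Dec (𝓕 𝔮 J)
      in? J = em

      out? : ∀ J → Dec (¬ 𝓕 𝔮 J)
      out? J = em

    present absent : Family n
    present = record
      { members  = filter in? (nonemptySubsets n)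
      ; unique   = Unique.filter⁺ in? (nonemptySubsets-unique n)
      ; nonempty = All.tabulate λ J∈ → ∈-nonemptySubsets⁻ (proj₁ (∈-filter⁻ in? {xs = nonemptySubsets n} J∈))
      }
    absent = record
      { members  = filter out? (nonemptySubsets n)
      ; unique   = Unique.filter⁺ out? (nonemptySubsets-unique n)
      ; nonempty = All.tabulate λ J∈ → ∈-nonemptySubsets⁻ (proj₁ (∈-filter⁻ out? {xs = nonemptySubsets n} J∈))
      }

    ∈-present⁺ : ∀ {J} → 𝓕 𝔮 J → J ∈ members present
    ∈-present⁺ J∈ = ∈-filter⁺ in? (∈-nonemptySubsets⁺ (proj₁ J∈)) J∈

    ∈-present⁻ : ∀ {J} → J ∈ members present → 𝓕 𝔮 J
    ∈-present⁻ J∈ = proj₂ (∈-filter⁻ in? {xs = nonemptySubsets n} J∈)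

    ∈-absent⁺ : ∀ {J} → Nonempty J → ¬ 𝓕 𝔮 J → J ∈ members absent
    ∈-absent⁺ ne J∉ = ∈-filter⁺ out? (∈-nonemptySubsets⁺ ne) J∉

    ∈-absent⁻ : ∀ {J} → J ∈ members absent → ¬ 𝓕 𝔮 J
    ∈-absent⁻ J∈ = proj₂ (∈-filter⁻ out? {xs = nonemptySubsets n} J∈)

    -- A set composition outside the union would be orthogonal to exactly the sets in `𝓕 𝔮`, and its
    -- word of block indices would have that family.
    covering : ¬ (∃[ f ] ∀ J → (𝓕 𝔮 J → UniqueMin (lookup {n = n} f) J) × (UniqueMin (lookup f) J → 𝓕 𝔮 J)) →
               ∀ π → (∃[ A ] A ∈ members present × ¬ Orth A π) ⊎ (∃[ B ] B ∈ members absent × Orth B π)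
    covering not-word π with em {P = ∃[ A ] A ∈ members present × ¬ Orth A π}
    ... | yes A = inj₁ A
    ... | no ¬A with em {P = ∃[ B ] B ∈ members absent × Orth B π}
    ...   | yes B = inj₂ B
    ...   | no ¬B = contradiction (tabulate index , λ J → to J , from J) not-word
      where
      index = blockIndex (SetComposition.blocks π)
      to : ∀ J → 𝓕 𝔮 J → UniqueMin (lookup (tabulate index)) J
      to J J∈ with em {P = Orth J π}
      ... | yes orth = UniqueMin-cong (λ i → ≡.sym (Vec.lookup∘tabulate index i)) (Orth⇒UniqueMin π orth)
      ... | no ¬orth = contradiction (J , ∈-present⁺ J∈ , ¬orth) ¬A
      from : ∀ J → UniqueMin (lookup (tabulate index)) J → 𝓕 𝔮 J
      from J u with in? J
      ... | yes J∈ = J∈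
      ... | no  J∉ = contradiction
        (J , ∈-absent⁺ (UniqueMin⇒Nonempty {f = lookup (tabulate index)} u) J∉ ,
         UniqueMin⇒Orth π (UniqueMin-cong (Vec.lookup∘tabulate index) u)) ¬B

    enlarged : List (Subset n) → HypergraphicPolytope n
    enlarged 𝒯 = 𝓕⁻¹ (members present) ⊕ 𝓕⁻¹ 𝒯

    𝓕-enlarged : ∀ 𝒯 {J} → 𝓕 𝔮 J → 𝓕 (enlarged 𝒯) J
    𝓕-enlarged 𝒯 J∈ = proj₁ J∈ ,
      ⊕-pos⁺ˡ (𝓕⁻¹ (members present)) (𝓕⁻¹ 𝒯) (coefficient-pos⁺ (members present) (∈-present⁺ J∈))

    -- The first member of `𝒯` is absent from `𝔮` and present in the enlarged polytope, while no set
    -- is lost.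
    missing-enlarged : ∀ {𝒯} → 𝒯 ∈ sublists (members absent) → 𝒯 ≢ [] → missing (enlarged 𝒯) ℕ.< missing 𝔮
    missing-enlarged {[]}    _  ≢[] = contradiction ≡.refl ≢[]
    missing-enlarged {B ∷ 𝒯} 𝒯∈ _   = count-strict _ _ (nonemptySubsets n)
      (λ _ J∉ J∈ → J∉ (𝓕-enlarged (B ∷ 𝒯) J∈)) (∈-nonemptySubsets⁺ B≠∅) (∈-absent⁻ B∈)
      (λ B∉ → B∉ (B≠∅ , ⊕-pos⁺ʳ (𝓕⁻¹ (members present)) (𝓕⁻¹ (B ∷ 𝒯))
        (coefficient-pos⁺ (B ∷ 𝒯) (here ≡.refl))))
      where
      B∈ : B ∈ members absent
      B∈ = sublists-⊆ (members absent) 𝒯∈ (here ≡.refl)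
      B≠∅ : Nonempty B
      B≠∅ = All.lookup (nonempty absent) B∈

    -- `𝓕⁻¹` replaces all positive coefficients by 1, so in general the two polytopes agree only up
    -- to a simple relation.
    enlarged-[] : [ enlarged [] ] ≃ [ 𝔮 ]
    enlarged-[] = simple-≃ {𝔭 = enlarged []} {𝔮}
      (λ {J} (_ , 0<) → [ ∈-present⁻ ∘ coefficient-pos⁻ (members present)
                    , (λ 0<′ → contradiction (coefficient-pos⁻ [] {J} 0<′) Any.¬Any[]) ]′
                    (⊕-pos⁻ (𝓕⁻¹ (members present)) (𝓕⁻¹ []) 0<))
      (𝓕-enlarged [])

  -- Unless 𝓕 𝔮 comes from a word, the sets in it and the remaining ones are the families
  -- of a modular relation, whose other terms are polytopes with more sets.
  spanned-polytope : ∀ k {n} (𝔮 : HypergraphicPolytope n) → missing 𝔮 ℕ.< k → Spanned [ 𝔮 ]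
  spanned-polytope (suc k) {n} 𝔮 missing<k
    with em {P = ∃[ f ] ∀ J → (𝓕 𝔮 J → UniqueMin (lookup {n = n} f) J) × (UniqueMin (lookup f) J → 𝓕 𝔮 J)}
  ... | yes (f , same) = spanned-≃
    (simple-≃ {𝔭 = 𝔮} {wordPolytope f}
      (λ {J} J∈ → 𝓕-word⁺ f (proj₁ (same J) J∈)) (λ {J} J∈ → proj₂ (same J) (𝓕-word⁻ f J∈)))
    (spanned-word (n , f))
  ... | no not-word with sublists-[] (members (absent 𝔮))
  ...   | 𝒯s , 𝒯s-eq , 𝒯s≢[] = spanned-≃ isolated (spanned-· (K.- K.1#) (spanned-sum 𝒯s spanned-terms))
    where
    term : List (Subset n) → HGP
    term 𝒯 = ((K.- K.1#) ^ length 𝒯) · [ enlarged 𝔮 𝒯 ]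
    spanned-sum : ∀ 𝒰s → (∀ {𝒯} → 𝒯 ∈ 𝒰s → Spanned (term 𝒯)) → Spanned (sumᴴ (map term 𝒰s))
    spanned-sum []       _ = [] , ≈⇒≃ ≈-refl
    spanned-sum (𝒯 ∷ 𝒰s) s = spanned-+ (s (here ≡.refl)) (spanned-sum 𝒰s (s ∘ there))
    spanned-terms : ∀ {𝒯} → 𝒯 ∈ 𝒯s → Spanned (term 𝒯)
    spanned-terms {𝒯} 𝒯∈ = spanned-· _ (spanned-polytope k (enlarged 𝔮 𝒯) (ℕ.<-≤-trans
      (missing-enlarged 𝔮 (≡.subst (𝒯 ∈_) (≡.sym 𝒯s-eq) (∈-++⁺ˡ 𝒯∈)) (All.lookup 𝒯s≢[] 𝒯∈))
      (ℕ.≤-pred missing<k)))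
    sum-++ : ∀ 𝒰s → sumᴴ (map term (𝒰s ++ [] ∷ [])) ≈ᴴ sumᴴ (map term 𝒰s) +ᴴ [ enlarged 𝔮 [] ]
    sum-++ []       = ≈-trans (+-comm _ 0ᴴ) (+-cong ≈-refl (·-identityˡ _))
    sum-++ (𝒯 ∷ 𝒰s) = ≈-trans (+-cong ≈-refl (sum-++ 𝒰s)) (≈-sym (+-assoc _ _ _))
    disjoint : ∀ {J} → ¬ (J ∈ members (present 𝔮) × J ∈ members (absent 𝔮))
    disjoint (J∈ , J∈′) = ∈-absent⁻ 𝔮 J∈′ (∈-present⁻ 𝔮 J∈)
    -- The terms of the modular relation with non-empty `𝒯`; the remaining term has sign 1 and is
    -- congruent to `[ 𝔮 ]`.
    S = sumᴴ (map term 𝒯s)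
    vanishing : S +ᴴ [ 𝔮 ] ≃ 0ᴴ
    vanishing = begin
      S +ᴴ [ 𝔮 ]                                      ≈⟨ ≃-+ (≈⇒≃ ≈-refl) (≃-sym (enlarged-[] 𝔮)) ⟩
      S +ᴴ [ enlarged 𝔮 [] ]                          ≈⟨ ≈⇒≃ (sum-++ 𝒯s) ⟨
      sumᴴ (map term (𝒯s ++ [] ∷ []))                 ≡⟨ ≡.cong (sumᴴ ∘ map term) 𝒯s-eq ⟨
      modularSum (present 𝔮) (absent 𝔮)               ≈⟨ span⇒≃0 (generator (modular (present 𝔮) (absent 𝔮)
                                                           disjoint (covering 𝔮 not-word))) ⟩
      0ᴴ                                              ∎
      where open ≃-Reasoning
    isolated : [ 𝔮 ] ≃ (K.- K.1#) · S
    isolated = begin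
      [ 𝔮 ]                                 ≈⟨ ≈⇒≃ (+-identityˡ _) ⟨
      0ᴴ +ᴴ [ 𝔮 ]                           ≈⟨ ≃-+ (≈⇒≃ (≈-trans (+-comm _ S) (inverseʳ S))) (≈⇒≃ ≈-refl) ⟨
      ((K.- K.1#) · S +ᴴ S) +ᴴ [ 𝔮 ]        ≈⟨ ≈⇒≃ (+-assoc _ S _) ⟩
      (K.- K.1#) · S +ᴴ (S +ᴴ [ 𝔮 ])        ≈⟨ ≃-+ (≈⇒≃ ≈-refl) vanishing ⟩
      (K.- K.1#) · S +ᴴ 0ᴴ                  ≈⟨ ≈⇒≃ (H.identityʳ _) ⟩
      (K.- K.1#) · S                        ∎
      where open ≃-Reasoning

  spanned : ∀ x → Spanned x
  spanned [ 𝔮 ]    = spanned-polytope (suc (missing 𝔮)) 𝔮 ℕ.≤-refl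
  spanned 0ᴴ       = [] , ≈⇒≃ ≈-refl
  spanned (x +ᴴ y) = spanned-+ (spanned x) (spanned y)
  spanned (a · x)  = spanned-· a (spanned x)

  -- Linear independence

  -- Characteristic zero enters here and in `multiplicity-inverse`: positive multiplicities are
  -- invertible.
  *-cancel-suc : ∀ {a} k → a K.* (suc k ×ℕ K.1#) K.≈ K.0# → a K.≈ K.0#
  *-cancel-suc {a} k eq with inverse (suc k ×ℕ K.1#) (char0 k)
  ... | y , ky≈1 = begin
    a                                    ≈⟨ K.*-identityʳ a ⟨
    a K.* K.1#                           ≈⟨ K.*-congˡ ky≈1 ⟨
    a K.* ((suc k ×ℕ K.1#) K.* y)        ≈⟨ K.*-assoc a _ y ⟨
    (a K.* (suc k ×ℕ K.1#)) K.* y        ≈⟨ K.*-congʳ eq ⟩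
    K.0# K.* y                           ≈⟨ K.zeroˡ y ⟩
    K.0#                                 ∎
    where open K-Reasoning

  Ψ-combination-zero : ∀ m L → All (λ (_ , w) → countʷ w m ≡ 0) L → (Ψ (combination L) ⟨$⟩ m) K.≈ K.0#
  Ψ-combination-zero m []            []         = K.refl
  Ψ-combination-zero m ((a , w) ∷ L) (eq ∷ eqs) = K.trans
    (K.+-cong (K.trans (K.*-congˡ (×-congˡ eq)) (K.zeroʳ a)) (Ψ-combination-zero m L eqs)) (K.+-identityˡ _)

  -- Take a term `w` of least rank. If another term is congruent to it, the two are merged.
  -- Otherwise no other term contributes to the monomial of `w`, so its coefficient is zero and the
  -- term is dropped. Either way the list becomes shorter; `k` bounds its length.
  combination-kernel : ∀ k L → length L ℕ.< k → Ψ (combination L) ≈ˢ 0ˢ → combination L ≃ 0ᴴ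
  combination-kernel k       []      _   _   = ≈⇒≃ ≈-refl
  combination-kernel (suc k) (e ∷ L) L<k Ψ≈0 with extractMin (rankʷ ∘ proj₂) e L
  ... | (a , w@(n , f)) , L′ , L↭ , min with em {P = ∃[ e′ ] e′ ∈ L′ × [ proj₂ e′ ]ʷ ≃ [ w ]ʷ}
  ...   | yes ((b , v) , v∈ , v≃w) with ∈⇒↭ v∈
  ...     | L″ , L′↭ = ≃-trans merge
    (combination-kernel k ((a K.+ b , w) ∷ L″) shorter
      (λ m → K.trans (K.sym (≃⇒Ψ≈ merge m)) (Ψ≈0 m)))
    where
    open ≃-Reasoning
    merge : combination (e ∷ L) ≃ combination ((a K.+ b , w) ∷ L″)
    merge = begin
      combination (e ∷ L)                                 ≈⟨ ≈⇒≃ (combination-↭ (↭-trans L↭ (↭.prep _ L′↭))) ⟩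
      a · [ w ]ʷ +ᴴ (b · [ v ]ʷ +ᴴ combination L″)        ≈⟨ ≃-+ (≈⇒≃ ≈-refl) (≃-+ (≃-· b v≃w) (≈⇒≃ ≈-refl)) ⟩
      a · [ w ]ʷ +ᴴ (b · [ w ]ʷ +ᴴ combination L″)        ≈⟨ ≈⇒≃ (+-assoc _ _ _) ⟨
      (a · [ w ]ʷ +ᴴ b · [ w ]ʷ) +ᴴ combination L″        ≈⟨ ≈⇒≃ (+-cong (·-distribʳ a b _) ≈-refl) ⟨
      (a K.+ b) · [ w ]ʷ +ᴴ combination L″                ∎
    shorter : suc (length L″) ℕ.< k
    shorter = ≡.subst (ℕ._< k) (≡.trans (ℕ.suc-injective (↭.↭-length L↭)) (↭.↭-length L′↭)) (ℕ.≤-pred L<k)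
  combination-kernel (suc k) (e ∷ L) L<k Ψ≈0 | (a , w@(n , f)) , L′ , L↭ , min | no isolated =
    ≃-trans drop (combination-kernel k L′ shorter (λ m → K.trans (K.sym (≃⇒Ψ≈ drop m)) (Ψ≈0 m)))
    where
    open K-Reasoning
    others : All (λ (_ , v) → countʷ v (toList f) ≡ 0) L′
    others = All.tabulate λ {e′} → other e′
      where
      other : ∀ e′ → e′ ∈ L′ → countʷ (proj₂ e′) (toList f) ≡ 0
      other e′@(b , v) v∈ with triangular v f
      ... | inj₁ eq = eq
      -- By minimality `g` has rank at least that of `h`, so `g ⊑ h` is an equality of families and
      -- this term would be congruent to `w`.
      ... | inj₂ (g , h , ≡.refl , g⊑h , h↭f) = contradiction
        (e′ , v∈ , ≃-trans (⊑-antisym-≃ g h g⊑h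
          (rank-reflects g⊑h (ℕ.≤-trans (ℕ.≤-reflexive (rank-↭ h f h↭f)) (All.lookup min v∈))))
          (↭⇒≃ h f h↭f)) isolated
    a≈0 : a K.≈ K.0#
    a≈0 with count-positive (wordPolytope f) f (word-generic f)
    -- In the coefficient of the monomial of `f` only the first term is left.
    ... | N , eq = *-cancel-suc N (begin
      a K.* (suc N ×ℕ K.1#)                                       ≈⟨ K.*-congˡ (×-congˡ eq) ⟨
      a K.* (countʷ w (toList f) ×ℕ K.1#)                         ≈⟨ K.+-identityʳ _ ⟨
      a K.* (countʷ w (toList f) ×ℕ K.1#) K.+ K.0#                ≈⟨ K.+-congˡ (Ψ-combination-zero (toList f) L′ others) ⟨
      (Ψ (combination ((a , w) ∷ L′)) ⟨$⟩ toList f)               ≈⟨ Ψ-cong (combination-↭ L↭) (toList f) ⟨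
      (Ψ (combination (e ∷ L)) ⟨$⟩ toList f)                      ≈⟨ Ψ≈0 (toList f) ⟩
      K.0#                                                        ∎)
    drop : combination (e ∷ L) ≃ combination L′
    drop = ≈⇒≃ (≈-trans (combination-↭ L↭) (≈-trans
      (+-cong (≈-trans (·-cong a≈0 ≈-refl) (·-zeroˡ _)) ≈-refl) (+-identityˡ _)))
    shorter : length L′ ℕ.< k
    shorter = ≡.subst (ℕ._≤ k) (↭.↭-length L↭) (ℕ.≤-pred L<k)

  kernel⇒span : ∀ x → Ψ x ≈ˢ 0ˢ → Span Relation x
  kernel⇒span x Ψx≈0 with spanned x
  ... | L , x≃ = ≃0⇒span (≃-trans x≃ (combination-kernel (suc (length L)) L ℕ.≤-refl
    λ m → K.trans (K.sym (≃⇒Ψ≈ x≃ m)) (Ψx≈0 m)))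

  -- Surjectivity onto the quasisymmetric functions

  standardise : ∀ {n} → Vec ℕ n → Vec ℕ n
  standardise {n} f = tabulate (below (lookup f))

  module _ {F : PowerSeries} (quasi : Quasisymmetric F) where

    -- The number of letters smaller than `v` is strictly monotone in `v` on the letters of `f`, and
    -- relabelling by it standardises `f`.
    quasisymmetric-standardise : ∀ {n} (f : Vec ℕ n) → (F ⟨$⟩ toList f) K.≈ (F ⟨$⟩ toList (standardise f))
    quasisymmetric-standardise {n} f = K.trans
      (quasisymmetric-relabel {F} quasi {toList f} {position} monotone)
      (K.reflexive (≡.cong (F ⟨$⟩_) (≡.trans (≡.sym (Vec.toList-map position f)) (≡.cong toList relabelled))))
      where
      position : ℕ → ℕ
      position v = length (filter (λ i → lookup f i ℕ.<? v) (allFin n))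
      monotone : StrictlyMonotoneOn (toList f) position
      monotone x∈ y∈ x<y with ∈-toList⁻ f x∈ | ∈-toList⁻ f y∈
      ... | i , ≡.refl | j , ≡.refl = below-< (lookup f) {i} {j} x<y
      relabelled : Vec.map position f ≡ standardise f
      relabelled = ≡.trans (≡.cong (Vec.map position) (≡.sym (Vec.tabulate∘lookup f)))
        (≡.sym (Vec.tabulate-∘ position (lookup f)))

    -- `f` and `h` need not be relabellings of each other, but their standardisations have the same
    -- monomial by `below-↭`.
    quasisymmetric-⊑ : ∀ {n} {f h : Vec ℕ n} → f ⊑ h → h ⊑ f → (F ⟨$⟩ toList f) K.≈ (F ⟨$⟩ toList h)
    quasisymmetric-⊑ {f = f} {h} f⊑h h⊑f = K.trans (quasisymmetric-standardise f)
      (K.trans (Func.cong F (below-↭ f⊑h h⊑f)) (K.sym (quasisymmetric-standardise h)))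

  -- Standardised words of length `n` have letters below `n`, so this finite list contains those of
  -- length at most `d`. It suffices to test whether a quasisymmetric function of degree at most `d`
  -- vanishes.
  words : ℕ → List Word
  words d = concatMap (λ n → map (n ,_) (boundedFunctions n n)) (upTo (suc d))

  ∈-words⁺ : ∀ {d n} (f : Vec ℕ n) → n ℕ.≤ d → (∀ i → lookup f i ℕ.< n) → (n , f) ∈ words d
  ∈-words⁺ {n = n} f n≤d f<n = ∈-concatMap⁺ (λ n → map (n ,_) (boundedFunctions n n))
    (lose (∈-upTo⁺ (s≤s n≤d)) (∈-map⁺ (n ,_) (∈-boundedFunctions⁺ f f<n)))

  words-degree : ∀ {d w} → w ∈ words d → proj₁ w ℕ.≤ d
  words-degree {d} w∈ with find
    (∈-concatMap⁻ (λ n → map (n ,_) (boundedFunctions n n)) {xs = upTo (suc d)} w∈)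
  ... | n , n∈ , w∈′ with ∈-map⁻ (n ,_) w∈′
  ...   | f , _ , ≡.refl = ℕ.≤-pred (∈-upTo⁻ n∈)

  module Subtraction {d n} (f : Vec ℕ n) (n≤d : n ℕ.≤ d) (F : PowerSeries) (quasi : Quasisymmetric F)
    (bounded : ∀ m → d ℕ.< length m → (F ⟨$⟩ m) K.≈ K.0#) where

    private
      𝔭 = wordPolytope f

      multiplicity-inverse : ∃[ y ] (count 𝔭 (toList f) ×ℕ K.1#) K.* y K.≈ K.1#
      multiplicity-inverse with count-positive 𝔭 f (word-generic f)
      ... | N , eq = let y , Ny≈1 = inverse (suc N ×ℕ K.1#) (char0 N) in
        y , K.trans (K.*-congʳ (×-congˡ eq)) Ny≈1

      y = proj₁ multiplicity-inverse

    -- The coefficient of `F` at `f` divided by the diagonal coefficient of `𝔭`.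
    scalar : K.Carrier
    scalar = (F ⟨$⟩ toList f) K.* y

    remainder : PowerSeries
    remainder = F +ˢ (K.- scalar) ·ˢ Ψ[ 𝔭 ]

    remainder-quasisymmetric : Quasisymmetric remainder
    remainder-quasisymmetric α i j pos i↗ j↗ = K.+-cong (quasi α i j pos i↗ j↗)
      (K.*-congˡ (Ψ-quasisymmetric [ 𝔭 ] α i j pos i↗ j↗))

    remainder-absent : ∀ {m} → (F ⟨$⟩ m) K.≈ K.0# → count 𝔭 m ≡ 0 → (remainder ⟨$⟩ m) K.≈ K.0#
    remainder-absent Fm≈0 eq =
      K.trans (K.+-cong Fm≈0 (K.trans (K.*-congˡ (×-congˡ eq)) (K.zeroʳ _))) (K.+-identityˡ _)

    remainder-bounded : ∀ m → d ℕ.< length m → (remainder ⟨$⟩ m) K.≈ K.0#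
    remainder-bounded m d<m = remainder-absent (bounded m d<m)
      (count-degree 𝔭 m (ℕ.<⇒≢ (ℕ.≤-<-trans n≤d d<m)))

    remainder-leading : (remainder ⟨$⟩ toList f) K.≈ K.0#
    remainder-leading = begin
      Ff K.+ (K.- scalar) K.* N             ≈⟨ K.+-congˡ (-‿distribˡ-* scalar N) ⟨
      Ff K.+ K.- ((Ff K.* y) K.* N)         ≈⟨ K.+-congˡ (K.-‿cong (K.*-assoc Ff y N)) ⟩
      Ff K.+ K.- (Ff K.* (y K.* N))         ≈⟨ K.+-congˡ (K.-‿cong (K.*-congˡ
                                                 (K.trans (K.*-comm y N) (proj₂ multiplicity-inverse)))) ⟩
      Ff K.+ K.- (Ff K.* K.1#)              ≈⟨ K.+-congˡ (K.-‿cong (K.*-identityʳ Ff)) ⟩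
      Ff K.+ K.- Ff                         ≈⟨ K.-‿inverseʳ Ff ⟩
      K.0#                                  ∎
      where
      open K-Reasoning
      Ff = F ⟨$⟩ toList f
      N  = count 𝔭 (toList f) ×ℕ K.1#

    -- The monomial of a word w of rank at most that of f occurs in Ψ[ 𝔭 ] only if F takes
    -- the same value at w and at f; if that value is zero, nothing is subtracted.
    remainder-processed : ∀ w → (F ⟨$⟩ letters w) K.≈ K.0# → rankʷ w ℕ.≤ rank (lookup f) →
                          (remainder ⟨$⟩ letters w) K.≈ K.0#
    remainder-processed (n′ , g) Fg≈0 g≤f with triangular (n , f) g
    ... | inj₁ eq = remainder-absent Fg≈0 eq
    ... | inj₂ (_ , h , ≡.refl , f⊑h , h↭g) = K.trans
      (K.+-cong Fg≈0 (K.trans (K.*-congʳ -scalar≈0) (K.zeroˡ _))) (K.+-identityˡ _)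
      where
      Ff≈0 : (F ⟨$⟩ toList f) K.≈ K.0#
      Ff≈0 = K.trans
        (quasisymmetric-⊑ {F} quasi {f = f} {h} f⊑h
          (rank-reflects f⊑h (ℕ.≤-trans (ℕ.≤-reflexive (rank-↭ h g h↭g)) g≤f)))
        (K.trans (Func.cong F h↭g) Fg≈0)
      -scalar≈0 : K.- scalar K.≈ K.0#
      -scalar≈0 = K.trans (K.-‿cong (K.trans (K.*-congʳ Ff≈0) (K.zeroˡ y)))
        (K.trans (K.sym (K.+-identityˡ _)) (K.-‿inverseʳ K.0#))

    recover : ∀ {x} → Ψ x ≈ˢ remainder → Ψ (x +ᴴ scalar · [ 𝔭 ]) ≈ˢ F
    recover Ψx≈ m = K.trans
      (K.+-congʳ (Ψx≈ m)) (K.trans (K.+-assoc _ _ _)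
        (K.trans (K.+-congˡ (K.trans (K.sym (K.distribʳ _ _ _)) (K.trans (K.*-congʳ (K.-‿inverseˡ _)) (K.zeroˡ _))))
          (K.+-identityʳ _)))

  -- The invariant of the elimination: a word not in `U` has coefficient zero and rank at most that
  -- of each word still to be treated. The rank bound keeps its coefficient zero under later
  -- subtractions.
  Settled : ℕ → List Word → PowerSeries → Set ℓ
  Settled d U F = ∀ w → w ∈ words d →
    w ∈ U ⊎ ((F ⟨$⟩ letters w) K.≈ K.0# × All (λ u → rankʷ w ℕ.≤ rankʷ u) U)

  -- The value at a monomial is that at its standardisation, a word of the tested list when the
  -- degree is at most `d`.
  settled-[] : ∀ {d F} → Quasisymmetric F → (∀ m → d ℕ.< length m → (F ⟨$⟩ m) K.≈ K.0#) →
               Settled d [] F → F ≈ˢ 0ˢ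
  settled-[] {d} {F} quasi bounded settled m with length m ℕ.≤? d
  ... | no  m≰d = bounded m (ℕ.≰⇒> m≰d)
  ... | yes m≤d = K.trans
    (K.reflexive (≡.cong (F ⟨$⟩_) (≡.sym (Vec.toList∘fromList m))))
    (K.trans (quasisymmetric-standardise {F} quasi f) standard≈0)
    where
    f = Vec.fromList m
    standard≈0 : (F ⟨$⟩ toList (standardise f)) K.≈ K.0#
    standard≈0 with settled (length m , standardise f) (∈-words⁺ (standardise f) m≤d λ i →
                      ≡.subst (ℕ._< length m) (≡.sym (Vec.lookup∘tabulate _ i)) (below<n (lookup f) i))
    ... | inj₂ (eq , _) = eq

  -- Each round takes from `U` a word of least rank and subtracts the multiple of its polytope that
  -- clears its coefficient; these multiples add up to the preimage.
  realise : ∀ d k U F → length U ℕ.< k → Quasisymmetric F → (∀ m → d ℕ.< length m → (F ⟨$⟩ m) K.≈ K.0#) →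
            All (λ u → proj₁ u ℕ.≤ d) U → Settled d U F → ∃[ x ] Ψ x ≈ˢ F
  realise d (suc k) []       F _   quasi bounded _       settled =
    0ᴴ , λ m → K.sym (settled-[] {d} {F} quasi bounded settled m)
  realise d (suc k) (u₀ ∷ U₀) F U<k quasi bounded degrees settled with extractMin rankʷ u₀ U₀
  ... | u@(n , f) , U , U↭ , min =
    let x , Ψx≈ = realise d k U remainder shorter remainder-quasisymmetric remainder-bounded
                    (All.tail degrees′) settled′
    in x +ᴴ scalar · [ wordPolytope f ] , recover {x} Ψx≈
    where
    degrees′ : All (λ v → proj₁ v ℕ.≤ d) (u ∷ U)
    degrees′ = ↭.All-resp-↭ U↭ degrees
    open Subtraction f (All.head degrees′) F quasi bounded
    shorter : length U ℕ.< k
    shorter = ≡.subst (ℕ._≤ k) (↭.↭-length U↭) (ℕ.≤-pred U<k)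
    settled′ : Settled d U remainder
    settled′ w w∈ with settled w w∈
    ... | inj₂ (Fw≈0 , w≤U₀) with ↭.All-resp-↭ U↭ w≤U₀
    ...   | w≤u ∷ w≤U = inj₂ (remainder-processed w Fw≈0 w≤u , w≤U)
    settled′ w w∈ | inj₁ w∈U₀ with ↭.∈-resp-↭ U↭ w∈U₀
    -- The word just treated now has coefficient zero, and by minimality its rank is at most those
    -- that remain.
    ... | here ≡.refl = inj₂ (remainder-leading , min)
    ... | there w∈U   = inj₁ w∈U

  quasisymmetric⇒image : ∀ F → IsQuasisymmetric F → ∃[ x ] Ψ x ≈ˢ F
  quasisymmetric⇒image F F-quasi =
    let d , bounded = IsQuasisymmetric.boundedDegree F-quasi in
    realise d (suc (length (words d))) (words d) F ℕ.≤-refl (IsQuasisymmetric.quasisymmetric F-quasi) bounded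
      (All.tabulate words-degree) (λ w → inj₁)

  image⇒quasisymmetric : ∀ F → ∃[ x ] Ψ x ≈ˢ F → IsQuasisymmetric F
  image⇒quasisymmetric F (x , Ψx≈F) = record
    { boundedDegree  = let d , bounded = Ψ-boundedDegree x in
                       d , λ m d<m → K.trans (K.sym (Ψx≈F m)) (bounded m d<m)
    ; quasisymmetric = λ α i j pos i↗ j↗ → K.trans (K.sym (Ψx≈F _))
                         (K.trans (Ψ-quasisymmetric x α i j pos i↗ j↗) (Ψx≈F _))
    }

theorem4 : ∀ (em : ∀ {a} → ExcludedMiddle a)
    {c ℓ} (K : CommutativeRing c ℓ) → IsField K → CharacteristicZero K →
    (ℝ : RealNumbers) →
    let open HGPSpace em K ℝ in
    ((x : HGP) → Ψ x ≈ˢ 0ˢ ⇔ Span Relation x)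
    × ((F : PowerSeries) → (∃[ x ] Ψ x ≈ˢ F) ⇔ IsQuasisymmetric F)
theorem4 em K isField char0 ℝ =
  (λ x → mk⇔ (kernel⇒span x) span⇒kernel) ,
  (λ F → mk⇔ (image⇒quasisymmetric F) (quasisymmetric⇒image F))
  where
  open Symmetrisation em K ℝ
  open Kernel em K isField char0 ℝ
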